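{- Let $\mathcal{F}$ be the smallest family of finite posets that contains every $\mathbf{X}$-free finite poset and is closed under disjoint unions and ordinal sums (i.e. if $A,B\in\mathcal{F}$ then $A\sqcup B\in\mathcal{F}$ and $(A<B)\in\mathcal{F}$). Then every poset $P\in\mathcal{F}$ satisfies \[ s_k(\mathcal{O}(P)) \le s_k(\mathcal{C}(P)) \] for all $k\ge 0$.
   Context: All posets are finite. $\mathbf{X}$ denotes the five-element poset $\{a,b,c,d,e\}$ with $a<c$, $b<c$, $c<d$, $c<e$ (and the relations implied by transitivity), where $a,b$ are incomparable and $d,e$ are incomparable. A poset is $\mathbf{X}$-free if it contains no subposet isomorphic to $\mathbf{X}$. $A\sqcup B$ is the disjoint union of posets and $A<B$ is the ordinal sum (the disjoint union in which additionally every element of $A$ is below every element of $B$). For a poset $P$, the order polytope is $\mathcal{O}(P)=\{x\in\mathbb{R}^P: 0\le x_p\le 1 \text{ for all } p,\ x_p\le x_q \text{ if } p\le q\}$ and the chain polytope is $\mathcal{C}(P)=\{x\in\mathbb{R}^P: x_p\ge 0 \text{ for all } p,\ x_{p_1}+\dots+x_{p_k}\le 1 \text{ whenever } p_1<\dots<p_k \text{ in } P\}$. For a polytope $\mathcal{P}$, $s_k(\mathcal{P})$ denotes the number of $k$-dimensional faces of $\mathcal{P}$ that are simplices.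
   Formalization: The order and chain polytopes, their faces and their simplices are taken in rational rather than real coordinates; since both polytopes have 0/1 vertices and rational inequalities, the counts s_k agree with the real ones. -}

module Defs where

open import Level using (0ℓ)
open import Data.Nat using (ℕ; zero; suc; _+_)
open import Data.Fin using (Fin; zero; suc)
open import Data.Fin.Properties using (+↔⊎)
open import Data.Bool using (Bool; true; false; T)
open import Data.Empty using (⊥)
open import Data.Unit using (⊤; tt)
open import Data.Sum using (_⊎_; inj₁; inj₂)
open import Data.Product using (Σ; ∃; _×_; _,_)
open import Data.List using (List; []; _∷_)
open import Data.List.Relation.Unary.Linked using (Linked)
open import Data.Rational using (ℚ; 0ℚ; 1ℚ) renaming (_+_ to _+ℚ_; _*_ to _*ℚ_; _≤_ to _≤ℚ_)
open import Function using (_∘_)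
open import Function.Bundles using (_↔_; Inverse)
open import Function.Properties.Inverse using (↔-trans; ↔-sym)
open import Data.Sum.Function.Propositional using (_⊎-↔_)
open import Relation.Binary using (Rel; IsPartialOrder; IsPreorder)
open import Relation.Binary.PropositionalEquality using (_≡_; _≢_; refl; isEquivalence; cong; subst)
open import Relation.Nullary using (¬_)

record FinPoset : Set₁ where
  field
    Carrier        : Set
    _≼_            : Rel Carrier 0ℓ
    isPartialOrder : IsPartialOrder _≡_ _≼_
    size           : ℕ
    enum           : Carrier ↔ Fin size

open FinPoset public

record _≅_ (P Q : FinPoset) : Set where
  field
    bij   : Carrier P ↔ Carrier Q
    order : ∀ p p' → (_≼_ P p p' → _≼_ Q (Inverse.to bij p) (Inverse.to bij p'))
                   × (_≼_ Q (Inverse.to bij p) (Inverse.to bij p') → _≼_ P p p')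

module _ (A B : FinPoset) where
  private
    C = Carrier A ⊎ Carrier B

  data _⊔≤_ : C → C → Set where
    l : ∀ {a a'} → _≼_ A a a' → inj₁ a ⊔≤ inj₁ a'
    r : ∀ {b b'} → _≼_ B b b' → inj₂ b ⊔≤ inj₂ b'

  data _⊕≤_ : C → C → Set where
    l  : ∀ {a a'} → _≼_ A a a' → inj₁ a ⊕≤ inj₁ a'
    r  : ∀ {b b'} → _≼_ B b b' → inj₂ b ⊕≤ inj₂ b'
    lr : ∀ {a b} → inj₁ a ⊕≤ inj₂ b

  private
    module PA = IsPartialOrder (isPartialOrder A)
    module PB = IsPartialOrder (isPartialOrder B)

  ⊔-po : IsPartialOrder _≡_ _⊔≤_
  ⊔-po = record
    { isPreorder = record
      { isEquivalence = isEquivalence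
      ; reflexive = λ { {inj₁ a} refl → l PA.refl ; {inj₂ b} refl → r PB.refl }
      ; trans = λ { (l x) (l y) → l (PA.trans x y) ; (r x) (r y) → r (PB.trans x y) } }
    ; antisym = λ { (l x) (l y) → cong inj₁ (PA.antisym x y)
                  ; (r x) (r y) → cong inj₂ (PB.antisym x y) } }

  ⊕-po : IsPartialOrder _≡_ _⊕≤_
  ⊕-po = record
    { isPreorder = record
      { isEquivalence = isEquivalence
      ; reflexive = λ { {inj₁ a} refl → l PA.refl ; {inj₂ b} refl → r PB.refl }
      ; trans = λ { (l x) (l y) → l (PA.trans x y) ; (r x) (r y) → r (PB.trans x y)
                  ; (l x) lr → lr ; lr (r y) → lr } }
    ; antisym = λ { (l x) (l y) → cong inj₁ (PA.antisym x y)
                  ; (r x) (r y) → cong inj₂ (PB.antisym x y) } }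

  ⊎-enum : C ↔ Fin (size A + size B)
  ⊎-enum = ↔-trans (enum A ⊎-↔ enum B) (↔-sym +↔⊎)

  _⊔_ : FinPoset
  _⊔_ = record { Carrier = C ; _≼_ = _⊔≤_ ; isPartialOrder = ⊔-po
               ; size = size A + size B ; enum = ⊎-enum }

  _⊕_ : FinPoset
  _⊕_ = record { Carrier = C ; _≼_ = _⊕≤_ ; isPartialOrder = ⊕-po
               ; size = size A + size B ; enum = ⊎-enum }

-- The poset X on {a,b,c,d,e} = {0,1,2,3,4}: a,b < c < d,e

xle : Fin 5 → Fin 5 → Bool
xle zero zero = true
xle zero (suc zero) = false
xle zero (suc (suc _)) = true
xle (suc zero) zero = false
xle (suc zero) (suc zero) = true
xle (suc zero) (suc (suc _)) = true
xle (suc (suc zero)) (suc (suc zero)) = true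
xle (suc (suc zero)) (suc (suc (suc _))) = true
xle (suc (suc (suc zero))) (suc (suc (suc zero))) = true
xle (suc (suc (suc (suc zero)))) (suc (suc (suc (suc zero)))) = true
xle _ _ = false

_≤X_ : Fin 5 → Fin 5 → Set
i ≤X j = T (xle i j)

ContainsX : FinPoset → Set
ContainsX P = Σ (Fin 5 → Carrier P) λ f →
  (∀ i j → f i ≡ f j → i ≡ j) ×
  (∀ i j → (_≼_ P (f i) (f j) → i ≤X j) × (i ≤X j → _≼_ P (f i) (f j)))

XFree : FinPoset → Set
XFree P = ¬ ContainsX P

-- The smallest family containing X-free posets, closed under disjoint
-- unions and ordinal sums (families of posets are taken up to isomorphism).
data InF : FinPoset → Set₁ where
  xfree  : ∀ {P} → XFree P → InF P
  union  : ∀ {A B} → InF A → InF B → InF (A ⊔ B)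
  ordsum : ∀ {A B} → InF A → InF B → InF (A ⊕ B)
  iso    : ∀ {P Q} → InF P → P ≅ Q → InF Q

sumF : ∀ {n} → (Fin n → ℚ) → ℚ
sumF {zero}  f = 0ℚ
sumF {suc n} f = f zero +ℚ sumF (f ∘ suc)

module Geometry (P : FinPoset) where
  Pt : Set
  Pt = Carrier P → ℚ

  ΣP : (Carrier P → ℚ) → ℚ
  ΣP f = sumF (f ∘ Inverse.from (enum P))

  _·_ : Pt → Pt → ℚ
  w · x = ΣP (λ p → w p *ℚ x p)

  Region : Set₁
  Region = Pt → Set

  SameSet : Region → Region → Set
  SameSet S T = ∀ x → (S x → T x) × (T x → S x)

  record Face (Q : Region) : Set where
    field
      w     : Pt
      c     : ℚ
      valid : ∀ x → Q x → w · x ≤ℚ c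

  faceSet : {Q : Region} → Face Q → Region
  faceSet {Q} F x = Q x × (Face.w F · x ≡ Face.c F)

  Conv : ∀ {m} → (Fin m → Pt) → Region
  Conv {m} v x = Σ (Fin m → ℚ) λ λs →
    (∀ i → 0ℚ ≤ℚ λs i) × (sumF λs ≡ 1ℚ) ×
    (∀ p → x p ≡ sumF (λ i → λs i *ℚ v i p))

  AffInd : ∀ {m} → (Fin m → Pt) → Set
  AffInd {m} v = ∀ (μ : Fin m → ℚ) → sumF μ ≡ 0ℚ →
    (∀ p → sumF (λ i → μ i *ℚ v i p) ≡ 0ℚ) → ∀ i → μ i ≡ 0ℚ

  IsSimplex : ℕ → Region → Set
  IsSimplex k S = Σ (Fin (suc k) → Pt) λ v → AffInd v × SameSet S (Conv v)

  SimplexFace : Region → ℕ → Set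
  SimplexFace Q k = Σ (Face Q) λ F → IsSimplex k (faceSet F)

  -- s_k(Q) = m : an enumeration of the k-dimensional simplex faces of Q
  -- (faces identified when they are equal as point sets)
  HasSimplexCount : Region → ℕ → ℕ → Set
  HasSimplexCount Q k m = Σ (Fin m → SimplexFace Q k) λ e →
    (∀ i j → SameSet (faceSet (Data.Product.proj₁ (e i))) (faceSet (Data.Product.proj₁ (e j))) → i ≡ j) ×
    (∀ (G : SimplexFace Q k) → Σ (Fin m) λ i →
       SameSet (faceSet (Data.Product.proj₁ G)) (faceSet (Data.Product.proj₁ (e i))))

  sumL : Pt → List (Carrier P) → ℚ
  sumL x [] = 0ℚ
  sumL x (p ∷ ps) = x p +ℚ sumL x ps

  OrderPoly : Region
  OrderPoly x = (∀ p → (0ℚ ≤ℚ x p) × (x p ≤ℚ 1ℚ)) ×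
                (∀ p q → _≼_ P p q → x p ≤ℚ x q)

  IsChain : List (Carrier P) → Set
  IsChain = Linked (λ p q → _≼_ P p q × p ≢ q)

  ChainPoly : Region
  ChainPoly x = (∀ p → 0ℚ ≤ℚ x p) ×
                (∀ ps → IsChain ps → sumL x ps ≤ℚ 1ℚ)

s_[O_]≡_ : ℕ → FinPoset → ℕ → Set
s k [O P ]≡ m = Geometry.HasSimplexCount P (Geometry.OrderPoly P) k m

s_[C_]≡_ : ℕ → FinPoset → ℕ → Set
s k [C P ]≡ m = Geometry.HasSimplexCount P (Geometry.ChainPoly P) k m

{-# OPTIONS --safe #-}
-- Write 1_F for the indicator of a filter F. The simplex faces of O(P) are the sets of filters that are pairwise
-- joined by an edge, where F – G is an edge if 1_F + 1_G is not a sum of two filter indicators in another way.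
-- Faces containing a fixed vertex v are counted by the link of v, and the empty face is allowed throughout.
--
-- If P is X-free, the elements below p or those above p form a chain, for every p. Passing from each coordinate to
-- its difference with the next one along this chain is an affine isomorphism O(P) → C(P).
--
-- For a disjoint union the polytopes multiply, and a face of a product is a simplex only if one factor is a vertex.
-- For an ordinal sum both polytopes are glued at a vertex v: with a the simplices through v and b those avoiding v,
-- the new count is a a' + b b'. On the chain side v is the origin and a counts the chains of P. Chains embed in the
-- link of v on the order side (as principal filters), so the order side has a surplus d in a, which is the deficit
-- in b. The terms involving d are absorbed because a(order) ≤ b(chain), at both the empty and the full filter: this
-- inequality is carried along in the induction. For X-free posets it holds because in any simplicial complex there
-- are at least as many simplices avoiding u as there are simplices in the link of v.
--
-- All counts are compared by degree preserving injections. The order of P need not be decidable, but the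
-- conclusion is, so the argument may run under a double negation.
module Submission where

open import Defs
open import Data.Nat using (ℕ; _≤_; zero; suc; _+_; _^_; z≤n; s≤s)
open import Data.Nat.Properties using (≤-antisym; ≤-trans; +-suc; +-comm; +-identityʳ; suc-injective) renaming (_≤?_ to _≤?ℕ_)
open import Data.Bool using (Bool; true; false; if_then_else_; _∧_; _∨_; not) renaming (_≟_ to _≟B_)
open import Data.Bool.Properties using (T?)
open import Data.Fin using (Fin; zero; suc; punchOut; combine; funToFin; finToFun)
open import Data.Fin.Patterns using (0F; 1F; 2F; 3F; 4F)
open import Data.Fin.Properties using (punchOut-cong; punchOut-injective; finToFun-funToFin; injective⇒≤; all?; any?) renaming (_≟_ to _≟F_)
open import Data.Unit using (⊤; tt)
open import Data.Empty using (⊥; ⊥-elim)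
open import Data.Sum using (_⊎_; inj₁; inj₂; [_,_]′)
open import Data.Sum.Properties using (inj₁-injective; inj₂-injective)
open import Data.Product using (Σ; _×_; _,_; proj₁; proj₂; swap)
open import Data.List using (List; []; _∷_; length; map; allFin; tabulate; lookup; _++_)
open import Data.List.Properties using (length-map; length-++; length-tabulate)
open import Data.List.Relation.Unary.Any using (Any; here; there) renaming (any? to anyL?)
open import Data.List.Relation.Unary.Any.Properties using (++⁺ˡ; ++⁺ʳ; ++⁻)
open import Data.List.Relation.Unary.All using (All; []; _∷_) renaming (all? to all?ᴸ; lookup to lookupAll)
open import Data.List.Relation.Unary.Linked using ([]; [-]; _∷_) renaming (tail to tailᴸ)
open import Data.List.Relation.Unary.Unique.Propositional using (Unique; []; _∷_)
open import Data.List.Relation.Unary.Unique.Propositional.Properties using (map⁺; allFin⁺)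
open import Data.List.Membership.Propositional.Properties using (∈-map⁺; ∈-allFin)
open import Data.Rational using (ℚ; 0ℚ; 1ℚ; -_; 1/_; _⊓_; ≢-nonZero; nonNegative) renaming (_+_ to _+ℚ_; _*_ to _*ℚ_; _≤_ to _≤ℚ_; _⊔_ to _⊔ℚ_)
import Data.Rational.Properties as ℚ
open import Data.Rational.Solver using (module +-*-Solver)
open +-*-Solver using (solve; _:+_; _:*_; :-_; _:=_)
open import Function using (_∘_)
open import Function.Bundles using (Inverse; mk↔ₛ′)
open import Relation.Binary using (IsPartialOrder)
open import Relation.Binary.PropositionalEquality using (_≡_; _≢_; refl; sym; trans; cong; cong₂; subst; subst₂)
open import Relation.Nullary using (¬_; Dec; yes; no; does)
open import Relation.Nullary.Decidable using (map′; dec-true; dec-false; toWitness; _×-dec_; _→-dec_; _⊎-dec_; ¬?; decidable-stable)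

-- Geometry enters in two places and in opposite directions: a simplex face of O(P) has to yield
-- pairwise edges, and an object on the chain side has to yield a simplex face of C(P). So order
-- faces are kept as cliques, since edges restrict to the parts of a composite poset, while chain
-- faces are kept as certificates made of a supporting function and dual functions, since those can
-- be combined explicitly. That pairwise edges also suffice for a face of O(P) is proved for all
-- posets but enters through the X-free ones, whose bound starts from arbitrary cliques.
--
-- The obstacle is the ordinal sum, where the inequality for a summand has to be split: the chains
-- through the glued vertex must be subtracted from both sides before the remainders are multiplied.
-- For injections instead of numbers this is the cancellation of a common finite summand. Degrees
-- are numbers of vertices, one more than the dimension, so that the empty face has degree zero.

¬¬-bind : {A B : Set} → ¬ ¬ A → (A → ¬ ¬ B) → ¬ ¬ B
¬¬-bind a f k = a (λ x → f x k)

¬¬-em : (A : Set) → ¬ ¬ Dec A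
¬¬-em A k = k (no (λ a → k (yes a)))

-- Graded sets and degree preserving injections

record Graded : Set₁ where
  field
    El  : Set
    _≋_ : El → El → Set
    deg : El → ℕ

open Graded public

-- Reflecting ≋ is all that is needed of an embedding: it need not respect ≋.
record _↪_ (X Y : Graded) : Set where
  field
    fun  : El X → El Y
    inj  : ∀ x y → _≋_ Y (fun x) (fun y) → _≋_ X x y
    deg≡ : ∀ x → deg Y (fun x) ≡ deg X x

open _↪_ public

_⨾_ : ∀ {X Y Z} → X ↪ Y → Y ↪ Z → X ↪ Z
fun (f ⨾ g) x = fun g (fun f x)
inj (f ⨾ g) x y e = inj f x y (inj g _ _ e)
deg≡ (f ⨾ g) x = trans (deg≡ g _) (deg≡ f x)

module _ (X Y : Graded) where
  data Sum≋ : El X ⊎ El Y → El X ⊎ El Y → Set where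
    inl : ∀ {x x'} → _≋_ X x x' → Sum≋ (inj₁ x) (inj₁ x')
    inr : ∀ {y y'} → _≋_ Y y y' → Sum≋ (inj₂ y) (inj₂ y')

  _⊎ᵍ_ : Graded
  _⊎ᵍ_ = record { El = El X ⊎ El Y ; _≋_ = Sum≋ ; deg = [ deg X , deg Y ]′ }


_×ᵍ_ : Graded → Graded → Graded
X ×ᵍ Y = record { El = El X × El Y ; _≋_ = λ a b → _≋_ X (proj₁ a) (proj₁ b) × _≋_ Y (proj₂ a) (proj₂ b)
                ; deg = λ a → deg X (proj₁ a) + deg Y (proj₂ a) }

_×↪_ : ∀ {X X' Y Y'} → X ↪ X' → Y ↪ Y' → (X ×ᵍ Y) ↪ (X' ×ᵍ Y')
fun (f ×↪ g) (x , y) = fun f x , fun g y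
inj (f ×↪ g) _ _ (e , e') = inj f _ _ e , inj g _ _ e'
deg≡ (f ×↪ g) (x , y) = cong₂ _+_ (deg≡ f x) (deg≡ g y)

×↪-swap : ∀ {X Y} → (X ×ᵍ Y) ↪ (Y ×ᵍ X)
fun ×↪-swap (x , y) = y , x
inj ×↪-swap _ _ (e , e') = e' , e
deg≡ (×↪-swap {X} {Y}) (x , y) = +-comm (deg Y y) (deg X x)

-- Disjointness of the images is asked for in both orders because `≋` is not assumed symmetric.
copair : ∀ {X Y Z} (f : X ↪ Z) (g : Y ↪ Z) → (∀ x y → ¬ _≋_ Z (fun f x) (fun g y)) →
         (∀ x y → ¬ _≋_ Z (fun g y) (fun f x)) → (X ⊎ᵍ Y) ↪ Z
fun (copair f g _ _) = [ fun f , fun g ]′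
inj (copair f g n m) (inj₁ x) (inj₁ x') e = inl (inj f x x' e)
inj (copair f g n m) (inj₁ x) (inj₂ y) e = ⊥-elim (n x y e)
inj (copair f g n m) (inj₂ y) (inj₁ x) e = ⊥-elim (m x y e)
inj (copair f g n m) (inj₂ y) (inj₂ y') e = inr (inj g y y' e)
deg≡ (copair f g _ _) (inj₁ x) = deg≡ f x
deg≡ (copair f g _ _) (inj₂ y) = deg≡ g y

inj₁↪ : ∀ {X Y} → X ↪ (X ⊎ᵍ Y)
fun inj₁↪ = inj₁
inj inj₁↪ _ _ (inl e) = e
deg≡ inj₁↪ _ = refl

inj₂↪ : ∀ {X Y} → Y ↪ (X ⊎ᵍ Y)
fun inj₂↪ = inj₂
inj inj₂↪ _ _ (inr e) = e
deg≡ inj₂↪ _ = refl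

Unit : Graded
Unit = record { El = ⊤ ; _≋_ = λ _ _ → ⊤ ; deg = λ _ → 0 }

-- Cancelling a common summand

-- A code need not be onto: `N` only bounds the number of classes of `A`. It also decides `≋`,
-- through equality in `Fin`, which is what lets `view` recognise the class of `a₀`.
record Coded (A : Graded) (N : ℕ) : Set where
  field
    code      : El A → Fin N
    code-inj  : ∀ a b → code a ≡ code b → _≋_ A a b
    code-cong : ∀ a b → _≋_ A a b → code a ≡ code b
    deg-cong  : ∀ a b → _≋_ A a b → deg A a ≡ deg A b

-- A common finite summand is cancelled one element a₀ at a time: whatever f sends
-- to a₀ is redirected to f a₀.
module Redirect {N} (A X Y : Graded) (C : Coded A (suc N)) (f : (A ⊎ᵍ X) ↪ (A ⊎ᵍ Y))
                (a₀ : El A) (a₀-zero : Coded.code C a₀ ≡ zero) where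
  open Coded C

  A' : Graded
  A' = record { El = Σ (El A) (λ a → zero ≢ code a)
              ; _≋_ = λ a b → _≋_ A (proj₁ a) (proj₁ b)
              ; deg = λ a → deg A (proj₁ a) }

  coded' : Coded A' N
  coded' = record
    { code = λ a → punchOut (proj₂ a)
    ; code-inj = λ a b e → code-inj _ _ (punchOut-injective (proj₂ a) (proj₂ b) e)
    ; code-cong = λ a b e → punchOut-cong zero (code-cong _ _ e)
    ; deg-cong = λ a b → deg-cong _ _ }

  incl : El A' ⊎ El X → El A ⊎ El X
  incl (inj₁ (a , _)) = inj₁ a
  incl (inj₂ x) = inj₂ x

  deg-incl : ∀ z → deg (A ⊎ᵍ X) (incl z) ≡ deg (A' ⊎ᵍ X) z
  deg-incl (inj₁ _) = refl
  deg-incl (inj₂ _) = refl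

  incl-inj : ∀ z z' → Sum≋ A X (incl z) (incl z') → Sum≋ A' X z z'
  incl-inj (inj₁ _) (inj₁ _) (inl e) = inl e
  incl-inj (inj₂ _) (inj₂ _) (inr e) = inr e

  a₀≉incl : ∀ z → ¬ Sum≋ A X (inj₁ a₀) (incl z)
  a₀≉incl (inj₁ (a , n)) (inl e) = n (trans (sym a₀-zero) (code-cong _ _ e))

  incl≉a₀ : ∀ z → ¬ Sum≋ A X (incl z) (inj₁ a₀)
  incl≉a₀ (inj₁ (a , n)) (inl e) = n (sym (trans (code-cong _ _ e) a₀-zero))

  data View : El A ⊎ El Y → El A' ⊎ El Y → Set where
    left  : ∀ {a} n → View (inj₁ a) (inj₁ (a , n))
    right : ∀ {y} → View (inj₂ y) (inj₂ y)

  view : ∀ z → (Σ _ (View z)) ⊎ Sum≋ A Y z (inj₁ a₀)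
  view (inj₂ y) = inj₁ (inj₂ y , right)
  view (inj₁ a) with zero ≟F code a
  ... | yes e = inj₂ (inl (code-inj _ _ (trans (sym e) (sym a₀-zero))))
  ... | no n = inj₁ (inj₁ (a , n) , left n)

  view-inj : ∀ {z z' u u'} → View z u → View z' u' → Sum≋ A' Y u u' → Sum≋ A Y z z'
  view-inj (left _) (left _) (inl e) = inl e
  view-inj right right (inr e) = inr e

  view-deg : ∀ {z u} → View z u → deg (A' ⊎ᵍ Y) u ≡ deg (A ⊎ᵍ Y) z
  view-deg (left _) = refl
  view-deg right = refl

  join₀ : ∀ z z' → Sum≋ A Y z (inj₁ a₀) → Sum≋ A Y z' (inj₁ a₀) → Sum≋ A Y z z'
  join₀ (inj₁ a) (inj₁ b) (inl e) (inl e') = inl (code-inj _ _ (trans (code-cong _ _ e) (sym (code-cong _ _ e'))))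

  deg₀ : ∀ z → Sum≋ A Y z (inj₁ a₀) → deg (A ⊎ᵍ Y) z ≡ deg A a₀
  deg₀ (inj₁ a) (inl e) = deg-cong _ _ e

  -- The graph of `out`. Injectivity and degree are then proved by cases on derivations, instead of
  -- repeating the case analysis that computes the value; the same device recurs in most embeddings
  -- below.
  data Out (z : El A' ⊎ El X) (u : El A' ⊎ El Y) : Set where
    direct     : View (fun f (incl z)) u → Out z u
    redirected : Sum≋ A Y (fun f (incl z)) (inj₁ a₀) → View (fun f (inj₁ a₀)) u → Out z u

  out : ∀ z → Σ _ (Out z)
  out z with view (fun f (incl z)) | view (fun f (inj₁ a₀))
  ... | inj₁ (u , v) | _ = u , direct v
  ... | inj₂ e | inj₁ (u , v) = u , redirected e v
  -- Two different classes, that of `incl z` and that of `a₀`, would both be sent to `a₀`.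
  ... | inj₂ e | inj₂ e' = ⊥-elim (incl≉a₀ z (inj f _ _ (join₀ _ _ e e')))

  out-inj : ∀ {z z' u u'} → Out z u → Out z' u' → Sum≋ A' Y u u' → Sum≋ A' X z z'
  out-inj (direct v) (direct v') e = incl-inj _ _ (inj f _ _ (view-inj v v' e))
  out-inj {z} (direct v) (redirected _ v') e = ⊥-elim (incl≉a₀ z (inj f _ _ (view-inj v v' e)))
  out-inj {z' = z'} (redirected _ v) (direct v') e = ⊥-elim (a₀≉incl z' (inj f _ _ (view-inj v v' e)))
  out-inj (redirected e _) (redirected e' _) _ = incl-inj _ _ (inj f _ _ (join₀ _ _ e e'))

  out-deg : ∀ {z u} → Out z u → deg (A' ⊎ᵍ Y) u ≡ deg (A' ⊎ᵍ X) z
  out-deg {z} (direct v) = trans (view-deg v) (trans (deg≡ f _) (deg-incl z))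
  out-deg {z} (redirected e v) =
    trans (view-deg v) (trans (deg≡ f (inj₁ a₀)) (trans (sym (deg₀ _ e)) (trans (deg≡ f (incl z)) (deg-incl z))))

  f' : (A' ⊎ᵍ X) ↪ (A' ⊎ᵍ Y)
  fun f' z = proj₁ (out z)
  inj f' z z' = out-inj (proj₂ (out z)) (proj₂ (out z'))
  deg≡ f' z = out-deg (proj₂ (out z))

-- Induction on the bound `N`; with no codes left, `A` is empty and `f` itself maps `X` into `Y`.
-- Whether the code `zero` is attained cannot be decided, and this question is the only source of
-- the double negation.
cancel : ∀ N (A X Y : Graded) → Coded A N → (A ⊎ᵍ X) ↪ (A ⊎ᵍ Y) → ¬ ¬ (X ↪ Y)
cancel zero A X Y C f k = k record { fun = λ x → proj₁ (out x) ; inj = inj' ; deg≡ = deg' }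
  where
  out : ∀ x → Σ (El Y) λ y → fun f (inj₂ x) ≡ inj₂ y
  out x with fun f (inj₂ x)
  ... | inj₂ y = y , refl
  ... | inj₁ a with () ← Coded.code C a
  raise : ∀ {u u' y y'} → u ≡ inj₂ y → u' ≡ inj₂ y' → _≋_ Y y y' → Sum≋ A Y u u'
  raise refl refl e = inr e
  inj' : ∀ x x' → _≋_ Y (proj₁ (out x)) (proj₁ (out x')) → _≋_ X x x'
  inj' x x' e with inj f (inj₂ x) (inj₂ x') (raise (proj₂ (out x)) (proj₂ (out x')) e)
  ... | inr e' = e'
  deg' : ∀ x → deg Y (proj₁ (out x)) ≡ deg X x
  deg' x with out x
  ... | y , p = trans (cong (deg (A ⊎ᵍ Y)) (sym p)) (deg≡ f (inj₂ x))
cancel (suc N) A X Y C f = ¬¬-bind (¬¬-em (Σ (El A) λ a → Coded.code C a ≡ zero)) step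
  where
  step : Dec (Σ (El A) λ a → Coded.code C a ≡ zero) → ¬ ¬ (X ↪ Y)
  step (yes (a₀ , e)) = cancel N R.A' X Y R.coded' R.f'
    where module R = Redirect A X Y C f a₀ e
  step (no none) = cancel N A X Y C' f
    where
    open Coded C
    nz : ∀ a → zero ≢ code a
    nz a e = none (a , sym e)
    C' : Coded A N
    C' = record
      { code = λ a → punchOut (nz a)
      ; code-inj = λ a b e → code-inj a b (punchOut-injective (nz a) (nz b) e)
      ; code-cong = λ a b e → punchOut-cong zero (code-cong a b e)
      ; deg-cong = deg-cong }

-- Graphs, cliques and links

record Graph : Set₁ where
  field
    V       : Set
    _≈_     : V → V → Set
    ≈-refl  : ∀ {x} → x ≈ x
    ≈-sym   : ∀ {x y} → x ≈ y → y ≈ x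
    ≈-trans : ∀ {x y z} → x ≈ y → y ≈ z → x ≈ z
    _≈?_    : ∀ x y → Dec (x ≈ y)
    E       : V → V → Set
    E-sym   : ∀ {x y} → E x y → E y x
    E-resp  : ∀ {x y z} → x ≈ y → E x z → E y z
    E-irr   : ∀ {x y} → E x y → ¬ (x ≈ y)

module Cliques (G : Graph) where
  open Graph G public

  infix 4 _∈_ _~_

  _∈_ : V → List V → Set
  x ∈ xs = Any (x ≈_) xs

  ∈-resp : ∀ {x y xs} → x ≈ y → x ∈ xs → y ∈ xs
  ∈-resp e (here p) = here (≈-trans (≈-sym e) p)
  ∈-resp e (there p) = there (∈-resp e p)

  _∈?_ : ∀ x xs → Dec (x ∈ xs)
  x ∈? xs = anyL? (x ≈?_) xs

  E-respʳ : ∀ {x y z} → x ≈ y → E z x → E z y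
  E-respʳ e p = E-sym (E-resp e (E-sym p))

  Adj : V → List V → Set
  Adj v xs = ∀ u → u ∈ xs → E v u

  -- `E` excludes `≈`, so a clique has no repeated vertex and its length is its number of vertices;
  -- `~` then compares cliques as sets.
  data IsClique : List V → Set where
    []  : IsClique []
    _∷_ : ∀ {x xs} → Adj x xs → IsClique xs → IsClique (x ∷ xs)

  _⊆_ : List V → List V → Set
  xs ⊆ ys = ∀ u → u ∈ xs → u ∈ ys

  _~_ : List V → List V → Set
  xs ~ ys = (xs ⊆ ys) × (ys ⊆ xs)

  clique-E : ∀ {xs} → IsClique xs → ∀ {x y} → x ∈ xs → y ∈ xs → ¬ (x ≈ y) → E x y
  clique-E (h ∷ c) (here p) (here q) n = ⊥-elim (n (≈-trans p (≈-sym q)))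
  clique-E (h ∷ c) (here p) (there q) n = E-resp (≈-sym p) (h _ q)
  clique-E (h ∷ c) (there p) (here q) n = E-sym (E-resp (≈-sym q) (h _ p))
  clique-E (h ∷ c) (there p) (there q) n = clique-E c p q n

  clique-++ : ∀ {xs ys} → IsClique xs → IsClique ys → (∀ x y → x ∈ xs → y ∈ ys → E x y) → IsClique (xs ++ ys)
  clique-++ [] d h = d
  clique-++ {x ∷ xs} (adj ∷ c) d h = (λ u m → [ adj u , h x u (here ≈-refl) ]′ (++⁻ xs m)) ∷ clique-++ c d (λ a b m → h a b (there m))

  ∷-injective : ∀ {x xs ys} → ¬ (x ∈ xs) → ¬ (x ∈ ys) → (x ∷ xs) ~ (x ∷ ys) → xs ~ ys
  ∷-injective {x} {xs} {ys} n m (s , t) = half n s , half m t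
    where
    half : ∀ {xs ys} → ¬ (x ∈ xs) → (x ∷ xs) ⊆ (x ∷ ys) → xs ⊆ ys
    half n s _ p with s _ (there p)
    ... | here q = ⊥-elim (n (∈-resp q p))
    ... | there q = q

  record Extract (v : V) (xs : List V) : Set where
    field
      rest    : List V
      clique  : IsClique rest
      link    : Adj v rest
      len     : length xs ≡ suc (length rest)
      split   : ∀ {u} → u ∈ xs → (u ≈ v) ⊎ (u ∈ rest)
      rest⊆   : rest ⊆ xs
      mem     : v ∈ xs

  extract : ∀ {v xs} → IsClique xs → v ∈ xs → Extract v xs
  extract (h ∷ c) (here e) = record
    { rest = _ ; clique = c ; link = λ _ p → E-resp (≈-sym e) (h _ p) ; len = refl
    ; split = λ { (here p) → inj₁ (≈-trans p (≈-sym e)) ; (there p) → inj₂ p } ; rest⊆ = λ _ → there ; mem = here e }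
  extract {v} {x ∷ xs} (h ∷ c) (there m) = record
    { rest = x ∷ R.rest ; clique = (λ _ p → h _ (R.rest⊆ _ p)) ∷ R.clique
    ; link = λ { _ (here p) → E-respʳ (≈-sym p) (E-sym (h _ m)) ; _ (there p) → R.link _ p }
    ; len = cong suc R.len
    ; split = λ { (here p) → inj₂ (here p) ; (there p) → [ inj₁ , (λ q → inj₂ (there q)) ]′ (R.split p) }
    ; rest⊆ = λ { _ (here p) → here p ; _ (there p) → there (R.rest⊆ _ p) } ; mem = there m }
    where module R = Extract (extract c m)

  link-∉ : ∀ {v xs} → Adj v xs → ¬ (v ∈ xs)
  link-∉ adj p = E-irr (adj _ p) ≈-refl

  ⊆-length : ∀ {xs ys} → IsClique xs → IsClique ys → xs ⊆ ys → length xs ≤ length ys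
  ⊆-length [] _ _ = z≤n
  ⊆-length {x ∷ xs} {ys} (h ∷ c) d s = subst (suc (length xs) ≤_) (sym R.len) (s≤s (⊆-length c R.clique sub))
    where
    module R = Extract (extract d (s _ (here ≈-refl)))
    sub : xs ⊆ R.rest
    sub _ p with R.split (s _ (there p))
    ... | inj₂ q = q
    ... | inj₁ e = ⊥-elim (E-irr (h _ p) (≈-sym e))

  ~-length : ∀ {xs ys} → IsClique xs → IsClique ys → xs ~ ys → length xs ≡ length ys
  ~-length c d (s , t) = ≤-antisym (⊆-length c d s) (⊆-length d c t)

  lookup-∈ : ∀ xs i → lookup xs i ∈ xs
  lookup-∈ (x ∷ xs) zero = here ≈-refl
  lookup-∈ (x ∷ xs) (suc i) = there (lookup-∈ xs i)

  lookup-index : ∀ xs x → x ∈ xs → Σ (Fin (length xs)) λ i → x ≈ lookup xs i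
  lookup-index (y ∷ xs) x (here e) = zero , e
  lookup-index (y ∷ xs) x (there m) with lookup-index xs x m
  ... | i , e = suc i , e

  lookup-injective : ∀ {xs} → IsClique xs → ∀ i j → lookup xs i ≈ lookup xs j → i ≡ j
  lookup-injective (adj ∷ c) zero zero e = refl
  lookup-injective {x ∷ xs} (adj ∷ c) zero (suc j) e = ⊥-elim (E-irr (adj _ (lookup-∈ xs j)) e)
  lookup-injective {x ∷ xs} (adj ∷ c) (suc i) zero e = ⊥-elim (E-irr (adj _ (lookup-∈ xs i)) (≈-sym e))
  lookup-injective (adj ∷ c) (suc i) (suc j) e = cong suc (lookup-injective c i j e)

  tabulate-∈ : ∀ {n} (f : Fin n → V) i → f i ∈ tabulate f
  tabulate-∈ f zero = here ≈-refl
  tabulate-∈ f (suc i) = there (tabulate-∈ (f ∘ suc) i)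

  tabulate-∈⁻ : ∀ {n} (f : Fin n → V) x → x ∈ tabulate f → Σ (Fin n) λ i → x ≈ f i
  tabulate-∈⁻ {suc n} f x (here e) = zero , e
  tabulate-∈⁻ {suc n} f x (there m) with tabulate-∈⁻ (f ∘ suc) x m
  ... | i , e = suc i , e

  tabulate-clique : ∀ {n} (f : Fin n → V) → (∀ i j → i ≢ j → E (f i) (f j)) → IsClique (tabulate f)
  tabulate-clique {zero} f h = []
  tabulate-clique {suc n} f h = adj ∷ tabulate-clique (f ∘ suc) (λ i j n → h (suc i) (suc j) (λ { refl → n refl }))
    where
    adj : Adj (f zero) (tabulate (f ∘ suc))
    adj u m with tabulate-∈⁻ (f ∘ suc) u m
    ... | i , e = E-respʳ (≈-sym e) (h zero (suc i) (λ ()))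

  Cl : Graded
  Cl = record { El = Σ (List V) IsClique ; _≋_ = λ a b → proj₁ a ~ proj₁ b ; deg = λ a → length (proj₁ a) }

  Avoid : V → Graded
  Avoid v = record { El = Σ (List V) λ xs → IsClique xs × ¬ (v ∈ xs)
                   ; _≋_ = λ a b → proj₁ a ~ proj₁ b ; deg = λ a → length (proj₁ a) }

  Link : V → Graded
  Link v = record { El = Σ (List V) λ xs → IsClique xs × Adj v xs
                  ; _≋_ = λ a b → proj₁ a ~ proj₁ b ; deg = λ a → length (proj₁ a) }

  Link-resp : ∀ {v w} → v ≈ w → Link v ↪ Link w
  fun (Link-resp e) (xs , c , adj) = xs , c , λ u m → E-resp e (adj u m)
  inj (Link-resp e) _ _ h = h
  deg≡ (Link-resp e) _ = refl

  Cl≥ : ℕ → Graded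
  Cl≥ n = record { El = Σ (List V) λ xs → IsClique xs × n ≤ length xs
                 ; _≋_ = λ a b → proj₁ a ~ proj₁ b ; deg = λ a → length (proj₁ a) }

  Link≥1 : V → Graded
  Link≥1 v = record { El = Σ (El (Link v)) λ τ → 1 ≤ length (proj₁ τ)
                    ; _≋_ = λ a b → proj₁ (proj₁ a) ~ proj₁ (proj₁ b) ; deg = λ a → length (proj₁ (proj₁ a)) }

  inhabitant : ∀ xs → 1 ≤ length xs → Σ V λ x → x ∈ xs
  inhabitant (x ∷ xs) _ = x , here ≈-refl

  two-inhabitants : ∀ {xs} → IsClique xs → 2 ≤ length xs → Σ V λ x → Σ V λ y → x ∈ xs × y ∈ xs × ¬ (x ≈ y)
  two-inhabitants {x ∷ []} _ (s≤s ())
  two-inhabitants {x ∷ y ∷ xs} (adj ∷ _) _ = x , y , here ≈-refl , there (here ≈-refl) , E-irr (adj y (here ≈-refl))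

  -- Delete v from a clique v ∷ xs, unless u occurs in xs; in that case delete u instead.
  Link↪Avoid : ∀ v u → Link v ↪ Avoid u
  Link↪Avoid v u = record { fun = λ a → proj₁ (out a) ; inj = λ a b → out-inj (proj₂ (out a)) (proj₂ (out b))
                          ; deg≡ = λ a → out-deg (proj₂ (out a)) }
    where
    data Out : El (Link v) → El (Avoid u) → Set where
      exchange : ∀ {xs c adj} (X : Extract u xs) {d} → Out (xs , c , adj) (v ∷ Extract.rest X , d)
      keep : ∀ {xs c adj d} → Out (xs , c , adj) (xs , d)
    out : ∀ a → Σ _ (Out a)
    out (xs , c , adj) with u ∈? xs
    ... | no n = (xs , c , n) , keep
    ... | yes m = (v ∷ X.rest , ((λ _ p → adj _ (X.rest⊆ _ p)) ∷ X.clique) , n) , exchange X'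
      where
      X' = extract c m
      module X = Extract X'
      n : ¬ (u ∈ v ∷ X.rest)
      n (here e) = E-irr (adj _ m) (≈-sym e)
      n (there p) = link-∉ X.link p
    out-inj : ∀ {a b a' b'} → Out a a' → Out b b' → _≋_ (Avoid u) a' b' → _≋_ (Link v) a b
    out-inj keep keep e = e
    -- An exchanged list contains `v`, while `Adj v` keeps `v` out of a kept one, so the two kinds
    -- of output cannot agree.
    out-inj {b = _ , _ , adj} (exchange X) keep (s , t) = ⊥-elim (link-∉ adj (s _ (here ≈-refl)))
    out-inj {a = _ , _ , adj} keep (exchange X) (s , t) = ⊥-elim (link-∉ adj (t _ (here ≈-refl)))
    out-inj {xs , c , adj} {ys , d , k} (exchange X) (exchange Y) e = half X Y (proj₁ rest~) , half Y X (proj₂ rest~)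
      where
      module X = Extract X
      module Y = Extract Y
      rest~ : X.rest ~ Y.rest
      rest~ = ∷-injective (λ p → link-∉ adj (X.rest⊆ _ p)) (λ p → link-∉ k (Y.rest⊆ _ p)) e
      half : ∀ {xs ys} (X : Extract u xs) (Y : Extract u ys) → Extract.rest X ⊆ Extract.rest Y → xs ⊆ ys
      half X Y s _ p with Extract.split X p
      ... | inj₂ q = Extract.rest⊆ Y _ (s _ q)
      ... | inj₁ e = ∈-resp (≈-sym e) (Extract.mem Y)
    out-deg : ∀ {a b} → Out a b → deg (Avoid u) b ≡ deg (Link v) a
    out-deg keep = refl
    out-deg (exchange X) = sym (Extract.len X)

-- `g` is tied to `≈` but not to `E`: some uses have preservation of adjacency, others reflection,
-- and each call of `map-clique` or `Preimage.clique` supplies the direction at hand.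
module Transport (G K : Graph) (g : Graph.V K → Graph.V G)
                 (g-cong : ∀ {p q} → Graph._≈_ K p q → Graph._≈_ G (g p) (g q))
                 (g-inj : ∀ {p q} → Graph._≈_ G (g p) (g q) → Graph._≈_ K p q) where
  private
    module G = Cliques G
    module K = Cliques K

  map-∈ : ∀ {p ps} → p K.∈ ps → g p G.∈ map g ps
  map-∈ (here e) = here (g-cong e)
  map-∈ (there m) = there (map-∈ m)

  map-∈⁻ : ∀ {a} ps → a G.∈ map g ps → Σ K.V λ p → p K.∈ ps × a G.≈ g p
  map-∈⁻ (p ∷ ps) (here e) = p , here K.≈-refl , e
  map-∈⁻ (p ∷ ps) (there m) with map-∈⁻ ps m
  ... | q , q∈ , e = q , there q∈ , e

  map-∈⁻¹ : ∀ {p} ps → g p G.∈ map g ps → p K.∈ ps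
  map-∈⁻¹ ps m with map-∈⁻ ps m
  ... | q , q∈ , e = K.∈-resp (K.≈-sym (g-inj e)) q∈

  map-clique : ∀ {ps} → (∀ p q → p K.∈ ps → q K.∈ ps → K.E p q → G.E (g p) (g q)) → K.IsClique ps → G.IsClique (map g ps)
  map-clique h K.[] = G.[]
  map-clique {p ∷ ps} h (adj K.∷ c) = adj' G.∷ map-clique (λ p q m m' → h p q (there m) (there m')) c
    where
    adj' : G.Adj (g p) (map g ps)
    adj' a m with map-∈⁻ ps m
    ... | q , q∈ , e = G.E-respʳ (G.≈-sym e) (h p q (here K.≈-refl) (there q∈) (adj q q∈))

  map-⊆⁻ : ∀ {ps qs} → map g ps G.⊆ map g qs → ps K.⊆ qs
  map-⊆⁻ {qs = qs} s p m = map-∈⁻¹ qs (s (g p) (map-∈ m))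

  map-~⁻ : ∀ {ps qs} → map g ps G.~ map g qs → ps K.~ qs
  map-~⁻ (s , s') = map-⊆⁻ s , map-⊆⁻ s'

  InImage : List G.V → Set
  InImage xs = ∀ a → a G.∈ xs → Σ K.V λ p → a G.≈ g p

  inImage? : (∀ a → Dec (Σ K.V λ p → a G.≈ g p)) → ∀ xs → Dec (InImage xs)
  inImage? d [] = yes (λ _ ())
  inImage? d (x ∷ xs) with d x | inImage? d xs
  ... | no n | _ = no (λ f → n (f x (here G.≈-refl)))
  ... | yes _ | no n = no (λ f → n (λ a m → f a (there m)))
  ... | yes (p , e) | yes f = yes (λ { a (here x) → p , G.≈-trans x e ; a (there m) → f a m })

  record Preimage (xs : List G.V) : Set where
    field
      elts   : List K.V
      len    : length elts ≡ length xs
      elt→   : ∀ p → p K.∈ elts → g p G.∈ xs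
      elt←   : ∀ p → g p G.∈ xs → p K.∈ elts
      image  : InImage xs
      clique : G.IsClique xs → (∀ p q → g p G.∈ xs → g q G.∈ xs → G.E (g p) (g q) → K.E p q) → K.IsClique elts

  preimage : ∀ xs → InImage xs → Preimage xs
  preimage [] f = record { elts = [] ; len = refl ; elt→ = λ _ () ; elt← = λ _ () ; image = f ; clique = λ _ _ → K.[] }
  preimage (x ∷ xs) f = record
    { elts = p ∷ R.elts ; len = cong suc R.len
    ; elt→ = λ { _ (here q) → here (G.≈-trans (g-cong q) (G.≈-sym e)) ; q (there m) → there (R.elt→ q m) }
    ; elt← = λ { q (here a) → here (g-inj (G.≈-trans a e)) ; q (there m) → there (R.elt← q m) }
    ; image = f
    ; clique = λ { (adj G.∷ c) h →
        (λ q m → h p q (here (G.≈-sym e)) (there (R.elt→ q m)) (G.E-resp e (adj (g q) (R.elt→ q m)))) K.∷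
        R.clique c (λ p q m m' → h p q (there m) (there m')) } }
    where
    p = proj₁ (f x (here G.≈-refl))
    e = proj₂ (f x (here G.≈-refl))
    module R = Preimage (preimage xs (λ a m → f a (there m)))

  preimage-⊆ : ∀ {xs ys} (S : Preimage xs) (T : Preimage ys) → Preimage.elts S K.⊆ Preimage.elts T → xs G.⊆ ys
  preimage-⊆ S T s a m with Preimage.image S a m
  ... | p , e = G.∈-resp (G.≈-sym e) (Preimage.elt→ T p (s p (Preimage.elt← S p (G.∈-resp e m))))

true⇒ : {A : Set} (d : Dec A) → does d ≡ true → A
true⇒ (yes a) _ = a

false⇒ : {A : Set} (d : Dec A) → does d ≡ false → ¬ A
false⇒ (no n) _ = n

true≢false : ∀ {b} → b ≡ true → b ≢ false
true≢false refl ()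

¬true⇒false : ∀ {b} → b ≢ true → b ≡ false
¬true⇒false {false} _ = refl
¬true⇒false {true} n = ⊥-elim (n refl)

≡-by-true : ∀ {a b} → (a ≡ true → b ≡ true) → (b ≡ true → a ≡ true) → a ≡ b
≡-by-true {true} f g = sym (f refl)
≡-by-true {false} {false} f g = refl
≡-by-true {false} {true} f g = g refl

-- Filters, antichains and chains of a poset

module Elements (P : FinPoset) where
  open Inverse (enum P) using (to; from)

  from-to : ∀ p → from (to p) ≡ p
  from-to p = Inverse.strictlyInverseʳ (enum P) p

  infix 4 _≟C_
  abstract
    _≟C_ : (p q : Carrier P) → Dec (p ≡ q)
    p ≟C q with to p ≟F to q
    ... | yes e = yes (trans (sym (from-to p)) (trans (cong from e) (from-to q)))
    ... | no n = no (λ e → n (cong to e))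

    allC? : {Q : Carrier P → Set} → (∀ p → Dec (Q p)) → Dec (∀ p → Q p)
    allC? {Q} Q? = map′ (λ h p → subst Q (from-to p) (h (to p))) (λ h i → h (from i)) (all? (λ i → Q? (from i)))

    anyC? : {Q : Carrier P → Set} → (∀ p → Dec (Q p)) → Dec (Σ (Carrier P) Q)
    anyC? {Q} Q? = map′ (λ { (i , q) → from i , q }) (λ { (p , q) → to p , subst Q (sym (from-to p)) q }) (any? (λ i → Q? (from i)))

    elems : List (Carrier P)
    elems = map from (allFin (size P))

    ∈-elems : ∀ p → Any (p ≡_) elems
    ∈-elems p = subst (λ q → Any (q ≡_) elems) (from-to p) (∈-map⁺ from (∈-allFin (to p)))

    elems-unique : Unique elems
    elems-unique = map⁺ (λ {i} {j} e → trans (sym (Inverse.strictlyInverseˡ (enum P) i)) (trans (cong to e) (Inverse.strictlyInverseˡ (enum P) j))) (allFin⁺ (size P))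

  open IsPartialOrder (isPartialOrder P) public using () renaming (refl to ≼-refl; trans to ≼-trans; antisym to ≼-antisym)

Vtx : FinPoset → Set
Vtx P = Carrier P → Bool

IsFilter IsAnti : (P : FinPoset) → Vtx P → Set
IsFilter P F = ∀ p q → _≼_ P p q → F p ≡ true → F q ≡ true
IsAnti P A = ∀ p q → A p ≡ true → A q ≡ true → _≼_ P p q → p ≡ q

Filter Anti : FinPoset → Set
Filter P = Σ (Vtx P) (IsFilter P)
Anti P = Σ (Vtx P) (IsAnti P)

-- c , d is a , b up to order: on indicator values this says a + b = c + d.
Swap : Bool → Bool → Bool → Bool → Set
Swap a b c d = (c ≡ a × d ≡ b) ⊎ (c ≡ b × d ≡ a)

Swap-sym : ∀ {a b c d} → Swap a b c d → Swap b a c d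
Swap-sym (inj₁ p) = inj₂ p
Swap-sym (inj₂ p) = inj₁ p

Swap-flip : ∀ {a b c d} → Swap a b c d → Swap a b d c
Swap-flip (inj₁ p) = inj₂ (swap p)
Swap-flip (inj₂ p) = inj₁ (swap p)

module _ (P : FinPoset) where
  open Elements P

  _≗ᵛ_ : Vtx P → Vtx P → Set
  F ≗ᵛ G = ∀ p → F p ≡ G p

  ≗ᵛ-sym : ∀ {F G} → F ≗ᵛ G → G ≗ᵛ F
  ≗ᵛ-sym e p = sym (e p)

  ≗ᵛ-trans : ∀ {F G H} → F ≗ᵛ G → G ≗ᵛ H → F ≗ᵛ H
  ≗ᵛ-trans e f p = trans (e p) (f p)

  _≗ᵛ?_ : ∀ F G → Dec (F ≗ᵛ G)
  F ≗ᵛ? G = allC? (λ p → F p ≟B G p)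

  -- 1_F + 1_G has no other expression as a sum of two indicators of filters.
  Edge : Filter P → Filter P → Set
  Edge (F , _) (G , _) = ¬ (F ≗ᵛ G) × (∀ (H K : Filter P) → (∀ p → Swap (F p) (G p) (proj₁ H p) (proj₁ K p)) →
    (proj₁ H ≗ᵛ F × proj₁ K ≗ᵛ G) ⊎ (proj₁ H ≗ᵛ G × proj₁ K ≗ᵛ F))

  OG : Graph
  OG = record
    { V = Filter P ; _≈_ = λ F G → proj₁ F ≗ᵛ proj₁ G
    ; ≈-refl = λ _ → refl ; ≈-sym = ≗ᵛ-sym ; ≈-trans = ≗ᵛ-trans
    ; _≈?_ = λ F G → proj₁ F ≗ᵛ? proj₁ G
    ; E = Edge
    ; E-sym = λ { (n , h) → (λ e → n (≗ᵛ-sym e)) , λ H K s → [ inj₂ , inj₁ ]′ (h H K (λ p → Swap-sym (s p))) }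
    ; E-resp = λ { {x} {y} {z} e (n , h) → (λ f → n (≗ᵛ-trans e f)) , λ H K s →
        [ (λ { (u , v) → inj₁ (≗ᵛ-trans u e , v) }) , (λ { (u , v) → inj₂ (u , ≗ᵛ-trans v e) }) ]′
          (h H K (λ p → subst (λ b → Swap b (proj₁ z p) (proj₁ H p) (proj₁ K p)) (sym (e p)) (s p))) }
    ; E-irr = proj₁ }

  -- The complete graph, so that cliques are just finite sets of antichains: on the chain side the
  -- simplex condition is carried by `Simp` and not by edges.
  AG : Graph
  AG = record
    { V = Anti P ; _≈_ = λ A B → proj₁ A ≗ᵛ proj₁ B
    ; ≈-refl = λ _ → refl ; ≈-sym = ≗ᵛ-sym ; ≈-trans = ≗ᵛ-trans
    ; _≈?_ = λ A B → proj₁ A ≗ᵛ? proj₁ B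
    ; E = λ A B → ¬ (proj₁ A ≗ᵛ proj₁ B)
    ; E-sym = λ n e → n (≗ᵛ-sym e)
    ; E-resp = λ e n f → n (≗ᵛ-trans e f)
    ; E-irr = λ n → n }

  -- The comparability graph; its cliques are the chains of `P`, listed in any order.
  CG : Graph
  CG = record
    { V = Carrier P ; _≈_ = _≡_ ; ≈-refl = refl ; ≈-sym = sym ; ≈-trans = trans ; _≈?_ = _≟C_
    ; E = λ p q → p ≢ q × (_≼_ P p q ⊎ _≼_ P q p)
    ; E-sym = λ { (n , c) → (λ e → n (sym e)) , [ inj₂ , inj₁ ]′ c }
    ; E-resp = λ { refl e → e }
    ; E-irr = proj₁ }

  base : Bool → Filter P
  base b = (λ _ → b) , λ _ _ _ e → e

  ∅ : Anti P
  ∅ = (λ _ → false) , λ _ _ ()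

  -- `F` and `G` differ at `p`, so exactly one of `H` and `K` contains `p`; being a filter, it
  -- contains all of `G`. This leaves no freedom at the points where `F` and `G` differ.
  least-edge : ∀ {F G : Filter P} p → (∀ t → proj₁ F t ≡ true → proj₁ G t ≡ true) →
    proj₁ G p ≡ true → proj₁ F p ≡ false → (∀ t → proj₁ G t ≡ true → _≼_ P p t) → Edge F G
  least-edge {F , _} {G , _} p F⊆G Gp Fp least = (λ e → true≢false Gp (trans (sym (e p)) Fp)) , edge
    where
    resolve : ∀ (H K : Filter P) → (∀ t → Swap (F t) (G t) (proj₁ H t) (proj₁ K t)) → proj₁ K p ≡ true →
              proj₁ H ≗ᵛ F × proj₁ K ≗ᵛ G
    resolve (H , _) (K , Kf) s Kp = (λ t → proj₁ (at t)) , λ t → proj₂ (at t)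
      where
      at : ∀ t → H t ≡ F t × K t ≡ G t
      at t with F t in Fr | G t in Gr | s t
      ... | _ | _ | inj₁ x = x
      ... | true | true | inj₂ x = x
      ... | false | false | inj₂ x = x
      ... | true | false | inj₂ x = ⊥-elim (true≢false (F⊆G t Fr) Gr)
      ... | false | true | inj₂ (_ , k) = ⊥-elim (true≢false (Kf p t (least t Gr) Kp) k)
    edge : ∀ H K → (∀ t → Swap (F t) (G t) (proj₁ H t) (proj₁ K t)) → _
    edge H K s with s p
    ... | inj₁ (_ , k) = inj₁ (resolve H K s (trans k Gp))
    ... | inj₂ (h , _) = inj₂ (swap (resolve K H (λ t → Swap-flip (s t)) (trans h Gp)))

  -- Dual to `least-edge`: the one of `H` and `K` that misses `p` misses everything outside `F`.
  greatest-edge : ∀ {F G : Filter P} p → (∀ t → proj₁ F t ≡ true → proj₁ G t ≡ true) →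
    proj₁ G p ≡ true → proj₁ F p ≡ false → (∀ t → proj₁ F t ≡ false → _≼_ P t p) → Edge F G
  greatest-edge {F , _} {G , _} p F⊆G Gp Fp greatest = (λ e → true≢false Gp (trans (sym (e p)) Fp)) , edge
    where
    resolve : ∀ (H K : Filter P) → (∀ t → Swap (F t) (G t) (proj₁ H t) (proj₁ K t)) → proj₁ H p ≡ false →
              proj₁ H ≗ᵛ F × proj₁ K ≗ᵛ G
    resolve (H , Hf) (K , _) s Hp = (λ t → proj₁ (at t)) , λ t → proj₂ (at t)
      where
      at : ∀ t → H t ≡ F t × K t ≡ G t
      at t with F t in Fr | G t in Gr | s t
      ... | _ | _ | inj₁ x = x
      ... | true | true | inj₂ x = x
      ... | false | false | inj₂ x = x
      ... | true | false | inj₂ x = ⊥-elim (true≢false (F⊆G t Fr) Gr)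
      ... | false | true | inj₂ (h , _) = ⊥-elim (true≢false (Hf t p (greatest t Fr) h) Hp)
    edge : ∀ H K → (∀ t → Swap (F t) (G t) (proj₁ H t) (proj₁ K t)) → _
    edge H K s with s p
    ... | inj₁ (h , _) = inj₁ (resolve H K s (trans h Fp))
    ... | inj₂ (_ , k) = inj₂ (swap (resolve K H (λ t → Swap-flip (s t)) (trans k Fp)))

  _⊆ᵛ_ : Vtx P → Vtx P → Set
  F ⊆ᵛ G = ∀ p → F p ≡ true → G p ≡ true

  meet join : Filter P → Filter P → Filter P
  meet (F , f) (G , g) = (λ p → F p ∧ G p) , λ p q le e → both (f p q le (fst (F p) e)) (g p q le (snd (F p) e))
    where
    fst : ∀ a {b} → a ∧ b ≡ true → a ≡ true
    fst true _ = refl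
    snd : ∀ a {b} → a ∧ b ≡ true → b ≡ true
    snd true e = e
    both : ∀ {a b} → a ≡ true → b ≡ true → a ∧ b ≡ true
    both refl refl = refl
  join (F , f) (G , g) = (λ p → F p ∨ G p) , λ p q le → up p q le
    where
    ∨-true : ∀ a {b} → b ≡ true → a ∨ b ≡ true
    ∨-true true _ = refl
    ∨-true false e = e
    up : ∀ p q → _≼_ P p q → F p ∨ G p ≡ true → F q ∨ G q ≡ true
    up p q le e with F p in Fp
    ... | true rewrite f p q le Fp = refl
    ... | false = ∨-true (F q) (g p q le e)

  -- Meet and join have the same sum of indicators as `F` and `G`, so an edge forces the meet to be
  -- one of the two.
  edge⇒comparable : ∀ {F G : Filter P} → Edge F G → (proj₁ F ⊆ᵛ proj₁ G) ⊎ (proj₁ G ⊆ᵛ proj₁ F)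
  edge⇒comparable {F} {G} (_ , h) with h (meet F G) (join F G) (λ p → sw (proj₁ F p) (proj₁ G p))
    where
    sw : ∀ a b → Swap a b (a ∧ b) (a ∨ b)
    sw true true = inj₁ (refl , refl)
    sw true false = inj₂ (refl , refl)
    sw false true = inj₁ (refl , refl)
    sw false false = inj₁ (refl , refl)
  ... | inj₁ (_ , j) = inj₁ (λ p e → trans (sym (j p)) (∨ˡ e))
    where
    ∨ˡ : ∀ {a b} → a ≡ true → a ∨ b ≡ true
    ∨ˡ refl = refl
  ... | inj₂ (m , _) = inj₂ (λ p e → ∧ˡ (proj₁ F p) (trans (m p) e))
    where
    ∧ˡ : ∀ a {b} → a ∧ b ≡ true → a ≡ true
    ∧ˡ true _ = refl

DecOrder : FinPoset → Set
DecOrder P = ∀ p q → Dec (_≼_ P p q)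

module Principal (P : FinPoset) (_≤?_ : DecOrder P) where
  open Elements P

  up co-down : Carrier P → Filter P
  up p = (λ t → does (p ≤? t)) , λ q t le e → dec-true (p ≤? t) (≼-trans (true⇒ (p ≤? q) e) le)
  co-down p = (λ t → not (does (t ≤? p))) , λ q t le e → flip le (t ≤? p) (q ≤? p) e
    where
    flip : ∀ {q t} → _≼_ P q t → (d : Dec (_≼_ P t p)) (d' : Dec (_≼_ P q p)) → not (does d') ≡ true → not (does d) ≡ true
    flip le (no _) _ _ = refl
    flip le (yes m) (no n) _ = ⊥-elim (n (≼-trans le m))

  -- Neighbours of `base b` indexed by `P`: principal filters at the empty filter, complements of
  -- principal ideals at the full one. Both families reverse the order, and chains of `P` become
  -- simplices in the link.
  principal : Bool → Carrier P → Filter P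
  principal false = up
  principal true = co-down

  base-edge : ∀ b p → Edge P (base P b) (principal b p)
  base-edge false p = least-edge P {base P false} {up p} p (λ _ ()) (dec-true (p ≤? p) ≼-refl) refl (λ t e → true⇒ (p ≤? t) e)
  base-edge true p = Graph.E-sym (OG P) {co-down p} {base P true} (greatest-edge P {co-down p} {base P true} p (λ _ _ → refl) refl
    (cong not (dec-true (p ≤? p) ≼-refl)) (λ t e → below (t ≤? p) e))
    where
    below : ∀ {t} (d : Dec (_≼_ P t p)) → not (does d) ≡ false → _≼_ P t p
    below (yes le) _ = le

  principal-edge< : ∀ b p q → p ≢ q → _≼_ P p q → Edge P (principal b p) (principal b q)
  principal-edge< false p q n le = Graph.E-sym (OG P) {up q} {up p} (least-edge P {up q} {up p} p
    (λ t e → dec-true (p ≤? t) (≼-trans le (true⇒ (q ≤? t) e))) (dec-true (p ≤? p) ≼-refl)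
    (dec-false (q ≤? p) (λ m → n (≼-antisym le m))) (λ t e → true⇒ (p ≤? t) e))
  principal-edge< true p q n le = Graph.E-sym (OG P) {co-down q} {co-down p} (greatest-edge P {co-down q} {co-down p} q
    (λ t e → flip (t ≤? p) (t ≤? q) e) (cong not (dec-false (q ≤? p) (λ m → n (≼-antisym le m))))
    (cong not (dec-true (q ≤? q) ≼-refl)) (λ t e → below (t ≤? q) e))
    where
    below : ∀ {t} (d : Dec (_≼_ P t q)) → not (does d) ≡ false → _≼_ P t q
    below (yes le) _ = le
    flip : ∀ {t} (d : Dec (_≼_ P t p)) (d' : Dec (_≼_ P t q)) → not (does d') ≡ true → not (does d) ≡ true
    flip (no _) _ _ = refl
    flip (yes m) (no k) _ = ⊥-elim (k (≼-trans m le))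

  principal-edge : ∀ b p q → Graph.E (CG P) p q → Edge P (principal b p) (principal b q)
  principal-edge b p q (n , inj₁ le) = principal-edge< b p q n le
  principal-edge b p q (n , inj₂ le) = Graph.E-sym (OG P) {principal b q} {principal b p} (principal-edge< b q p (λ e → n (sym e)) le)

  principal-⊆ : ∀ b p q → _⊆ᵛ_ P (proj₁ (principal b p)) (proj₁ (principal b q)) → _≼_ P q p
  principal-⊆ false p q s = true⇒ (q ≤? p) (s p (dec-true (p ≤? p) ≼-refl))
  principal-⊆ true p q s with q ≤? p | s q
  ... | yes le | _ = le
  ... | no n | h = ⊥-elim (true≢false (h refl) (cong not (dec-true (q ≤? q) ≼-refl)))

  principal-injective : ∀ b p q → _≗ᵛ_ P (proj₁ (principal b p)) (proj₁ (principal b q)) → p ≡ q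
  principal-injective b p q e = ≼-antisym (principal-⊆ b q p (λ t x → trans (e t) x)) (principal-⊆ b p q (λ t x → trans (sym (e t)) x))

  principal-edge⁻ : ∀ b p q → Edge P (principal b p) (principal b q) → Graph.E (CG P) p q
  principal-edge⁻ b p q e = (λ { refl → proj₁ e (λ _ → refl) }) ,
    [ (λ s → inj₂ (principal-⊆ b p q s)) , (λ s → inj₁ (principal-⊆ b q p s)) ]′ (edge⇒comparable P {principal b p} {principal b q} e)

-- Affine functions and certificates of simplex faces

nonpos-+ : ∀ {a b} → a ≤ℚ 0ℚ → b ≤ℚ 0ℚ → a +ℚ b ≤ℚ 0ℚ
nonpos-+ {a} {b} a≤0 b≤0 = ℚ.≤-trans (ℚ.+-mono-≤ a≤0 b≤0) (ℚ.≤-reflexive (ℚ.+-identityˡ 0ℚ))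

nonpos-+≡0 : ∀ {a b} → a ≤ℚ 0ℚ → b ≤ℚ 0ℚ → a +ℚ b ≡ 0ℚ → a ≡ 0ℚ × b ≡ 0ℚ
nonpos-+≡0 {a} {b} a≤0 b≤0 e = half a≤0 b≤0 e , half b≤0 a≤0 (trans (ℚ.+-comm b a) e)
  where
  half : ∀ {a b} → a ≤ℚ 0ℚ → b ≤ℚ 0ℚ → a +ℚ b ≡ 0ℚ → a ≡ 0ℚ
  half {a} {b} a≤0 b≤0 e = ℚ.≤-antisym a≤0 (ℚ.≤-trans (ℚ.≤-reflexive (sym e))
    (ℚ.≤-trans (ℚ.+-monoʳ-≤ a b≤0) (ℚ.≤-reflexive (ℚ.+-identityʳ a))))

+-interchange : ∀ a b c d → (a +ℚ b) +ℚ (c +ℚ d) ≡ (a +ℚ c) +ℚ (b +ℚ d)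
+-interchange = solve 4 (λ a b c d → ((a :+ b) :+ (c :+ d)) := ((a :+ c) :+ (b :+ d))) refl

-- Syntax of affine functions, so that they can be pulled back by substitution.
infixl 6 _⊞_
infixr 7 _⊠_
data Aff (C : Set) : Set where
  con : ℚ → Aff C
  var : C → Aff C
  _⊞_ : Aff C → Aff C → Aff C
  _⊠_ : ℚ → Aff C → Aff C

⟦_⟧ : ∀ {C} → Aff C → (C → ℚ) → ℚ
⟦ con a ⟧ x = a
⟦ var c ⟧ x = x c
⟦ e ⊞ f ⟧ x = ⟦ e ⟧ x +ℚ ⟦ f ⟧ x
⟦ a ⊠ e ⟧ x = a *ℚ ⟦ e ⟧ x

⟦⟧-cong : ∀ {C} (e : Aff C) {x y} → (∀ c → x c ≡ y c) → ⟦ e ⟧ x ≡ ⟦ e ⟧ y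
⟦⟧-cong (con a) h = refl
⟦⟧-cong (var c) h = h c
⟦⟧-cong (e ⊞ f) h = cong₂ _+ℚ_ (⟦⟧-cong e h) (⟦⟧-cong f h)
⟦⟧-cong (a ⊠ e) h = cong (a *ℚ_) (⟦⟧-cong e h)

sub : ∀ {C D} → (C → Aff D) → Aff C → Aff D
sub σ (con a) = con a
sub σ (var c) = σ c
sub σ (e ⊞ f) = sub σ e ⊞ sub σ f
sub σ (a ⊠ e) = a ⊠ sub σ e

⟦sub⟧ : ∀ {C D} (σ : C → Aff D) e x → ⟦ sub σ e ⟧ x ≡ ⟦ e ⟧ (λ c → ⟦ σ c ⟧ x)
⟦sub⟧ σ (con a) x = refl
⟦sub⟧ σ (var c) x = refl
⟦sub⟧ σ (e ⊞ f) x = cong₂ _+ℚ_ (⟦sub⟧ σ e x) (⟦sub⟧ σ f x)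
⟦sub⟧ σ (a ⊠ e) x = cong (a *ℚ_) (⟦sub⟧ σ e x)

-- With two points on each side the constants cancel, so affine functions suffice. Combined with
-- `χ-swap`, it turns an identity between sums of indicators into one between values of a supporting
-- or dual function.
⟦⟧-balance : ∀ {C} (e : Aff C) {x y z t} → (∀ c → x c +ℚ y c ≡ z c +ℚ t c) → ⟦ e ⟧ x +ℚ ⟦ e ⟧ y ≡ ⟦ e ⟧ z +ℚ ⟦ e ⟧ t
⟦⟧-balance (con a) h = refl
⟦⟧-balance (var c) h = h c
⟦⟧-balance (e ⊞ f) {x} {y} {z} {t} h = trans (+-interchange (⟦ e ⟧ x) _ _ _)
  (trans (cong₂ _+ℚ_ (⟦⟧-balance e h) (⟦⟧-balance f h)) (+-interchange (⟦ e ⟧ z) _ _ _))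
⟦⟧-balance (a ⊠ e) h = trans (sym (ℚ.*-distribˡ-+ a _ _)) (trans (cong (a *ℚ_) (⟦⟧-balance e h)) (ℚ.*-distribˡ-+ a _ _))

sumA : ∀ {C D : Set} → List D → (D → Aff C) → Aff C
sumA [] f = con 0ℚ
sumA (d ∷ ds) f = f d ⊞ sumA ds f

module _ {C D : Set} (x : C → ℚ) (f : D → Aff C) where
  sumA-≤0 : ∀ ds → (∀ d → ⟦ f d ⟧ x ≤ℚ 0ℚ) → ⟦ sumA ds f ⟧ x ≤ℚ 0ℚ
  sumA-≤0 [] h = ℚ.≤-refl
  sumA-≤0 (d ∷ ds) h = nonpos-+ (h d) (sumA-≤0 ds h)

  sumA-≡0⁻ : ∀ ds → (∀ d → ⟦ f d ⟧ x ≤ℚ 0ℚ) → ⟦ sumA ds f ⟧ x ≡ 0ℚ → ∀ d → Any (d ≡_) ds → ⟦ f d ⟧ x ≡ 0ℚ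
  sumA-≡0⁻ (d ∷ ds) h e _ (here refl) = proj₁ (nonpos-+≡0 (h d) (sumA-≤0 ds h) e)
  sumA-≡0⁻ (d ∷ ds) h e c (there m) = sumA-≡0⁻ ds h (proj₂ (nonpos-+≡0 (h d) (sumA-≤0 ds h) e)) c m

  sumA-≡0 : ∀ ds → (∀ d → Any (d ≡_) ds → ⟦ f d ⟧ x ≡ 0ℚ) → ⟦ sumA ds f ⟧ x ≡ 0ℚ
  sumA-≡0 [] h = refl
  sumA-≡0 (d ∷ ds) h rewrite h d (here refl) | sumA-≡0 ds (λ c m → h c (there m)) = ℚ.+-identityˡ 0ℚ

χ : Bool → ℚ
χ true = 1ℚ
χ false = 0ℚ

χ≥0 : ∀ b → 0ℚ ≤ℚ χ b
χ≥0 true = toWitness {a? = 0ℚ ℚ.≤? 1ℚ} _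
χ≥0 false = ℚ.≤-refl

χ-swap : ∀ {a b c d} → Swap a b c d → χ c +ℚ χ d ≡ χ a +ℚ χ b
χ-swap (inj₁ (refl , refl)) = refl
χ-swap {a} {b} (inj₂ (refl , refl)) = ℚ.+-comm (χ b) (χ a)

-1ℚ : ℚ
-1ℚ = - 1ℚ

-χ≤0 : ∀ b → -1ℚ *ℚ χ b ≤ℚ 0ℚ
-χ≤0 true = toWitness {a? = (-1ℚ *ℚ 1ℚ) ℚ.≤? 0ℚ} _
-χ≤0 false = ℚ.≤-refl

⟦_⟧ᵇ : ∀ {C} → Aff C → (C → Bool) → ℚ
⟦ e ⟧ᵇ F = ⟦ e ⟧ (χ ∘ F)

⟦⟧ᵇ-cong : ∀ {C} (e : Aff C) {F G} → (∀ c → F c ≡ G c) → ⟦ e ⟧ᵇ F ≡ ⟦ e ⟧ᵇ G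
⟦⟧ᵇ-cong e h = ⟦⟧-cong e (λ c → cong χ (h c))

module _ (P : FinPoset) where
  open Cliques (AG P)

  -- A simplex face of the chain polytope, given by its vertices: face ≤ 0 is valid and
  -- tight exactly at these, and the functions dual witness affine independence.
  record Simp : Set where
    field
      pts   : List (Anti P)
      uniq  : IsClique pts
      face  : Aff (Carrier P)
      face≤ : ∀ (A : Anti P) → ⟦ face ⟧ᵇ (proj₁ A) ≤ℚ 0ℚ
      face→ : ∀ A → ⟦ face ⟧ᵇ (proj₁ A) ≡ 0ℚ → A ∈ pts
      face← : ∀ A → A ∈ pts → ⟦ face ⟧ᵇ (proj₁ A) ≡ 0ℚ
      dual  : ∀ A → A ∈ pts → Σ (Aff (Carrier P)) λ u →
              ⟦ u ⟧ᵇ (proj₁ A) ≢ 0ℚ × (∀ B → B ∈ pts → ¬ (B ≈ A) → ⟦ u ⟧ᵇ (proj₁ B) ≡ 0ℚ)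

  Simps Simps∌∅ : Graded
  Simps = record { El = Simp ; _≋_ = λ s t → Simp.pts s ~ Simp.pts t ; deg = λ s → length (Simp.pts s) }
  Simps∌∅ = record { El = Σ Simp λ s → ¬ (∅ P ∈ Simp.pts s)
                   ; _≋_ = λ s t → Simp.pts (proj₁ s) ~ Simp.pts (proj₁ t) ; deg = λ s → length (Simp.pts (proj₁ s)) }

infix 30 _⁺
-- Multiplication of a generating function by its variable: it counts the apex of a cone.
_⁺ : Graded → Graded
X ⁺ = record { El = El X ; _≋_ = _≋_ X ; deg = λ x → suc (deg X x) }

Chains : FinPoset → Graded
Chains P = Cliques.Cl (CG P)

-- Simplex faces of the chain polytope through the origin

module Singletons (P : FinPoset) where
  open Elements P

  single : Carrier P → Anti P
  single p = (λ q → does (p ≟C q)) , λ q t e e' _ → trans (sym (true⇒ (p ≟C q) e)) (true⇒ (p ≟C t) e')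

  single-self : ∀ p → proj₁ (single p) p ≡ true
  single-self p = dec-true (p ≟C p) refl

  single-other : ∀ {p q} → p ≢ q → proj₁ (single p) q ≡ false
  single-other {p} {q} n = dec-false (p ≟C q) n

  single-injective : ∀ {p q} → _≗ᵛ_ P (proj₁ (single p)) (proj₁ (single q)) → p ≡ q
  single-injective {p} {q} e = sym (true⇒ (q ≟C p) (trans (sym (e p)) (single-self p)))

  single≉∅ : ∀ {p} → ¬ _≗ᵛ_ P (proj₁ (single p)) (λ _ → false)
  single≉∅ {p} e = true≢false (single-self p) (e p)

  ≈single : ∀ (A : Anti P) p → proj₁ A p ≡ true → (∀ q → proj₁ A q ≡ true → p ≡ q) → _≗ᵛ_ P (proj₁ A) (proj₁ (single p))
  ≈single A p Ap h q = ≡-by-true (λ e → dec-true (p ≟C q) (h q e)) (λ e → subst (λ z → proj₁ A z ≡ true) (true⇒ (p ≟C q) e) Ap)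

module ChainSimplices (P : FinPoset) (_≤?_ : DecOrder P) where
  open Elements P
  open Singletons P
  private
    module A = Cliques (AG P)
    module K = Cliques (CG P)
  open Simp

  private module T = Transport (AG P) (CG P) single (λ e q → cong (λ p → proj₁ (single p) q) e) single-injective

  module _ (σ : Simp P) (∅∈ : ∅ P A.∈ pts σ) where

    private
      tight∅ = face← σ (∅ P) ∅∈

      -- Two antichains with 1_B + 1_C = 1_A + 1_∅ lie on every face through A and ∅.
      on-face : ∀ (A B C : Anti P) → A A.∈ pts σ → (∀ q → Swap (proj₁ A q) false (proj₁ B q) (proj₁ C q)) →
                B A.∈ pts σ × C A.∈ pts σ
      on-face A B C A∈ s = face→ σ B (proj₁ both) , face→ σ C (proj₂ both)
        where
        bal : ⟦ face σ ⟧ᵇ (proj₁ B) +ℚ ⟦ face σ ⟧ᵇ (proj₁ C) ≡ 0ℚ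
        bal = trans (⟦⟧-balance (face σ) (λ q → χ-swap (s q))) (cong₂ _+ℚ_ (face← σ A A∈) tight∅)
        both : ⟦ face σ ⟧ᵇ (proj₁ B) ≡ 0ℚ × ⟦ face σ ⟧ᵇ (proj₁ C) ≡ 0ℚ
        both = nonpos-+≡0 (face≤ σ B) (face≤ σ C) bal

      remove : Anti P → Carrier P → Anti P
      remove A p = (λ q → if does (p ≟C q) then false else proj₁ A q) ,
                   λ q t e e' → proj₂ A q t (keep (does (p ≟C q)) e) (keep (does (p ≟C t)) e')
        where
        keep : ∀ b {c} → (if b then false else c) ≡ true → c ≡ true
        keep false e = e

    -- If `A` contains `p` and something else, then `p` alone and `A` without `p` lie on the face as
    -- well, and their indicators have the same sum as those of `A` and the empty set. The dual
    -- function of `A` vanishes at the other three points, so it would vanish at `A`.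
    singletons : ∀ A → A A.∈ pts σ → ¬ (A A.≈ ∅ P) → Σ (Carrier P) λ p → A A.≈ single p
    singletons A A∈ n with anyC? (λ p → proj₁ A p ≟B true)
    ... | no none = ⊥-elim (n (λ p → ¬true⇒false (λ e → none (p , e))))
    ... | yes (p , Ap) with A A.≈? single p
    ...   | yes e = p , e
    ...   | no A≉p = ⊥-elim (u≢0 (trans (sym (ℚ.+-identityʳ _)) (trans (cong (⟦ u ⟧ᵇ (proj₁ A) +ℚ_) (sym (u0 (∅ P) ∅∈ (λ e → n (A.≈-sym {∅ P} {A} e)))))
                 (trans (sym (⟦⟧-balance u (λ q → χ-swap (s q))))
                 (trans (cong₂ _+ℚ_ (u0 (single p) (proj₁ on) (λ e → A≉p (A.≈-sym {single p} {A} e))) (u0 (remove A p) (proj₂ on) rem≉)) (ℚ.+-identityˡ 0ℚ))))))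
      where
      s : ∀ q → Swap (proj₁ A q) false (proj₁ (single p) q) (proj₁ (remove A p) q)
      s q with p ≟C q
      ... | yes refl = inj₁ (sym Ap , refl)
      ... | no _ = inj₂ (refl , refl)
      on = on-face A (single p) (remove A p) A∈ s
      u = proj₁ (dual σ A A∈)
      u≢0 = proj₁ (proj₂ (dual σ A A∈))
      u0 = proj₂ (proj₂ (dual σ A A∈))
      rem≉ : ¬ (remove A p A.≈ A)
      rem≉ e with does (p ≟C p) | dec-true (p ≟C p) refl | e p
      ... | true | refl | x = true≢false Ap (sym x)

    -- For incomparable `p` and `q` the antichain of both would be tight too, since together with
    -- the origin it balances the two singletons; but `singletons` allows no antichain with two
    -- elements on the face.
    comparable : ∀ p q → p ≢ q → single p A.∈ pts σ → single q A.∈ pts σ → _≼_ P p q ⊎ _≼_ P q p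
    comparable p q p≢q p∈ q∈ with p ≤? q | q ≤? p
    ... | yes le | _ = inj₁ le
    ... | no _ | yes le = inj₂ le
    ... | no n | no m = ⊥-elim (no-single (singletons pq pq∈ (λ e → true≢false (pq-p) (e p))))
      where
      pq : Anti P
      pq = (λ t → does (p ≟C t) ∨ does (q ≟C t)) , λ a b e e' le → anti (mem a e) (mem b e') le
        where
        mem : ∀ t → does (p ≟C t) ∨ does (q ≟C t) ≡ true → (p ≡ t) ⊎ (q ≡ t)
        mem t e with p ≟C t | q ≟C t
        ... | yes x | _ = inj₁ x
        ... | no _ | yes y = inj₂ y
        anti : ∀ {a b} → (p ≡ a) ⊎ (q ≡ a) → (p ≡ b) ⊎ (q ≡ b) → _≼_ P a b → a ≡ b
        anti (inj₁ refl) (inj₁ refl) _ = refl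
        anti (inj₁ refl) (inj₂ refl) le = ⊥-elim (n le)
        anti (inj₂ refl) (inj₁ refl) le = ⊥-elim (m le)
        anti (inj₂ refl) (inj₂ refl) _ = refl
      pq-p : proj₁ pq p ≡ true
      pq-p rewrite dec-true (p ≟C p) refl = refl
      pq-q : proj₁ pq q ≡ true
      pq-q with does (p ≟C q)
      ... | true = refl
      ... | false = dec-true (q ≟C q) refl
      s : ∀ t → Swap (proj₁ pq t) false (proj₁ (single p) t) (proj₁ (single q) t)
      s t with p ≟C t | q ≟C t
      ... | yes refl | yes e = ⊥-elim (p≢q (sym e))
      ... | yes _ | no _ = inj₁ (refl , refl)
      ... | no _ | yes _ = inj₂ (refl , refl)
      ... | no _ | no _ = inj₁ (refl , refl)
      bal : ⟦ face σ ⟧ᵇ (proj₁ pq) ≡ 0ℚ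
      bal = trans (sym (ℚ.+-identityʳ _)) (trans (cong (⟦ face σ ⟧ᵇ (proj₁ pq) +ℚ_) (sym tight∅))
            (trans (sym (⟦⟧-balance (face σ) (λ t → χ-swap (s t)))) (cong₂ _+ℚ_ (face← σ (single p) p∈) (face← σ (single q) q∈))))
      pq∈ = face→ σ pq bal
      no-single : ¬ (Σ (Carrier P) λ t → pq A.≈ single t)
      no-single (t , e) = p≢q (trans (sym (true⇒ (t ≟C p) (trans (sym (e p)) pq-p))) (true⇒ (t ≟C q) (trans (sym (e q)) pq-q)))

  data Split : Simp P → El (Chains P ⁺ ⊎ᵍ Simps∌∅ P) → Set where
    chain : ∀ {σ} (X : A.Extract (∅ P) (pts σ)) (S : T.Preimage (A.Extract.rest X)) {c} → Split σ (inj₁ (T.Preimage.elts S , c))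
    other : ∀ {σ n} → Split σ (inj₂ (σ , n))

  split : ∀ σ → Σ _ (Split σ)
  split σ with ∅ P A.∈? pts σ
  ... | no n = inj₂ (σ , n) , other
  ... | yes ∅∈ = inj₁ (_ , T.Preimage.clique S X.clique
                    (λ p q p∈ q∈ n → let p≢q = λ { refl → n (λ _ → refl) } in
                      p≢q , comparable σ ∅∈ p q p≢q (X.rest⊆ (single p) p∈) (X.rest⊆ (single q) q∈))) , chain X' S
    where
    X' = A.extract (uniq σ) ∅∈
    module X = A.Extract X'
    S = T.preimage X.rest (λ A m → singletons σ ∅∈ A (X.rest⊆ A m) (λ e → X.link A m (A.≈-sym {A} {∅ P} e)))

  -- By `singletons` and `comparable`, a simplex through the origin consists of the origin and the
  -- singletons of a chain.
  splitting : Simps P ↪ (Chains P ⁺ ⊎ᵍ Simps∌∅ P)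
  fun splitting σ = proj₁ (split σ)
  inj splitting σ τ = reflect {σ} {τ} (proj₂ (split σ)) (proj₂ (split τ))
    where
    half : ∀ σ τ (X : A.Extract (∅ P) (pts σ)) (S : T.Preimage (A.Extract.rest X))
           (Y : A.Extract (∅ P) (pts τ)) (T : T.Preimage (A.Extract.rest Y)) →
           T.Preimage.elts S K.⊆ T.Preimage.elts T → pts σ A.⊆ pts τ
    half σ τ X S Y T s A m with A.Extract.split X {A} m
    ... | inj₁ e = A.∈-resp {∅ P} {A} (A.≈-sym {A} {∅ P} e) (A.Extract.mem Y)
    ... | inj₂ m' = A.Extract.rest⊆ Y A (T.preimage-⊆ S T s A m')
    reflect : ∀ {σ τ u v} → Split σ u → Split τ v → Sum≋ (Chains P ⁺) (Simps∌∅ P) u v → pts σ A.~ pts τ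
    reflect {σ} {τ} (chain X S) (chain Y T) (inl (a , b)) = half σ τ X S Y T a , half τ σ Y T X S b
    reflect other other (inr e) = e
  deg≡ splitting σ = degree {σ} (proj₂ (split σ))
    where
    degree : ∀ {σ u} → Split σ u → deg (Chains P ⁺ ⊎ᵍ Simps∌∅ P) u ≡ length (pts σ)
    degree other = refl
    degree (chain X S) = trans (cong suc (T.Preimage.len S)) (sym (A.Extract.len X))

  -- For the dual function of the origin, which is `1` minus the sum of the coordinates along the
  -- chain.
  chain-sum : ∀ ps → K.IsClique ps → ∀ q → (q K.∈ ps → ⟦ sumA ps (λ p → -1ℚ ⊠ var p) ⟧ᵇ (proj₁ (single q)) ≡ -1ℚ)
                                     × (¬ (q K.∈ ps) → ⟦ sumA ps (λ p → -1ℚ ⊠ var p) ⟧ᵇ (proj₁ (single q)) ≡ 0ℚ)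
  chain-sum [] _ q = (λ ()) , λ _ → refl
  chain-sum (p ∷ ps) (adj K.∷ c) q with chain-sum ps c q | q ≟C p
  ... | _ , z | yes refl rewrite z (K.link-∉ adj) = (λ _ → refl) , λ n → ⊥-elim (n (here refl))
  ... | o , z | no n = (λ { (here e) → ⊥-elim (n e) ; (there m) → trans (ℚ.+-identityˡ _) (o m) }) ,
                       λ k → trans (ℚ.+-identityˡ _) (z (λ m → k (there m)))

  -- The face on which all coordinates off the chain vanish. An antichain supported on a chain has
  -- at most one element, so the vertices are the origin and the singletons; the coordinate
  -- functions are dual to the singletons.
  chainSimp : El (Chains P) → Simp P
  chainSimp (ps , c) = record
    { pts = ∅ P ∷ map single ps
    ; uniq = (λ A m e → let (p , _ , e') = T.map-∈⁻ {A} ps m in single≉∅ {p} (λ q → sym (trans (e q) (e' q))))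
             A.∷ T.map-clique (λ p q _ _ n e → proj₁ n (single-injective e)) c
    ; face = sumA elems term
    ; face≤ = λ A → sumA-≤0 _ term elems (term≤0 A)
    ; face→ = face→'
    ; face← = λ A m → sumA-≡0 _ term elems (λ q _ → vanish A m q)
    ; dual = dual' }
    where
    term : Carrier P → Aff (Carrier P)
    term q = if does (q K.∈? ps) then con 0ℚ else (-1ℚ ⊠ var q)
    term≤0 : ∀ (A : Anti P) q → ⟦ term q ⟧ᵇ (proj₁ A) ≤ℚ 0ℚ
    term≤0 A q with does (q K.∈? ps)
    ... | true = ℚ.≤-refl
    ... | false = -χ≤0 (proj₁ A q)
    zero-off : ∀ (A : Anti P) q → ⟦ term q ⟧ᵇ (proj₁ A) ≡ 0ℚ → proj₁ A q ≡ true → q K.∈ ps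
    zero-off A q e Aq with q K.∈? ps
    ... | yes m = m
    ... | no _ rewrite Aq with () ← e
    face→' : ∀ (A : Anti P) → ⟦ sumA elems term ⟧ᵇ (proj₁ A) ≡ 0ℚ → A A.∈ (∅ P ∷ map single ps)
    face→' A e with anyC? (λ p → proj₁ A p ≟B true)
    ... | no none = here (λ p → ¬true⇒false (λ x → none (p , x)))
    ... | yes (p , Ap) = there (A.∈-resp {single p} {A} (A.≈-sym {A} {single p} (≈single A p Ap same)) (T.map-∈ (on p Ap)))
      where
      on : ∀ q → proj₁ A q ≡ true → q K.∈ ps
      on q = zero-off A q (sumA-≡0⁻ _ term elems (term≤0 A) e q (∈-elems q))
      same : ∀ q → proj₁ A q ≡ true → p ≡ q
      same q Aq with p ≟C q
      ... | yes x = x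
      ... | no n with proj₂ (K.clique-E c (on p Ap) (on q Aq) n)
      ...   | inj₁ le = proj₂ A p q Ap Aq le
      ...   | inj₂ le = sym (proj₂ A q p Aq Ap le)
    vanish : ∀ (A : Anti P) → A A.∈ (∅ P ∷ map single ps) → ∀ q → ⟦ term q ⟧ᵇ (proj₁ A) ≡ 0ℚ
    vanish A m q with q K.∈? ps
    ... | yes _ = refl
    vanish A (here e) q | no _ rewrite e q = refl
    vanish A (there m) q | no n with T.map-∈⁻ {A} ps m
    ... | p , p∈ , e rewrite e q | single-other {p} {q} (λ { refl → n p∈ }) = refl
    dual' : ∀ (A : Anti P) → A A.∈ (∅ P ∷ map single ps) → Σ (Aff (Carrier P)) λ u →
            ⟦ u ⟧ᵇ (proj₁ A) ≢ 0ℚ × (∀ B → B A.∈ (∅ P ∷ map single ps) → ¬ (B A.≈ A) → ⟦ u ⟧ᵇ (proj₁ B) ≡ 0ℚ)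
    dual' A (here e) = u , (λ x → 1≢0 (trans (sym u∅) (trans (sym (⟦⟧ᵇ-cong u e)) x))) , others
      where
      u = con 1ℚ ⊞ sumA ps (λ p → -1ℚ ⊠ var p)
      1≢0 : 1ℚ ≢ 0ℚ
      1≢0 ()
      u∅ : ⟦ u ⟧ᵇ (λ _ → false) ≡ 1ℚ
      u∅ = trans (cong (1ℚ +ℚ_) (sumA-≡0 _ (λ p → -1ℚ ⊠ var p) ps (λ _ _ → refl))) (ℚ.+-identityʳ 1ℚ)
      others : ∀ B → B A.∈ (∅ P ∷ map single ps) → ¬ (B A.≈ A) → ⟦ u ⟧ᵇ (proj₁ B) ≡ 0ℚ
      others B (here e') n = ⊥-elim (n (λ q → trans (e' q) (sym (e q))))
      others B (there m) n with T.map-∈⁻ {B} ps m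
      ... | p , p∈ , e' = trans (⟦⟧ᵇ-cong u e') (cong (1ℚ +ℚ_) (proj₁ (chain-sum ps c p) p∈))
    dual' A (there m) with T.map-∈⁻ {A} ps m
    ... | p , p∈ , e = var p , (λ x → nz (e p) x) , others
      where
      nz : proj₁ A p ≡ proj₁ (single p) p → χ (proj₁ A p) ≢ 0ℚ
      nz e' rewrite e' | single-self p = λ ()
      others : ∀ B → B A.∈ (∅ P ∷ map single ps) → ¬ (B A.≈ A) → χ (proj₁ B p) ≡ 0ℚ
      others B (here e') n rewrite e' p = refl
      others B (there m') n with T.map-∈⁻ {B} ps m'
      ... | q , q∈ , e' rewrite e' p with q ≟C p
      ...   | no _ = refl
      ...   | yes refl = ⊥-elim (n (λ t → trans (e' t) (sym (e t))))

  chainSimp-inj : ∀ c d → pts (chainSimp c) A.~ pts (chainSimp d) → proj₁ c K.~ proj₁ d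
  chainSimp-inj c d e = T.map-~⁻ (A.∷-injective (∅∉ (proj₁ c)) (∅∉ (proj₁ d)) e)
    where
    ∅∉ : ∀ ps → ¬ (∅ P A.∈ map single ps)
    ∅∉ ps m with T.map-∈⁻ {∅ P} ps m
    ... | p , _ , e = single≉∅ {p} (λ q → sym (e q))

chains-coded : ∀ P → Coded (Chains P ⁺) (2 ^ size P)
chains-coded P = record
  { code = λ c → funToFin (bits (proj₁ c))
  ; code-inj = λ c d e → half (proj₁ c) (proj₁ d) e , half (proj₁ d) (proj₁ c) (sym e)
  ; code-cong = λ c d e → funToFin-cong (λ i → cong bit (same e (from i)))
  ; deg-cong = λ c d e → cong suc (K.~-length (proj₂ c) (proj₂ d) e) }
  where
  open Elements P
  open Inverse (enum P) using (to; from)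
  module K = Cliques (CG P)
  bit : Bool → Fin 2
  bit true = suc zero
  bit false = zero
  bits : List (Carrier P) → Fin (size P) → Fin 2
  bits ps i = bit (does (from i K.∈? ps))
  bit-inj : ∀ a b → bit a ≡ bit b → a ≡ b
  bit-inj true true _ = refl
  bit-inj false false _ = refl
  half : ∀ ps qs → funToFin (bits ps) ≡ funToFin (bits qs) → ps K.⊆ qs
  half ps qs e p m = true⇒ (p K.∈? qs) (trans (sym same') (dec-true (p K.∈? ps) m))
    where
    pointwise : ∀ i → bits ps i ≡ bits qs i
    pointwise i = trans (sym (finToFun-funToFin (bits ps) i)) (trans (cong (λ j → finToFun j i) e) (finToFun-funToFin (bits qs) i))
    same' : does (p K.∈? ps) ≡ does (p K.∈? qs)
    same' = subst (λ q → does (q K.∈? ps) ≡ does (q K.∈? qs)) (from-to p) (bit-inj _ _ (pointwise (to p)))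
  same : ∀ {ps qs} → ps K.~ qs → ∀ p → does (p K.∈? ps) ≡ does (p K.∈? qs)
  same {ps} {qs} (s , s') p = ≡-by-true (λ e → dec-true (p K.∈? qs) (s p (true⇒ (p K.∈? ps) e)))
                                        (λ e → dec-true (p K.∈? ps) (s' p (true⇒ (p K.∈? qs) e)))
  funToFin-cong : ∀ {m n} {f g : Fin m → Fin n} → (∀ i → f i ≡ g i) → funToFin f ≡ funToFin g
  funToFin-cong {zero} h = refl
  funToFin-cong {suc m} h = cong₂ combine (h zero) (funToFin-cong (λ i → h (suc i)))

-- Surplus in the link against deficit away from the origin

module Redistribution (P : FinPoset) (_≤?_ : DecOrder P) (b : Bool) where
  open Elements P
  open Principal P _≤?_
  open ChainSimplices P _≤?_
  module O = Cliques (OG P)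
  module K = Cliques (CG P)
  module T = Transport (OG P) (CG P) (principal b) (λ e q → cong (λ p → proj₁ (principal b p) q) e) (principal-injective b _ _)

  principal? : ∀ F → Dec (Σ (Carrier P) λ p → F O.≈ principal b p)
  principal? F = anyC? (λ p → F O.≈? principal b p)

  -- The surplus `d` of the overview: simplices in the link of `base b` that do not come from a
  -- chain.
  NonPrincipal : Graded
  NonPrincipal = record { El = Σ (El (O.Link (base P b))) (λ τ → ¬ T.InImage (proj₁ τ))
                        ; _≋_ = λ τ τ' → proj₁ (proj₁ τ) O.~ proj₁ (proj₁ τ') ; deg = λ τ → length (proj₁ (proj₁ τ)) }

  chainLink : Chains P ↪ O.Link (base P b)
  fun chainLink (ps , c) = map (principal b) ps , T.map-clique (λ p q _ _ → principal-edge b p q) c , adj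
    where
    adj : O.Adj (base P b) (map (principal b) ps)
    adj F m with T.map-∈⁻ {F} ps m
    ... | p , _ , e = O.E-respʳ {principal b p} {F} {base P b} (O.≈-sym {F} {principal b p} e) (base-edge b p)
  inj chainLink (ps , _) (qs , _) e = T.map-~⁻ {ps} {qs} e
  deg≡ chainLink (ps , _) = length-map (principal b) ps

  chainLink-image : ∀ c → T.InImage (proj₁ (fun chainLink c))
  chainLink-image (ps , _) F m with T.map-∈⁻ {F} ps m
  ... | p , _ , e = p , e

  cone : El (O.Link (base P b)) → El O.Cl
  cone (xs , c , adj) = base P b ∷ xs , (adj O.∷ c)

  -- A clique is a cone over `base b` or avoids it, and what is coned over comes from a chain or
  -- does not. The case distinction is read backwards, since only an embedding into cliques is
  -- wanted.
  assemble : (Chains P ⁺ ⊎ᵍ (O.Avoid (base P b) ⊎ᵍ NonPrincipal ⁺)) ↪ O.Cl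
  fun assemble (inj₁ c) = cone (fun chainLink c)
  fun assemble (inj₂ (inj₁ (xs , c , _))) = xs , c
  fun assemble (inj₂ (inj₂ (τ , _))) = cone τ
  inj assemble (inj₁ c) (inj₁ d) e = inl (inj chainLink c d (O.∷-injective (∉ c) (∉ d) e))
    where
    ∉ : ∀ c → ¬ (base P b O.∈ proj₁ (fun chainLink c))
    ∉ c = O.link-∉ {base P b} (proj₂ (proj₂ (fun chainLink c)))
  inj assemble (inj₁ c) (inj₂ (inj₁ (ys , d , n))) (s , _) = ⊥-elim (n (s (base P b) (here (λ _ → refl))))
  inj assemble (inj₁ c) (inj₂ (inj₂ ((ys , d , adj) , n))) e = ⊥-elim (n (λ F m → chainLink-image c F (proj₂ tails F m)))
    where tails = O.∷-injective (O.link-∉ {base P b} (proj₂ (proj₂ (fun chainLink c)))) (O.link-∉ {base P b} adj) e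
  inj assemble (inj₂ (inj₁ (xs , c , n))) (inj₁ d) (_ , s) = ⊥-elim (n (s (base P b) (here (λ _ → refl))))
  inj assemble (inj₂ (inj₁ x)) (inj₂ (inj₁ y)) e = inr (inl e)
  inj assemble (inj₂ (inj₁ (xs , c , n))) (inj₂ (inj₂ y)) (_ , s) = ⊥-elim (n (s (base P b) (here (λ _ → refl))))
  inj assemble (inj₂ (inj₂ ((xs , _ , adj) , n))) (inj₁ c) e = ⊥-elim (n (λ F m → chainLink-image c F (proj₁ tails F m)))
    where tails = O.∷-injective (O.link-∉ {base P b} adj) (O.link-∉ {base P b} (proj₂ (proj₂ (fun chainLink c)))) e
  inj assemble (inj₂ (inj₂ x)) (inj₂ (inj₁ (ys , d , n))) (s , _) = ⊥-elim (n (s (base P b) (here (λ _ → refl))))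
  inj assemble (inj₂ (inj₂ ((xs , _ , adj) , _))) (inj₂ (inj₂ ((ys , _ , adj') , _))) e = inr (inr (O.∷-injective (O.link-∉ {base P b} adj) (O.link-∉ {base P b} adj') e))
  deg≡ assemble (inj₁ c) = cong suc (deg≡ chainLink c)
  deg≡ assemble (inj₂ (inj₁ _)) = refl
  deg≡ assemble (inj₂ (inj₂ _)) = refl

  -- With `t` marking degree and `c` counting chains, the hypothesis yields
  -- `t c + b + t d ≤ t c + b'`; cancelling `t c` leaves `b + t d ≤ b'`.
  redistribute : O.Cl ↪ Simps P → ¬ ¬ ((O.Avoid (base P b) ⊎ᵍ NonPrincipal ⁺) ↪ Simps∌∅ P)
  redistribute f = cancel _ _ _ _ (chains-coded P) ((assemble ⨾ f) ⨾ splitting)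

-- The induction hypothesis, and wedges of graphs

-- `links` is carried at both bases: an ordinal sum glues along the empty filter of the lower
-- summand and the full filter of the upper one, and has to return the bound at both of its own
-- bases.
record Bounds (P : FinPoset) : Set where
  field
    simplices : Cliques.Cl (OG P) ↪ Simps P
    links     : ∀ b → Cliques.Link (OG P) (base P b) ↪ Simps∌∅ P

-- W is X and Y glued along the vertex v = ιX x₀ = ιY y₀.
module Wedge (X Y W : Graph) (ιX : Graph.V X → Graph.V W) (ιY : Graph.V Y → Graph.V W)
             (ιX-cong : ∀ {x x'} → Graph._≈_ X x x' → Graph._≈_ W (ιX x) (ιX x'))
             (ιY-cong : ∀ {y y'} → Graph._≈_ Y y y' → Graph._≈_ W (ιY y) (ιY y'))
             (ιX-inj : ∀ {x x'} → Graph._≈_ W (ιX x) (ιX x') → Graph._≈_ X x x')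
             (ιY-inj : ∀ {y y'} → Graph._≈_ W (ιY y) (ιY y') → Graph._≈_ Y y y')
             (x₀ : Graph.V X) (y₀ : Graph.V Y) (glue : Graph._≈_ W (ιX x₀) (ιY y₀))
             (sep : ∀ {x y} → Graph._≈_ W (ιX x) (ιY y) → Graph._≈_ X x x₀ × Graph._≈_ Y y y₀)
             (cover : ∀ w → (Σ (Graph.V X) λ x → Graph._≈_ W w (ιX x)) ⊎ (Σ (Graph.V Y) λ y → Graph._≈_ W w (ιY y)))
             (ιX-E : ∀ {x x'} → Graph.E W (ιX x) (ιX x') → Graph.E X x x')
             (ιY-E : ∀ {y y'} → Graph.E W (ιY y) (ιY y') → Graph.E Y y y') where
  private
    module X = Cliques X
    module Y = Cliques Y
    module W = Cliques W

  v : W.V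
  v = ιX x₀

  record Parts (τ : List W.V) : Set where
    field
      xs   : List X.V
      ys   : List Y.V
      cxs  : X.IsClique xs
      cys  : Y.IsClique ys
      len  : length τ ≡ length xs + length ys
      x→   : ∀ x → x X.∈ xs → ιX x W.∈ τ
      x←   : ∀ x → ιX x W.∈ τ → x X.∈ xs
      y→   : ∀ y → y Y.∈ ys → ιY y W.∈ τ
      y←   : ∀ y → ιY y W.∈ τ → y Y.∈ ys

  -- A clique is determined by its traces on the two sides, whatever the edges across, because the
  -- target counts all pairs.
  parts : ∀ τ → W.IsClique τ → ¬ (v W.∈ τ) → Parts τ
  parts [] _ _ = record { xs = [] ; ys = [] ; cxs = X.[] ; cys = Y.[] ; len = refl
                        ; x→ = λ _ () ; x← = λ _ () ; y→ = λ _ () ; y← = λ _ () }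
  parts (w ∷ τ) (adj W.∷ c) n with parts τ c (λ m → n (there m)) | cover w
  ... | R | inj₁ (x , e) = record
    { xs = x ∷ R.xs ; ys = R.ys
    ; cxs = (λ x' m → ιX-E (W.E-resp e (adj (ιX x') (R.x→ x' m)))) X.∷ R.cxs ; cys = R.cys
    ; len = cong suc R.len
    ; x→ = λ { _ (here q) → here (W.≈-trans (ιX-cong q) (W.≈-sym e)) ; x' (there m) → there (R.x→ x' m) }
    ; x← = λ { _ (here q) → here (ιX-inj (W.≈-trans q e)) ; x' (there m) → there (R.x← x' m) }
    ; y→ = λ y m → there (R.y→ y m)
    -- A vertex lying on both sides is the gluing vertex by `sep`, and `τ` avoids it.
    ; y← = λ { y (here q) → ⊥-elim (n (here (W.≈-trans (ιX-cong (X.≈-sym (proj₁ (sep (W.≈-trans (W.≈-sym e) (W.≈-sym q)))))) (W.≈-sym e))))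
             ; y (there m) → R.y← y m } }
    where module R = Parts R
  ... | R | inj₂ (y , e) = record
    { xs = R.xs ; ys = y ∷ R.ys
    ; cxs = R.cxs ; cys = (λ y' m → ιY-E (W.E-resp e (adj (ιY y') (R.y→ y' m)))) Y.∷ R.cys
    ; len = trans (cong suc R.len) (sym (+-suc (length R.xs) (length R.ys)))
    ; y→ = λ { _ (here q) → here (W.≈-trans (ιY-cong q) (W.≈-sym e)) ; y' (there m) → there (R.y→ y' m) }
    ; y← = λ { _ (here q) → here (ιY-inj (W.≈-trans q e)) ; y' (there m) → there (R.y← y' m) }
    ; x→ = λ x m → there (R.x→ x m)
    ; x← = λ { x (here q) → ⊥-elim (n (here (W.≈-trans glue (W.≈-trans (ιY-cong (Y.≈-sym (proj₂ (sep (W.≈-trans q e))))) (W.≈-sym e)))))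
             ; x (there m) → R.x← x m } }
    where module R = Parts R

  parts-⊆ : ∀ {τ τ'} (S : Parts τ) (T : Parts τ') → Parts.xs S X.⊆ Parts.xs T → Parts.ys S Y.⊆ Parts.ys T → τ W.⊆ τ'
  parts-⊆ S T p q w m with cover w
  ... | inj₁ (x , e) = W.∈-resp (W.≈-sym e) (Parts.x→ T x (p x (Parts.x← S x (W.∈-resp e m))))
  ... | inj₂ (y , e) = W.∈-resp (W.≈-sym e) (Parts.y→ T y (q y (Parts.y← S y (W.∈-resp e m))))

  extract-⊆ : ∀ {τ τ'} (S : W.Extract v τ) (T : W.Extract v τ') → W.Extract.rest S W.⊆ W.Extract.rest T → τ W.⊆ τ'
  extract-⊆ S T s w m with W.Extract.split S m
  ... | inj₁ e = W.∈-resp (W.≈-sym e) (W.Extract.mem T)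
  ... | inj₂ m' = W.Extract.rest⊆ T w (s w m')

  module Through (τ : List W.V) (S : W.Extract v τ) (T : Parts (W.Extract.rest S)) where
    module S = W.Extract S
    module T = Parts T
    x-adj : X.Adj x₀ T.xs
    x-adj x m = ιX-E (S.link (ιX x) (T.x→ x m))
    y-adj : Y.Adj y₀ T.ys
    y-adj y m = ιY-E (W.E-resp glue (S.link (ιY y) (T.y→ y m)))

  decompose : W.Cl ↪ ((X.Link x₀ ×ᵍ Y.Link y₀) ⁺ ⊎ᵍ (X.Avoid x₀ ×ᵍ Y.Avoid y₀))
  decompose = record { fun = λ σ → proj₁ (out σ) ; inj = λ σ σ' → reflect (proj₂ (out σ)) (proj₂ (out σ'))
                     ; deg≡ = λ σ → degree (proj₂ (out σ)) }
    where
    Tgt = (X.Link x₀ ×ᵍ Y.Link y₀) ⁺ ⊎ᵍ (X.Avoid x₀ ×ᵍ Y.Avoid y₀)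
    data Out : El W.Cl → El Tgt → Set where
      through : ∀ {τ c} (S : W.Extract v τ) (T : Parts (W.Extract.rest S)) {p q} → Out (τ , c) (inj₁ ((Parts.xs T , p) , (Parts.ys T , q)))
      apart   : ∀ {τ c} (T : Parts τ) {p q} → Out (τ , c) (inj₂ ((Parts.xs T , p) , (Parts.ys T , q)))
    out : ∀ σ → Σ _ (Out σ)
    out (τ , c) with v W.∈? τ
    ... | no n = inj₂ ((T.xs , T.cxs , λ m → n (T.x→ x₀ m)) , (T.ys , T.cys , λ m → n (W.∈-resp (W.≈-sym glue) (T.y→ y₀ m)))) , apart T'
      where
      T' = parts τ c n
      module T = Parts T'
    ... | yes m = inj₁ ((Th.T.xs , Th.T.cxs , Th.x-adj) , (Th.T.ys , Th.T.cys , Th.y-adj)) , through S T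
      where
      S = W.extract c m
      T = parts (W.Extract.rest S) (W.Extract.clique S) (W.link-∉ (W.Extract.link S))
      module Th = Through τ S T
    reflect : ∀ {σ σ' u u'} → Out σ u → Out σ' u' → _≋_ Tgt u u' → _≋_ W.Cl σ σ'
    reflect (through S T) (through S' T') (inl ((a , a') , (b , b'))) = extract-⊆ S S' (parts-⊆ T T' a b) , extract-⊆ S' S (parts-⊆ T' T a' b')
    reflect (apart T) (apart T') (inr ((a , a') , (b , b'))) = parts-⊆ T T' a b , parts-⊆ T' T a' b'
    degree : ∀ {σ u} → Out σ u → deg Tgt u ≡ deg W.Cl σ
    degree (through S T) = sym (trans (W.Extract.len S) (cong suc (Parts.len T)))
    degree (apart T) = sym (Parts.len T)

  -- When the clique passes through the gluing vertex, `y₀` is put back on the `Y` side. The second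
  -- component then tells the two cases apart, so `f` and `g` may overlap in `Z`, and one bound can
  -- serve both the link and the avoiding part of `X`.
  decompose-link : ∀ {Z Z'} y₁ → X.Link x₀ ↪ Z → X.Avoid x₀ ↪ Z → Y.Link y₁ ↪ Z' → W.Link (ιY y₁) ↪ (Z ×ᵍ Z')
  decompose-link {Z} {Z'} y₁ f g h = record
    { fun = λ σ → proj₁ (out σ) ; inj = λ σ σ' → reflect (proj₂ (out σ)) (proj₂ (out σ')) ; deg≡ = λ σ → degree (proj₂ (out σ)) }
    where
    data Out : El (W.Link (ιY y₁)) → El (Z ×ᵍ Z') → Set where
      through : ∀ {τ c} (S : W.Extract v τ) (T : Parts (W.Extract.rest S)) p q →
                Out (τ , c) (fun f (Parts.xs T , p) , fun h (y₀ ∷ Parts.ys T , q))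
      apart   : ∀ {τ c} (T : Parts τ) p q → ¬ (y₀ Y.∈ Parts.ys T) → Out (τ , c) (fun g (Parts.xs T , p) , fun h (Parts.ys T , q))
    out : ∀ σ → Σ _ (Out σ)
    out (τ , c , adj) with v W.∈? τ
    ... | no n = _ , apart T' (T.cxs , λ m → n (T.x→ x₀ m)) (T.cys , λ y m → ιY-E (adj (ιY y) (T.y→ y m)))
                           (λ m → n (W.∈-resp (W.≈-sym glue) (T.y→ y₀ m)))
      where
      T' = parts τ c n
      module T = Parts T'
    ... | yes m = _ , through S T (Th.T.cxs , Th.x-adj) ((Th.y-adj Y.∷ Th.T.cys) , adj')
      where
      S = W.extract c m
      T = parts (W.Extract.rest S) (W.Extract.clique S) (W.link-∉ (W.Extract.link S))
      module Th = Through τ S T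
      adj' : Y.Adj y₁ (y₀ ∷ Th.T.ys)
      adj' y (here e) = ιY-E (adj (ιY y) (W.∈-resp (W.≈-trans glue (ιY-cong (Y.≈-sym e))) m))
      adj' y (there k) = ιY-E (adj (ιY y) (Th.S.rest⊆ (ιY y) (Th.T.y→ y k)))
    reflect : ∀ {σ σ' u u'} → Out σ u → Out σ' u' → _≋_ (Z ×ᵍ Z') u u' → _≋_ (W.Link (ιY y₁)) σ σ'
    reflect (through S T p q) (through S' T' p' q') (a , b) with inj f _ _ a | inj h _ _ b
    ... | a1 , a2 | bs with Y.∷-injective (Y.link-∉ (Through.y-adj _ S T)) (Y.link-∉ (Through.y-adj _ S' T')) bs
    ...   | b1 , b2 = extract-⊆ S S' (parts-⊆ T T' a1 b1) , extract-⊆ S' S (parts-⊆ T' T a2 b2)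
    reflect (apart T p q n) (apart T' p' q' n') (a , b) with inj g _ _ a | inj h _ _ b
    ... | a1 , a2 | b1 , b2 = parts-⊆ T T' a1 b1 , parts-⊆ T' T a2 b2
    reflect (through S T p q) (apart T' p' q' n') (a , b) = ⊥-elim (n' (proj₁ (inj h _ _ b) y₀ (here Y.≈-refl)))
    reflect (apart T p q n) (through S T' p' q') (a , b) = ⊥-elim (n (proj₂ (inj h _ _ b) y₀ (here Y.≈-refl)))
    degree : ∀ {σ u} → Out σ u → deg (Z ×ᵍ Z') u ≡ deg (W.Link (ιY y₁)) σ
    degree (through S T p q) = trans (cong₂ _+_ (deg≡ f _) (deg≡ h _))
      (trans (+-suc (length (Parts.xs T)) (length (Parts.ys T))) (sym (trans (W.Extract.len S) (cong suc (Parts.len T)))))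
    degree (apart T p q _) = trans (cong₂ _+_ (deg≡ g _) (deg≡ h _)) (sym (Parts.len T))

*-zero-cancelˡ : ∀ {c x} → c ≢ 0ℚ → c *ℚ x ≡ 0ℚ → x ≡ 0ℚ
*-zero-cancelˡ {c} {x} n e = trans (sym (ℚ.*-identityˡ x)) (trans (cong (_*ℚ x) (sym (ℚ.*-inverseˡ c)))
  (trans (ℚ.*-assoc (1/ c) c x) (trans (cong ((1/ c) *ℚ_) e) (ℚ.*-zeroʳ (1/ c)))))
  where instance _ = ≢-nonZero n

neg≢0 : ∀ {k} → k ≢ 0ℚ → - k ≢ 0ℚ
neg≢0 {k} n e = n (ℚ.neg-injective {k} {0ℚ} e)

-k*x≤0 : ∀ {k x} → k ≤ℚ 0ℚ → x ≤ℚ 0ℚ → (- k) *ℚ x ≤ℚ 0ℚ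
-k*x≤0 {k} {x} k≤0 x≤0 = ℚ.≤-trans (ℚ.*-monoˡ-≤-nonNeg (- k) {{nonNegative (ℚ.neg-antimono-≤ k≤0)}} x≤0) (ℚ.≤-reflexive (ℚ.*-zeroʳ (- k)))

-- Ordinal sums

module OrdinalSum (A B : FinPoset) where
  private
    P = A ⊕ B
    module EA = Elements A
    module EB = Elements B
    module GA = Cliques (AG A)
    module GB = Cliques (AG B)
    module GP = Cliques (AG P)
    module OP = Cliques (OG P)
  open Simp

  filterA : Filter A → Filter P
  filterA (F , f) = [ F , (λ _ → true) ]′ , λ { _ _ (l le) e → f _ _ le e ; _ _ (r _) _ → refl ; _ _ lr _ → refl }

  filterB : Filter B → Filter P
  filterB (G , g) = [ (λ _ → false) , G ]′ , λ { _ _ (r le) e → g _ _ le e }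

  restrictA : Filter P → Filter A
  restrictA (H , h) = (λ a → H (inj₁ a)) , λ a a' le → h (inj₁ a) (inj₁ a') (l le)

  restrictB : Filter P → Filter B
  restrictB (H , h) = (λ b → H (inj₂ b)) , λ b b' le → h (inj₂ b) (inj₂ b') (r le)

  filter-cover : ∀ (H : Filter P) → (Σ (Filter A) λ F → H OP.≈ filterA F) ⊎ (Σ (Filter B) λ G → H OP.≈ filterB G)
  filter-cover H with EA.anyC? (λ a → proj₁ H (inj₁ a) ≟B true)
  ... | yes (a , e) = inj₁ (restrictA H , λ { (inj₁ _) → refl ; (inj₂ b) → proj₂ H (inj₁ a) (inj₂ b) lr e })
  ... | no none = inj₂ (restrictB H , λ { (inj₁ a) → ¬true⇒false (λ e → none (a , e)) ; (inj₂ _) → refl })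

  filterA-E : ∀ {F F' : Filter A} → Edge P (filterA F) (filterA F') → Edge A F F'
  filterA-E (n , h) = (λ e → n (λ { (inj₁ a) → e a ; (inj₂ _) → refl })) ,
    λ H K s → Data.Sum.map (λ { (x , y) → (λ a → x (inj₁ a)) , (λ a → y (inj₁ a)) }) (λ { (x , y) → (λ a → x (inj₁ a)) , (λ a → y (inj₁ a)) })
      (h (filterA H) (filterA K) (λ { (inj₁ a) → s a ; (inj₂ _) → inj₁ (refl , refl) }))

  filterB-E : ∀ {F F' : Filter B} → Edge P (filterB F) (filterB F') → Edge B F F'
  filterB-E (n , h) = (λ e → n (λ { (inj₂ a) → e a ; (inj₁ _) → refl })) ,
    λ H K s → Data.Sum.map (λ { (x , y) → (λ a → x (inj₂ a)) , (λ a → y (inj₂ a)) }) (λ { (x , y) → (λ a → x (inj₂ a)) , (λ a → y (inj₂ a)) })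
      (h (filterB H) (filterB K) (λ { (inj₂ a) → s a ; (inj₁ _) → inj₁ (refl , refl) }))

  glue : filterA (base A false) OP.≈ filterB (base B true)
  glue = λ { (inj₁ _) → refl ; (inj₂ _) → refl }

  separate : ∀ {F G} → filterA F OP.≈ filterB G → _≗ᵛ_ A (proj₁ F) (λ _ → false) × _≗ᵛ_ B (proj₁ G) (λ _ → true)
  separate e = (λ a → e (inj₁ a)) , (λ b → sym (e (inj₂ b)))

  filterA-cong : ∀ {F F' : Filter A} → _≗ᵛ_ A (proj₁ F) (proj₁ F') → filterA F OP.≈ filterA F'
  filterA-cong e (inj₁ a) = e a
  filterA-cong e (inj₂ _) = refl

  filterB-cong : ∀ {G G' : Filter B} → _≗ᵛ_ B (proj₁ G) (proj₁ G') → filterB G OP.≈ filterB G'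
  filterB-cong e (inj₁ _) = refl
  filterB-cong e (inj₂ b) = e b

  -- The wedge is formed in both orders because `decompose-link` treats vertices of the second
  -- graph: the empty filter of the sum comes from `B`, the full one from `A`.
  module AB = Wedge (OG A) (OG B) (OG P) filterA filterB (λ {F} {F'} → filterA-cong {F} {F'}) (λ {F} {F'} → filterB-cong {F} {F'})
    (λ e a → e (inj₁ a)) (λ e b → e (inj₂ b)) (base A false) (base B true) glue (λ {F} {G} → separate {F} {G}) filter-cover
    (λ {F} {F'} → filterA-E {F} {F'}) (λ {F} {F'} → filterB-E {F} {F'})
  module BA = Wedge (OG B) (OG A) (OG P) filterB filterA (λ {F} {F'} → filterB-cong {F} {F'}) (λ {F} {F'} → filterA-cong {F} {F'})
    (λ e b → e (inj₂ b)) (λ e a → e (inj₁ a)) (base B true) (base A false)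
    (OP.≈-sym {filterA (base A false)} {filterB (base B true)} glue)
    (λ {G} {F} e → swap (separate {F} {G} (OP.≈-sym {filterB G} {filterA F} e))) (λ H → Data.Sum.swap (filter-cover H))
    (λ {F} {F'} → filterB-E {F} {F'}) (λ {F} {F'} → filterA-E {F} {F'})

  antiA : Anti A → Anti P
  antiA (Z , z) = [ Z , (λ _ → false) ]′ , λ { _ _ e e' (l le) → cong inj₁ (z _ _ e e' le) }

  antiB : Anti B → Anti P
  antiB (Z , z) = [ (λ _ → false) , Z ]′ , λ { _ _ e e' (r le) → cong inj₂ (z _ _ e e' le) }

  anti-cover : ∀ (Z : Anti P) → (Σ (Anti A) λ F → Z GP.≈ antiA F) ⊎ (Σ (Anti B) λ G → Z GP.≈ antiB G)
  anti-cover (Z , z) with EA.anyC? (λ a → Z (inj₁ a) ≟B true)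
  ... | yes (a , e) = inj₁ (((λ a → Z (inj₁ a)) , λ a a' x y le → inj₁-injective (z _ _ x y (l le))) ,
                            λ { (inj₁ _) → refl ; (inj₂ b) → ¬true⇒false (λ x → absurd b x) })
    where
    absurd : ∀ b → Z (inj₂ b) ≡ true → ⊥
    absurd b x with () ← z (inj₁ a) (inj₂ b) e x lr
  ... | no none = inj₂ (((λ b → Z (inj₂ b)) , λ b b' x y le → inj₂-injective (z _ _ x y (r le))) ,
                        λ { (inj₁ a) → ¬true⇒false (λ e → none (a , e)) ; (inj₂ _) → refl })

  antiA-cong : ∀ {Z Z' : Anti A} → _≗ᵛ_ A (proj₁ Z) (proj₁ Z') → antiA Z GP.≈ antiA Z'
  antiA-cong e (inj₁ a) = e a
  antiA-cong e (inj₂ _) = refl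

  antiB-cong : ∀ {Z Z' : Anti B} → _≗ᵛ_ B (proj₁ Z) (proj₁ Z') → antiB Z GP.≈ antiB Z'
  antiB-cong e (inj₁ _) = refl
  antiB-cong e (inj₂ b) = e b

  module TA = Transport (AG P) (AG A) antiA (λ {Z} {Z'} → antiA-cong {Z} {Z'}) (λ e a → e (inj₁ a))
  module TB = Transport (AG P) (AG B) antiB (λ {Z} {Z'} → antiB-cong {Z} {Z'}) (λ e b → e (inj₂ b))

  module Join (σ : Simp A) (∅∉σ : ¬ (∅ A GA.∈ pts σ)) (τ : Simp B) (∅∉τ : ¬ (∅ B GB.∈ pts τ)) where
    σs = map antiA (pts σ)
    τs = map antiB (pts τ)

    k₁ k₂ : ℚ
    k₁ = ⟦ face σ ⟧ᵇ (λ _ → false)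
    k₂ = ⟦ face τ ⟧ᵇ (λ _ → false)
    k₁≢0 : k₁ ≢ 0ℚ
    k₁≢0 e = ∅∉σ (face→ σ (∅ A) e)
    k₂≢0 : k₂ ≢ 0ℚ
    k₂≢0 e = ∅∉τ (face→ τ (∅ B) e)

    -- On an antichain of `A` the second function takes its value `k₂` at the origin, so the
    -- constant cancels and `- k₂` times `face σ` remains; symmetrically on `B`. Both `k₁` and `k₂`
    -- are negative, as neither face contains the origin, so signs and zero sets are kept.
    face' : Aff (Carrier P)
    face' = ((- k₂) ⊠ sub (λ a → var (inj₁ a)) (face σ) ⊞ (- k₁) ⊠ sub (λ b → var (inj₂ b)) (face τ)) ⊞ con (k₁ *ℚ k₂)

    evalA : ∀ (e : Aff (Carrier A)) (Z : Vtx P) {F : Vtx A} → (∀ a → Z (inj₁ a) ≡ F a) → ⟦ sub (λ a → var (inj₁ a)) e ⟧ᵇ Z ≡ ⟦ e ⟧ᵇ F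
    evalA e Z h = trans (⟦sub⟧ _ e _) (⟦⟧ᵇ-cong e h)
    evalB : ∀ (e : Aff (Carrier B)) (Z : Vtx P) {G : Vtx B} → (∀ b → Z (inj₂ b) ≡ G b) → ⟦ sub (λ b → var (inj₂ b)) e ⟧ᵇ Z ≡ ⟦ e ⟧ᵇ G
    evalB e Z h = trans (⟦sub⟧ _ e _) (⟦⟧ᵇ-cong e h)

    face-A : ∀ (Z : Anti P) F → Z GP.≈ antiA F → ⟦ face' ⟧ᵇ (proj₁ Z) ≡ (- k₂) *ℚ ⟦ face σ ⟧ᵇ (proj₁ F)
    face-A Z F e = trans (cong₂ (λ x y → ((- k₂) *ℚ x +ℚ (- k₁) *ℚ y) +ℚ k₁ *ℚ k₂) (evalA (face σ) (proj₁ Z) (λ a → e (inj₁ a))) (evalB (face τ) (proj₁ Z) (λ b → e (inj₂ b))))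
      (solve 3 (λ x k₁ k₂ → (((:- k₂) :* x :+ (:- k₁) :* k₂) :+ k₁ :* k₂) := ((:- k₂) :* x)) refl (⟦ face σ ⟧ᵇ (proj₁ F)) k₁ k₂)
    face-B : ∀ (Z : Anti P) G → Z GP.≈ antiB G → ⟦ face' ⟧ᵇ (proj₁ Z) ≡ (- k₁) *ℚ ⟦ face τ ⟧ᵇ (proj₁ G)
    face-B Z G e = trans (cong₂ (λ x y → ((- k₂) *ℚ x +ℚ (- k₁) *ℚ y) +ℚ k₁ *ℚ k₂) (evalA (face σ) (proj₁ Z) (λ a → e (inj₁ a))) (evalB (face τ) (proj₁ Z) (λ b → e (inj₂ b))))
      (solve 3 (λ x k₁ k₂ → (((:- k₂) :* k₁ :+ (:- k₁) :* x) :+ k₁ :* k₂) := ((:- k₁) :* x)) refl (⟦ face τ ⟧ᵇ (proj₁ G)) k₁ k₂)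

    memA : ∀ (F : Anti A) → F GA.∈ pts σ → antiA F GP.∈ (σs ++ τs)
    memA F m = ++⁺ˡ (TA.map-∈ {F} m)
    memB : ∀ (G : Anti B) → G GB.∈ pts τ → antiB G GP.∈ (σs ++ τs)
    memB G m = ++⁺ʳ σs (TB.map-∈ {G} m)

    mem⁻ : ∀ (Z : Anti P) → Z GP.∈ (σs ++ τs) → (Σ (Anti A) λ F → F GA.∈ pts σ × Z GP.≈ antiA F) ⊎ (Σ (Anti B) λ G → G GB.∈ pts τ × Z GP.≈ antiB G)
    mem⁻ Z m = Data.Sum.map (TA.map-∈⁻ {Z} (pts σ)) (TB.map-∈⁻ {Z} (pts τ)) (++⁻ σs m)

    disjoint : ∀ (F : Anti A) (G : Anti B) → F GA.∈ pts σ → ¬ (antiA F GP.≈ antiB G)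
    disjoint F G m e = ∅∉σ (GA.∈-resp {F} {∅ A} (λ a → e (inj₁ a)) m)

    face≤' : ∀ Z → ⟦ face' ⟧ᵇ (proj₁ Z) ≤ℚ 0ℚ
    face≤' Z with anti-cover Z
    ... | inj₁ (F , e) = subst (_≤ℚ 0ℚ) (sym (face-A Z F e)) (-k*x≤0 (face≤ τ (∅ B)) (face≤ σ F))
    ... | inj₂ (G , e) = subst (_≤ℚ 0ℚ) (sym (face-B Z G e)) (-k*x≤0 (face≤ σ (∅ A)) (face≤ τ G))

    face→' : ∀ Z → ⟦ face' ⟧ᵇ (proj₁ Z) ≡ 0ℚ → Z GP.∈ (σs ++ τs)
    face→' Z x with anti-cover Z
    ... | inj₁ (F , e) = GP.∈-resp {antiA F} {Z} (GP.≈-sym {Z} {antiA F} e)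
            (memA F (face→ σ F (*-zero-cancelˡ (neg≢0 k₂≢0) (trans (sym (face-A Z F e)) x))))
    ... | inj₂ (G , e) = GP.∈-resp {antiB G} {Z} (GP.≈-sym {Z} {antiB G} e)
            (memB G (face→ τ G (*-zero-cancelˡ (neg≢0 k₁≢0) (trans (sym (face-B Z G e)) x))))

    face←' : ∀ Z → Z GP.∈ (σs ++ τs) → ⟦ face' ⟧ᵇ (proj₁ Z) ≡ 0ℚ
    face←' Z m with mem⁻ Z m
    ... | inj₁ (F , F∈ , e) = trans (face-A Z F e) (trans (cong ((- k₂) *ℚ_) (face← σ F F∈)) (ℚ.*-zeroʳ (- k₂)))
    ... | inj₂ (G , G∈ , e) = trans (face-B Z G e) (trans (cong ((- k₁) *ℚ_) (face← τ G G∈)) (ℚ.*-zeroʳ (- k₁)))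

    -- A dual function u of σ is corrected by a multiple of face σ so that it vanishes at ∅, hence on τ.
    vanish-correct : ∀ k u → (- k) *ℚ u +ℚ u *ℚ k ≡ 0ℚ
    vanish-correct = solve 2 (λ k u → ((:- k) :* u :+ u :* k) := con 0ℚ) refl
      where open +-*-Solver using (con)
    correct : ∀ k u u₀ {f} → f ≡ 0ℚ → (- k) *ℚ u +ℚ u₀ *ℚ f ≡ (- k) *ℚ u
    correct k u u₀ refl = trans (cong ((- k) *ℚ u +ℚ_) (ℚ.*-zeroʳ u₀)) (ℚ.+-identityʳ _)

    dual' : ∀ Z → Z GP.∈ (σs ++ τs) → Σ (Aff (Carrier P)) λ u →
            ⟦ u ⟧ᵇ (proj₁ Z) ≢ 0ℚ × (∀ Z' → Z' GP.∈ (σs ++ τs) → ¬ (Z' GP.≈ Z) → ⟦ u ⟧ᵇ (proj₁ Z') ≡ 0ℚ)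
    dual' Z m with mem⁻ Z m
    ... | inj₁ (F , F∈ , e) with dual σ F F∈
    ...   | u , u≢0 , u0 = u' , (λ x → u≢0 (*-zero-cancelˡ (neg≢0 k₁≢0) (trans (sym (at Z F F∈ e)) x))) , others
      where
      u₀ = ⟦ u ⟧ᵇ (λ _ → false)
      u' = (- k₁) ⊠ sub (λ a → var (inj₁ a)) u ⊞ u₀ ⊠ sub (λ a → var (inj₁ a)) (face σ)
      at : ∀ (Z : Anti P) F → F GA.∈ pts σ → Z GP.≈ antiA F → ⟦ u' ⟧ᵇ (proj₁ Z) ≡ (- k₁) *ℚ ⟦ u ⟧ᵇ (proj₁ F)
      at Z F m e = trans (cong₂ (λ x y → (- k₁) *ℚ x +ℚ u₀ *ℚ y) (evalA u (proj₁ Z) (λ a → e (inj₁ a))) (evalA (face σ) (proj₁ Z) (λ a → e (inj₁ a)))) (correct k₁ (⟦ u ⟧ᵇ (proj₁ F)) u₀ (face← σ F m))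
      others : ∀ Z' → Z' GP.∈ (σs ++ τs) → ¬ (Z' GP.≈ Z) → ⟦ u' ⟧ᵇ (proj₁ Z') ≡ 0ℚ
      others Z' m' n with mem⁻ Z' m'
      ... | inj₁ (F' , F'∈ , e') = trans (at Z' F' F'∈ e') (trans (cong ((- k₁) *ℚ_) (u0 F' F'∈
              (λ x → n (λ { (inj₁ a) → trans (e' (inj₁ a)) (trans (x a) (sym (e (inj₁ a)))) ; (inj₂ b) → trans (e' (inj₂ b)) (sym (e (inj₂ b))) })))) (ℚ.*-zeroʳ (- k₁)))
      ... | inj₂ (G , _ , e') = trans (cong₂ (λ x y → (- k₁) *ℚ x +ℚ u₀ *ℚ y) (evalA u (proj₁ Z') (λ a → e' (inj₁ a))) (evalA (face σ) (proj₁ Z') (λ a → e' (inj₁ a)))) (vanish-correct k₁ u₀)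
    dual' Z m | inj₂ (F , F∈ , e) with dual τ F F∈
    ...   | u , u≢0 , u0 = u' , (λ x → u≢0 (*-zero-cancelˡ (neg≢0 k₂≢0) (trans (sym (at Z F F∈ e)) x))) , others
      where
      u₀ = ⟦ u ⟧ᵇ (λ _ → false)
      u' = (- k₂) ⊠ sub (λ a → var (inj₂ a)) u ⊞ u₀ ⊠ sub (λ a → var (inj₂ a)) (face τ)
      at : ∀ (Z : Anti P) F → F GB.∈ pts τ → Z GP.≈ antiB F → ⟦ u' ⟧ᵇ (proj₁ Z) ≡ (- k₂) *ℚ ⟦ u ⟧ᵇ (proj₁ F)
      at Z F m e = trans (cong₂ (λ x y → (- k₂) *ℚ x +ℚ u₀ *ℚ y) (evalB u (proj₁ Z) (λ a → e (inj₂ a))) (evalB (face τ) (proj₁ Z) (λ a → e (inj₂ a)))) (correct k₂ (⟦ u ⟧ᵇ (proj₁ F)) u₀ (face← τ F m))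
      others : ∀ Z' → Z' GP.∈ (σs ++ τs) → ¬ (Z' GP.≈ Z) → ⟦ u' ⟧ᵇ (proj₁ Z') ≡ 0ℚ
      others Z' m' n with mem⁻ Z' m'
      ... | inj₂ (F' , F'∈ , e') = trans (at Z' F' F'∈ e') (trans (cong ((- k₂) *ℚ_) (u0 F' F'∈
              (λ x → n (λ { (inj₂ a) → trans (e' (inj₂ a)) (trans (x a) (sym (e (inj₂ a)))) ; (inj₁ b) → trans (e' (inj₁ b)) (sym (e (inj₁ b))) })))) (ℚ.*-zeroʳ (- k₂)))
      ... | inj₁ (G , _ , e') = trans (cong₂ (λ x y → (- k₂) *ℚ x +ℚ u₀ *ℚ y) (evalB u (proj₁ Z') (λ a → e' (inj₂ a))) (evalB (face τ) (proj₁ Z') (λ a → e' (inj₂ a)))) (vanish-correct k₂ u₀)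

    uniq' : GP.IsClique (σs ++ τs)
    uniq' = GP.clique-++ (TA.map-clique (λ F F' _ _ n e → n (λ a → e (inj₁ a))) (uniq σ))
                         (TB.map-clique (λ G G' _ _ n e → n (λ b → e (inj₂ b))) (uniq τ)) apart
      where
      apart : ∀ Z Z' → Z GP.∈ σs → Z' GP.∈ τs → ¬ (Z GP.≈ Z')
      apart Z Z' m m' x with TA.map-∈⁻ {Z} (pts σ) m | TB.map-∈⁻ {Z'} (pts τ) m'
      ... | F , F∈ , e | G , _ , e' = disjoint F G F∈ (λ p → trans (sym (e p)) (trans (x p) (e' p)))

    simp : Simp P
    simp = record { pts = σs ++ τs ; uniq = uniq' ; face = face' ; face≤ = face≤' ; face→ = face→' ; face← = face←' ; dual = dual' }

    ∅∉ : ¬ (∅ P GP.∈ (σs ++ τs))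
    ∅∉ m with mem⁻ (∅ P) m
    ... | inj₁ (F , F∈ , e) = ∅∉σ (GA.∈-resp {F} {∅ A} (λ a → sym (e (inj₁ a))) F∈)
    ... | inj₂ (G , G∈ , e) = ∅∉τ (GB.∈-resp {G} {∅ B} (λ b → sym (e (inj₂ b))) G∈)

  -- The vertices split back into those of `A` and those of `B`, since the empty antichain is the
  -- only one common to both and it is absent.
  joinSimps : (Simps∌∅ A ×ᵍ Simps∌∅ B) ↪ Simps∌∅ P
  fun joinSimps ((σ , n) , (τ , m)) = Join.simp σ n τ m , Join.∅∉ σ n τ m
  inj joinSimps ((σ , n) , (τ , m)) ((σ' , n') , (τ' , m')) (s , s') =
    (halfA σ n τ m σ' n' τ' m' s , halfA σ' n' τ' m' σ n τ m s') , (halfB σ n τ m σ' n' τ' m' s , halfB σ' n' τ' m' σ n τ m s')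
    where
    halfA : ∀ σ n τ m σ' n' τ' m' → pts (Join.simp σ n τ m) GP.⊆ pts (Join.simp σ' n' τ' m') → pts σ GA.⊆ pts σ'
    halfA σ n τ m σ' n' τ' m' s F F∈ with Join.mem⁻ σ' n' τ' m' (antiA F) (s (antiA F) (Join.memA σ n τ m F F∈))
    ... | inj₁ (F' , F'∈ , e) = GA.∈-resp {F'} {F} (λ a → sym (e (inj₁ a))) F'∈
    ... | inj₂ (G , _ , e) = ⊥-elim (Join.disjoint σ n τ m F G F∈ e)
    halfB : ∀ σ n τ m σ' n' τ' m' → pts (Join.simp σ n τ m) GP.⊆ pts (Join.simp σ' n' τ' m') → pts τ GB.⊆ pts τ'
    halfB σ n τ m σ' n' τ' m' s G G∈ with Join.mem⁻ σ' n' τ' m' (antiB G) (s (antiB G) (Join.memB σ n τ m G G∈))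
    ... | inj₂ (G' , G'∈ , e) = GB.∈-resp {G'} {G} (λ b → sym (e (inj₂ b))) G'∈
    ... | inj₁ (F , F∈ , e) = ⊥-elim (Join.disjoint σ' n' τ' m' F G F∈ (λ p → sym (e p)))
  deg≡ joinSimps ((σ , n) , (τ , m)) = trans (length-++ (map antiA (pts σ))) (cong₂ _+_ (length-map antiA (pts σ)) (length-map antiB (pts τ)))

  module KA = Cliques (CG A)
  module KB = Cliques (CG B)
  module KP = Cliques (CG P)
  module CA = Transport (CG P) (CG A) inj₁ (cong inj₁) inj₁-injective
  module CB = Transport (CG P) (CG B) inj₂ (cong inj₂) inj₂-injective

  joinChains : (Chains A ×ᵍ Chains B) ↪ Chains P
  fun joinChains ((as , c) , (bs , d)) = map inj₁ as ++ map inj₂ bs ,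
    KP.clique-++ (CA.map-clique (λ _ _ _ _ → λ { (n , le) → (λ e → n (inj₁-injective e)) , Data.Sum.map l l le }) c)
                 (CB.map-clique (λ _ _ _ _ → λ { (n , le) → (λ e → n (inj₂-injective e)) , Data.Sum.map r r le }) d) across
    where
    across : ∀ p q → p KP.∈ map inj₁ as → q KP.∈ map inj₂ bs → KP.E p q
    across p q m m' with CA.map-∈⁻ as m | CB.map-∈⁻ bs m'
    ... | a , _ , refl | b , _ , refl = (λ ()) , inj₁ lr
  inj joinChains ((as , _) , (bs , _)) ((as' , _) , (bs' , _)) (s , s') =
    (halfA as bs as' bs' s , halfA as' bs' as bs s') , (halfB as bs as' bs' s , halfB as' bs' as bs s')
    where
    halfA : ∀ as bs as' bs' → (map inj₁ as ++ map inj₂ bs) KP.⊆ (map inj₁ as' ++ map inj₂ bs') → as KA.⊆ as'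
    halfA as bs as' bs' s a m with ++⁻ (map inj₁ as') (s (inj₁ a) (++⁺ˡ (CA.map-∈ m)))
    ... | inj₁ x = CA.map-∈⁻¹ as' x
    ... | inj₂ x with () ← proj₂ (proj₂ (CB.map-∈⁻ bs' x))
    halfB : ∀ as bs as' bs' → (map inj₁ as ++ map inj₂ bs) KP.⊆ (map inj₁ as' ++ map inj₂ bs') → bs KB.⊆ bs'
    halfB as bs as' bs' s b m with ++⁻ (map inj₁ as') (s (inj₂ b) (++⁺ʳ (map inj₁ as) (CB.map-∈ m)))
    ... | inj₂ x = CB.map-∈⁻¹ bs' x
    ... | inj₁ x with () ← proj₂ (proj₂ (CA.map-∈⁻ as' x))
  deg≡ joinChains ((as , _) , (bs , _)) = trans (length-++ (map inj₁ as)) (cong₂ _+_ (length-map inj₁ as) (length-map inj₂ bs))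

  module _ (dec : DecOrder P) where
    decA : DecOrder A
    decA a a' = map′ (λ { (l le) → le }) l (dec (inj₁ a) (inj₁ a'))
    decB : DecOrder B
    decB b b' = map′ (λ { (r le) → le }) r (dec (inj₂ b) (inj₂ b'))

    private
      module RA = Redistribution A decA false
      module RB = Redistribution B decB true
      module KS = ChainSimplices P dec

    LA = RA.O.Link (base A false)
    LB = RB.O.Link (base B true)
    ZA = RA.O.Avoid (base A false)
    ZB = RB.O.Avoid (base B true)

    -- Let `c`, `d`, `b` count chains, surplus and avoiding cliques on the order side, put
    -- `a = c + d`, and let `t` mark degree. Then `t a_A a_B + b_A b_B = t c_A c_B + a_A (t d_B) + t
    -- d_A c_B + b_A b_B`, and `c_B ≤ b_B` bounds the last two terms by `(b_A + t d_A) b_B`.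
    Sorted : Graded
    Sorted = (Chains A ×ᵍ Chains B) ⁺ ⊎ᵍ ((LA ×ᵍ (RB.NonPrincipal ⁺)) ⊎ᵍ ((ZA ⊎ᵍ (RA.NonPrincipal ⁺)) ×ᵍ ZB))

    classify : ((LA ×ᵍ LB) ⁺ ⊎ᵍ (ZA ×ᵍ ZB)) ↪ Sorted
    classify = record { fun = λ z → proj₁ (out z) ; inj = λ z z' → reflect (proj₂ (out z)) (proj₂ (out z')) ; deg≡ = λ z → degree (proj₂ (out z)) }
      where
      Src = (LA ×ᵍ LB) ⁺ ⊎ᵍ (ZA ×ᵍ ZB)
      data Out : El Src → El Sorted → Set where
        chains   : ∀ {a b} (S : RA.T.Preimage (proj₁ a)) (T : RB.T.Preimage (proj₁ b)) {c d} →
                   Out (inj₁ (a , b)) (inj₁ ((RA.T.Preimage.elts S , c) , (RB.T.Preimage.elts T , d)))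
        second   : ∀ {a b n} → Out (inj₁ (a , b)) (inj₂ (inj₁ (a , (b , n))))
        first    : ∀ {a b n m} → Out (inj₁ (a , b)) (inj₂ (inj₂ (inj₂ (a , n) , (proj₁ b , m))))
        avoiding : ∀ {a b} → Out (inj₂ (a , b)) (inj₂ (inj₂ (inj₁ a , b)))
      out : ∀ z → Σ _ (Out z)
      out (inj₂ (a , b)) = _ , avoiding
      out (inj₁ (a@(xs , c , adj) , b@(ys , d , adj'))) with RB.T.inImage? RB.principal? ys | RA.T.inImage? RA.principal? xs
      ... | no n | _ = _ , second {n = n}
      -- A clique in the link of a vertex avoids that vertex, which gives `c_B ≤ b_B`.
      ... | yes f | no n = _ , first {n = n} {m = d , RB.O.link-∉ {base B true} adj'}
      ... | yes f | yes g = _ , chains S T {RA.T.Preimage.clique S c (λ p q _ _ → Principal.principal-edge⁻ A decA false p q)} {RB.T.Preimage.clique T d (λ p q _ _ → Principal.principal-edge⁻ B decB true p q)}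
        where
        S = RA.T.preimage xs g
        T = RB.T.preimage ys f
      reflect : ∀ {z z' u u'} → Out z u → Out z' u' → _≋_ Sorted u u' → _≋_ Src z z'
      reflect (chains S T) (chains S' T') (inl ((a , a') , (b , b'))) =
        inl ((RA.T.preimage-⊆ S S' a , RA.T.preimage-⊆ S' S a') , (RB.T.preimage-⊆ T T' b , RB.T.preimage-⊆ T' T b'))
      reflect second second (inr (inl e)) = inl e
      reflect first first (inr (inr (inr e , e'))) = inl (e , e')
      reflect avoiding avoiding (inr (inr (inl e , e'))) = inr (e , e')
      reflect second first (inr ())
      reflect second avoiding (inr ())
      reflect first second (inr ())
      reflect avoiding second (inr ())
      reflect first avoiding (inr (inr (() , _)))
      reflect avoiding first (inr (inr (() , _)))
      degree : ∀ {z u} → Out z u → deg Sorted u ≡ deg Src z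
      degree (chains S T) = cong suc (cong₂ _+_ (RA.T.Preimage.len S) (RB.T.Preimage.len T))
      degree (second {a}) = +-suc (length (proj₁ a)) _
      degree first = refl
      degree avoiding = refl

    module _ (HA : Bounds A) (HB : Bounds B)
             (φA : (ZA ⊎ᵍ (RA.NonPrincipal ⁺)) ↪ Simps∌∅ A) (φB : (ZB ⊎ᵍ (RB.NonPrincipal ⁺)) ↪ Simps∌∅ B) where

      -- With `b'` counting chain-side simplices off the origin, the first product uses `a_A ≤ b'_A`
      -- from `links`, the second `b_A + t d_A ≤ b'_A` from `φA`. In the other factor they occupy
      -- the disjoint images under `φB` of `t d_B` and `b_B`, so an overlap in the `A` factor is
      -- harmless.
      mixed : ((LA ×ᵍ (RB.NonPrincipal ⁺)) ⊎ᵍ ((ZA ⊎ᵍ (RA.NonPrincipal ⁺)) ×ᵍ ZB)) ↪ (Simps∌∅ A ×ᵍ Simps∌∅ B)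
      mixed = copair (Bounds.links HA false ×↪ (inj₂↪ ⨾ φB)) (φA ×↪ (inj₁↪ ⨾ φB)) clash clash'
        where
        clash : ∀ x y → ¬ _≋_ (Simps∌∅ A ×ᵍ Simps∌∅ B) (fun (Bounds.links HA false ×↪ (inj₂↪ ⨾ φB)) x) (fun (φA ×↪ (inj₁↪ ⨾ φB)) y)
        clash (_ , x) (_ , y) (_ , e) with () ← inj φB (inj₂ x) (inj₁ y) e
        clash' : ∀ x y → ¬ _≋_ (Simps∌∅ A ×ᵍ Simps∌∅ B) (fun (φA ×↪ (inj₁↪ ⨾ φB)) y) (fun (Bounds.links HA false ×↪ (inj₂↪ ⨾ φB)) x)
        clash' (_ , x) (_ , y) (_ , e) with () ← inj φB (inj₁ y) (inj₂ x) e

      chainsIn : (Chains A ×ᵍ Chains B) ⁺ ↪ Simps P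
      fun chainsIn z = KS.chainSimp (fun joinChains z)
      inj chainsIn z z' e = inj joinChains z z' (KS.chainSimp-inj (fun joinChains z) (fun joinChains z') e)
      deg≡ chainsIn z = cong suc (trans (length-map _ (proj₁ (fun joinChains z))) (deg≡ joinChains z))

      forget : Simps∌∅ P ↪ Simps P
      fun forget = proj₁
      inj forget _ _ e = e
      deg≡ forget _ = refl

      bounds : Bounds P
      Bounds.simplices bounds = AB.decompose ⨾ (classify ⨾ copair chainsIn ((mixed ⨾ joinSimps) ⨾ forget) clash clash')
        where
        clash : ∀ x y → ¬ _≋_ (Simps P) (fun chainsIn x) (fun ((mixed ⨾ joinSimps) ⨾ forget) y)
        clash x y (s , _) = proj₂ (fun (mixed ⨾ joinSimps) y) (s (∅ P) (here (λ _ → refl)))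
        clash' : ∀ x y → ¬ _≋_ (Simps P) (fun ((mixed ⨾ joinSimps) ⨾ forget) y) (fun chainsIn x)
        clash' x y (_ , s) = proj₂ (fun (mixed ⨾ joinSimps) y) (s (∅ P) (here (λ _ → refl)))
      Bounds.links bounds false = OP.Link-resp {base P false} {filterB (base B false)} same ⨾ (AB.decompose-link (base B false) (Bounds.links HA false) (inj₁↪ ⨾ φA) (Bounds.links HB false) ⨾ joinSimps)
        where
        same : base P false OP.≈ filterB (base B false)
        same = λ { (inj₁ _) → refl ; (inj₂ _) → refl }
      Bounds.links bounds true = OP.Link-resp {base P true} {filterA (base A true)} same ⨾ ((BA.decompose-link (base A true) (Bounds.links HB true) (inj₁↪ ⨾ φB) (Bounds.links HA true) ⨾ ×↪-swap {Simps∌∅ B} {Simps∌∅ A}) ⨾ joinSimps)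
        where
        same : base P true OP.≈ filterA (base A true)
        same = λ { (inj₁ _) → refl ; (inj₂ _) → refl }

    ordinalSum-bounds : Bounds A → Bounds B → ¬ ¬ Bounds P
    ordinalSum-bounds HA HB = ¬¬-bind (RA.redistribute (Bounds.simplices HA)) λ φA →
      ¬¬-bind (RB.redistribute (Bounds.simplices HB)) λ φB k → k (bounds HA HB φA φB)

-- Invariance under isomorphism

module Isomorphism {P Q : FinPoset} (φ : P ≅ Q) where
  open Inverse (_≅_.bij φ) using (to; from; strictlyInverseˡ; strictlyInverseʳ)
  private
    module OP = Cliques (OG P)
    module OQ = Cliques (OG Q)
    module AP = Cliques (AG P)
    module AQ = Cliques (AG Q)
  open Simp

  from-order : ∀ a b → _≼_ Q a b → _≼_ P (from a) (from b)
  from-order a b le = proj₂ (_≅_.order φ (from a) (from b)) (subst₂ (_≼_ Q) (sym (strictlyInverseˡ a)) (sym (strictlyInverseˡ b)) le)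

  pull : Filter Q → Filter P
  pull (F , f) = (λ p → F (to p)) , λ p q le → f (to p) (to q) (proj₁ (_≅_.order φ p q) le)

  push : Filter P → Filter Q
  push (F , f) = (λ q → F (from q)) , λ a b le → f (from a) (from b) (from-order a b le)

  pull-inj : ∀ {F G : Filter Q} → pull F OP.≈ pull G → F OQ.≈ G
  pull-inj {F , _} {G , _} e q = trans (cong F (sym (strictlyInverseˡ q))) (trans (e (from q)) (cong G (strictlyInverseˡ q)))

  pull-E : ∀ {F G : Filter Q} → Edge Q F G → Edge P (pull F) (pull G)
  pull-E {F} {G} (n , h) = (λ e → n (pull-inj {F} {G} e)) ,
    λ H K s → Data.Sum.map (λ { (x , y) → back {H} {F} x , back {K} {G} y }) (λ { (x , y) → back {H} {G} x , back {K} {F} y })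
      (h (push H) (push K) (λ q → subst₂ (λ a b → Swap a b (proj₁ H (from q)) (proj₁ K (from q)))
        (cong (proj₁ F) (strictlyInverseˡ q)) (cong (proj₁ G) (strictlyInverseˡ q)) (s (from q))))
    where
    back : ∀ {H : Filter P} {F : Filter Q} → push H OQ.≈ F → H OP.≈ pull F
    back {H , _} e p = trans (cong H (sym (strictlyInverseʳ p))) (e (to p))

  module TF = Transport (OG P) (OG Q) pull (λ e p → e (to p)) (λ {F} {G} → pull-inj {F} {G})

  pullCliques : OQ.Cl ↪ OP.Cl
  fun pullCliques (xs , c) = map pull xs , TF.map-clique (λ F G _ _ → pull-E {F} {G}) c
  inj pullCliques (xs , _) (ys , _) e = TF.map-~⁻ {xs} {ys} e
  deg≡ pullCliques (xs , _) = length-map pull xs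

  pullLinks : ∀ b → OQ.Link (base Q b) ↪ OP.Link (base P b)
  fun (pullLinks b) (xs , c , adj) = map pull xs , TF.map-clique (λ F G _ _ → pull-E {F} {G}) c , adj'
    where
    adj' : OP.Adj (base P b) (map pull xs)
    adj' F m with TF.map-∈⁻ {F} xs m
    ... | G , G∈ , e = OP.E-respʳ {pull G} {F} {base P b} (OP.≈-sym {F} {pull G} e) (pull-E {base Q b} {G} (adj G G∈))
  inj (pullLinks b) (xs , _) (ys , _) e = TF.map-~⁻ {xs} {ys} e
  deg≡ (pullLinks b) (xs , _) = length-map pull xs

  pushA : Anti P → Anti Q
  pushA (A , a) = (λ q → A (from q)) , λ x y e e' le →
    trans (sym (strictlyInverseˡ x)) (trans (cong to (a (from x) (from y) e e' (from-order x y le))) (strictlyInverseˡ y))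

  pullA : Anti Q → Anti P
  pullA (A , a) = (λ p → A (to p)) , λ x y e e' le →
    trans (sym (strictlyInverseʳ x)) (trans (cong from (a (to x) (to y) e e' (proj₁ (_≅_.order φ x y) le))) (strictlyInverseʳ y))

  pushA-inj : ∀ {A B : Anti P} → pushA A AQ.≈ pushA B → A AP.≈ B
  pushA-inj {A , _} {B , _} e p = trans (cong A (sym (strictlyInverseʳ p))) (trans (e (to p)) (cong B (strictlyInverseʳ p)))

  push-pull : ∀ A → pushA (pullA A) AQ.≈ A
  push-pull (A , _) q = cong A (strictlyInverseˡ q)

  pull≈ : ∀ {A B} → A AQ.≈ pushA B → pullA A AP.≈ B
  pull≈ {A , _} {B , _} e p = trans (e (to p)) (cong B (strictlyInverseʳ p))

  module TP = Transport (AG Q) (AG P) pushA (λ e q → e (from q)) (λ {A} {B} → pushA-inj {A} {B})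

  eval : ∀ (e : Aff (Carrier P)) (A : Anti Q) → ⟦ sub (λ p → var (to p)) e ⟧ᵇ (proj₁ A) ≡ ⟦ e ⟧ᵇ (proj₁ (pullA A))
  eval e A = ⟦sub⟧ _ e _

  pull-∈ : ∀ {xs} A → A AQ.∈ map pushA xs → pullA A AP.∈ xs
  pull-∈ {xs} A m with TP.map-∈⁻ {A} xs m
  ... | B , B∈ , e = AP.∈-resp {B} {pullA A} (AP.≈-sym {pullA A} {B} (pull≈ {A} {B} e)) B∈

  pushSimp : Simp P → Simp Q
  pushSimp σ = record
    { pts = map pushA (pts σ)
    ; uniq = TP.map-clique (λ A B _ _ n e → n (pushA-inj {A} {B} e)) (uniq σ)
    ; face = sub (λ p → var (to p)) (face σ)
    ; face≤ = λ A → subst (_≤ℚ 0ℚ) (sym (eval (face σ) A)) (face≤ σ (pullA A))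
    ; face→ = λ A e → AQ.∈-resp {pushA (pullA A)} {A} (push-pull A) (TP.map-∈ {pullA A} (face→ σ (pullA A) (trans (sym (eval (face σ) A)) e)))
    ; face← = λ A m → trans (eval (face σ) A) (face← σ (pullA A) (pull-∈ A m))
    ; dual = λ A m → let (u , u≢0 , u0) = dual σ (pullA A) (pull-∈ A m) in
        sub (λ p → var (to p)) u , (λ e → u≢0 (trans (sym (eval u A)) e)) ,
        λ B m' n → trans (eval u B) (u0 (pullA B) (pull-∈ B m')
          (λ e → n (λ q → trans (cong (proj₁ B) (sym (strictlyInverseˡ q))) (trans (e (from q)) (cong (proj₁ A) (strictlyInverseˡ q)))))) }

  pushSimps : Simps P ↪ Simps Q
  fun pushSimps = pushSimp
  inj pushSimps σ τ e = TP.map-~⁻ {pts σ} {pts τ} e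
  deg≡ pushSimps σ = length-map pushA (pts σ)

  pushSimps∌∅ : Simps∌∅ P ↪ Simps∌∅ Q
  fun pushSimps∌∅ (σ , n) = pushSimp σ , λ m → n (pull-∈ (∅ Q) m)
  inj pushSimps∌∅ (σ , _) (τ , _) e = TP.map-~⁻ {pts σ} {pts τ} e
  deg≡ pushSimps∌∅ (σ , _) = length-map pushA (pts σ)

  iso-bounds : Bounds P → Bounds Q
  Bounds.simplices (iso-bounds H) = pullCliques ⨾ (Bounds.simplices H ⨾ pushSimps)
  Bounds.links (iso-bounds H) b = pullLinks b ⨾ (Bounds.links H b ⨾ pushSimps∌∅)

  iso-dec : DecOrder Q → DecOrder P
  iso-dec d p q = map′ (proj₂ (_≅_.order φ p q)) (proj₁ (_≅_.order φ p q)) (d (to p) (to q))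

-- Lets faces that are constant in the second component be reused as faces constant in the first.
⊔-comm : ∀ A B → (B ⊔ A) ≅ (A ⊔ B)
⊔-comm A B = record
  { bij = mk↔ₛ′ Data.Sum.swap Data.Sum.swap Data.Sum.Properties.swap-involutive Data.Sum.Properties.swap-involutive
  ; order = λ { _ _ → (λ { (l le) → r le ; (r le) → l le }) , back } }
  where
  back : ∀ {x y} → _⊔≤_ A B (Data.Sum.swap x) (Data.Sum.swap y) → _⊔≤_ B A x y
  back {inj₁ _} {inj₁ _} (r le) = l le
  back {inj₂ _} {inj₂ _} (l le) = r le

emptySimp : ∀ P → Simp P
emptySimp P = record
  { pts = [] ; uniq = Cliques.[] ; face = con -1ℚ ; face≤ = λ _ → toWitness {a? = -1ℚ ℚ.≤? 0ℚ} _
  ; face→ = λ _ () ; face← = λ _ () ; dual = λ _ () }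

-- Disjoint unions

module Product (A B : FinPoset) where
  private
    P = A ⊔ B
    module GA = Cliques (AG A)
    module GB = Cliques (AG B)
    module GP = Cliques (AG P)
  open Simp

  pairA : Anti A → Anti B → Anti P
  pairA (Z , z) (Y , y) = [ Z , Y ]′ , λ { _ _ e e' (l le) → cong inj₁ (z _ _ e e' le) ; _ _ e e' (r le) → cong inj₂ (y _ _ e e' le) }

  fstA : Anti P → Anti A
  fstA (Z , z) = (λ a → Z (inj₁ a)) , λ a a' x y le → inj₁-injective (z _ _ x y (l le))

  sndA : Anti P → Anti B
  sndA (Z , z) = (λ b → Z (inj₂ b)) , λ b b' x y le → inj₂-injective (z _ _ x y (r le))

  -- A face times a vertex: `τ` has `Y` as its only point, so the sum of the two supporting
  -- functions is tight exactly on the copy of `σ` over `Y`.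
  module Fibre (σ : Simp A) (τ : Simp B) (Y : Anti B) (Y∈ : Y GB.∈ pts τ) (only : ∀ Z → Z GB.∈ pts τ → Z GB.≈ Y) where
    pair-cong : ∀ {Z Z' : Anti A} → Z GA.≈ Z' → pairA Z Y GP.≈ pairA Z' Y
    pair-cong e (inj₁ a) = e a
    pair-cong e (inj₂ _) = refl

    module T = Transport (AG P) (AG A) (λ Z → pairA Z Y) (λ {Z} {Z'} → pair-cong {Z} {Z'}) (λ e a → e (inj₁ a))

    ptsP = map (λ Z → pairA Z Y) (pts σ)

    mem : ∀ Z → fstA Z GA.∈ pts σ → sndA Z GB.≈ Y → Z GP.∈ ptsP
    mem Z m e = GP.∈-resp {pairA (fstA Z) Y} {Z} (λ { (inj₁ _) → refl ; (inj₂ b) → sym (e b) }) (T.map-∈ {fstA Z} m)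

    mem⁻ : ∀ Z → Z GP.∈ ptsP → fstA Z GA.∈ pts σ × sndA Z GB.≈ Y
    mem⁻ Z m with T.map-∈⁻ {Z} (pts σ) m
    ... | F , F∈ , e = GA.∈-resp {F} {fstA Z} (λ a → sym (e (inj₁ a))) F∈ , (λ b → e (inj₂ b))

    face' : Aff (Carrier P)
    face' = sub (λ a → var (inj₁ a)) (face σ) ⊞ sub (λ b → var (inj₂ b)) (face τ)

    ev : ∀ Z → ⟦ face' ⟧ᵇ (proj₁ Z) ≡ ⟦ face σ ⟧ᵇ (proj₁ (fstA Z)) +ℚ ⟦ face τ ⟧ᵇ (proj₁ (sndA Z))
    ev Z = cong₂ _+ℚ_ (⟦sub⟧ _ (face σ) _) (⟦sub⟧ _ (face τ) _)

    simp : Simp P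
    simp = record
      { pts = ptsP
      ; uniq = T.map-clique (λ _ _ _ _ n e → n (λ a → e (inj₁ a))) (uniq σ)
      ; face = face'
      ; face≤ = λ Z → subst (_≤ℚ 0ℚ) (sym (ev Z)) (nonpos-+ (face≤ σ (fstA Z)) (face≤ τ (sndA Z)))
      ; face→ = λ Z e → let (x , y) = nonpos-+≡0 (face≤ σ (fstA Z)) (face≤ τ (sndA Z)) (trans (sym (ev Z)) e) in
                  mem Z (face→ σ (fstA Z) x) (only (sndA Z) (face→ τ (sndA Z) y))
      ; face← = λ Z m → let (x , y) = mem⁻ Z m in
                  trans (ev Z) (cong₂ _+ℚ_ (face← σ (fstA Z) x) (face← τ (sndA Z) (GB.∈-resp {Y} {sndA Z} (λ b → sym (y b)) Y∈)))
      ; dual = λ Z m → let (x , y) = mem⁻ Z m ; (u , u≢0 , u0) = dual σ (fstA Z) x in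
                  sub (λ a → var (inj₁ a)) u , (λ e → u≢0 (trans (sym (⟦sub⟧ _ u _)) e)) ,
                  λ Z' m' n → let (x' , y') = mem⁻ Z' m' in trans (⟦sub⟧ _ u _) (u0 (fstA Z') x'
                    (λ e → n (λ { (inj₁ a) → e a ; (inj₂ b) → trans (y' b) (sym (y b)) }))) }

    degree : length ptsP ≡ length (pts σ)
    degree = length-map _ (pts σ)

  -- Degree zero, because multiplying a face by a vertex does not change its number of vertices.
  Vertices : Graded
  Vertices = record { El = Filter B ; _≋_ = λ G G' → _≗ᵛ_ B (proj₁ G) (proj₁ G') ; deg = λ _ → 0 }

  only-point : (τ : Simp B) → length (pts τ) ≡ 1 → Σ (Anti B) λ Y → Y GB.∈ pts τ × (∀ Z → Z GB.∈ pts τ → Z GB.≈ Y)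
  only-point τ e with pts τ
  only-point τ refl | Y ∷ [] = Y , here (λ _ → refl) , λ { Z (here x) → x }

  module _ (HA : Bounds A) (HB : Bounds B) where
    private
      module OA = Cliques (OG A)
      module OB = Cliques (OG B)

    -- The injection of filters into antichains is taken from the induction hypothesis in degree
    -- one: a single filter goes to a face with a single point.
    point : Filter B → Simp B
    point G = fun (Bounds.simplices HB) (G ∷ [] , ((λ _ ()) OB.∷ OB.[]))

    module Pt (G : Filter B) where
      found = only-point (point G) (deg≡ (Bounds.simplices HB) _)
      Y = proj₁ found
      Y∈ = proj₁ (proj₂ found)
      only = proj₂ (proj₂ found)

    point-inj : ∀ G G' → Pt.Y G GB.≈ Pt.Y G' → G OB.≈ G'
    point-inj G G' e with proj₁ (inj (Bounds.simplices HB) _ _ (half G G' e , half G' G (GB.≈-sym {Pt.Y G} {Pt.Y G'} e))) G (here (λ _ → refl))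
      where
      half : ∀ G G' → Pt.Y G GB.≈ Pt.Y G' → pts (point G) GB.⊆ pts (point G')
      half G G' e Z m = GB.∈-resp {Pt.Y G'} {Z} (λ b → sym (trans (Pt.only G Z m b) (e b))) (Pt.Y∈ G')
    ... | here x = x

    module Fib (z : El (OA.Cl≥ 1 ×ᵍ Vertices)) where
      σ = fun (Bounds.simplices HA) (proj₁ (proj₁ z) , proj₁ (proj₂ (proj₁ z)))
      G = proj₂ z
      open Fibre σ (point G) (Pt.Y G) (Pt.Y∈ G) (Pt.only G) public
      size≡ : length ptsP ≡ length (proj₁ (proj₁ z))
      size≡ = trans degree (deg≡ (Bounds.simplices HA) _)
      inhabited : Σ (Anti P) λ Z → Z GP.∈ ptsP
      inhabited = GP.inhabitant ptsP (subst (1 ≤_) (sym size≡) (proj₂ (proj₂ (proj₁ z))))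

    fibres : (OA.Cl≥ 1 ×ᵍ Vertices) ↪ Simps P
    fun fibres z = Fib.simp z
    inj fibres z z' (s , s') = inj (Bounds.simplices HA) _ _ (half z z' s , half z' z s') , point-inj (proj₂ z) (proj₂ z') Y≈
      where
      half : ∀ z z' → Fib.ptsP z GP.⊆ Fib.ptsP z' → pts (Fib.σ z) GA.⊆ pts (Fib.σ z')
      half z z' s F m = proj₁ (Fib.mem⁻ z' (pairA F (Pt.Y (proj₂ z))) (s (pairA F (Pt.Y (proj₂ z))) (Fib.T.map-∈ z {F} m)))
      Y≈ : Pt.Y (proj₂ z) GB.≈ Pt.Y (proj₂ z')
      Y≈ b with Fib.inhabited z
      ... | Z , m = trans (sym (proj₂ (Fib.mem⁻ z Z m) b)) (proj₂ (Fib.mem⁻ z' Z (s Z m)) b)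
    deg≡ fibres z = trans (Fib.size≡ z) (sym (+-identityʳ _))

    fibres-constant : ∀ z Z Z' → Z GP.∈ pts (fun fibres z) → Z' GP.∈ pts (fun fibres z) → sndA Z GB.≈ sndA Z'
    fibres-constant z Z Z' m m' b = trans (proj₂ (Fib.mem⁻ z Z m) b) (sym (proj₂ (Fib.mem⁻ z Z' m') b))

  module _ (decB : DecOrder B) where
    private
      module CB = ChainSimplices B decB
      τ∅ = CB.chainSimp ([] , Cliques.[])
      only∅ : ∀ Z → Z GB.∈ pts τ∅ → Z GB.≈ ∅ B
      only∅ Z (here e) = e
      module F∅ (σ : Simp A) = Fibre σ τ∅ (∅ B) (here (λ _ → refl)) only∅

    -- The second factor is the origin of `C(B)`, obtained as the simplex of the empty chain; a
    -- point of the result is the origin only if its first component is.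
    extend : Simps∌∅ A ↪ Simps∌∅ P
    fun extend (σ , n) = F∅.simp σ , λ m → n (proj₁ (F∅.mem⁻ σ (∅ P) m))
    inj extend (σ , _) (σ' , _) e = F∅.T.map-~⁻ σ {pts σ} {pts σ'} e
    deg≡ extend (σ , _) = F∅.degree σ

    extend-snd : ∀ s Z → Z GP.∈ pts (proj₁ (fun extend s)) → sndA Z GB.≈ ∅ B
    extend-snd (σ , _) Z m = proj₂ (F∅.mem⁻ σ Z m)

module Union (A B : FinPoset) where
  private
    P = A ⊔ B
    module GA = Cliques (AG A)
    module GB = Cliques (AG B)
    module GP = Cliques (AG P)
    module OA = Cliques (OG A)
    module OB = Cliques (OG B)
    module OP = Cliques (OG P)
  open Simp

  pairF : Filter A → Filter B → Filter P
  pairF (F , f) (G , g) = [ F , G ]′ , λ { _ _ (l le) → f _ _ le ; _ _ (r le) → g _ _ le }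

  fstF : Filter P → Filter A
  fstF (H , h) = (λ a → H (inj₁ a)) , λ a a' le → h _ _ (l le)

  sndF : Filter P → Filter B
  sndF (H , h) = (λ b → H (inj₂ b)) , λ b b' le → h _ _ (r le)

  Sharing : Filter P → Filter P → Set
  Sharing H H' = (sndF H OB.≈ sndF H' × OA.E (fstF H) (fstF H')) ⊎ (fstF H OA.≈ fstF H' × OB.E (sndF H) (sndF H'))

  -- The sum 1_H + 1_H' is unchanged when H and H' exchange their second components.
  edge-shares : ∀ H H' → OP.E H H' → Sharing H H'
  edge-shares H H' (n , h) with h (pairF (fstF H) (sndF H')) (pairF (fstF H') (sndF H))
                                 (λ { (inj₁ _) → inj₁ (refl , refl) ; (inj₂ _) → inj₂ (refl , refl) })
  ... | inj₁ (e , _) = inj₁ (e₂ , (λ e₁ → n (λ { (inj₁ a) → e₁ a ; (inj₂ b) → e₂ b })) ,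
    λ K K' s → Data.Sum.map (λ { (x , y) → (λ a → x (inj₁ a)) , (λ a → y (inj₁ a)) }) (λ { (x , y) → (λ a → x (inj₁ a)) , (λ a → y (inj₁ a)) })
      (h (pairF K (sndF H)) (pairF K' (sndF H')) (λ { (inj₁ a) → s a ; (inj₂ b) → inj₁ (refl , refl) })))
    where
    e₂ : sndF H OB.≈ sndF H'
    e₂ b = sym (e (inj₂ b))
  ... | inj₂ (e , _) = inj₂ (e₁ , (λ e₂ → n (λ { (inj₁ a) → e₁ a ; (inj₂ b) → e₂ b })) ,
    λ K K' s → Data.Sum.map (λ { (x , y) → (λ b → x (inj₂ b)) , (λ b → y (inj₂ b)) }) (λ { (x , y) → (λ b → x (inj₂ b)) , (λ b → y (inj₂ b)) })
      (h (pairF (fstF H) K) (pairF (fstF H') K') (λ { (inj₂ b) → s b ; (inj₁ a) → inj₁ (refl , refl) })))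
    where
    e₁ : fstF H OA.≈ fstF H'
    e₁ a = e (inj₁ a)

  -- All edges of a clique vary the same factor. If `H` and `H'` share the second component but `H`
  -- and `K` the first, then `K` and `H'` share one of the two, and either `K` has the second
  -- component of `H` after all or `H` and `H'` coincide.
  clique-shares : ∀ H H' Hs → OP.IsClique (H ∷ H' ∷ Hs) →
    (∀ K → K OP.∈ (H' ∷ Hs) → sndF K OB.≈ sndF H) ⊎ (∀ K → K OP.∈ (H' ∷ Hs) → fstF K OA.≈ fstF H)
  clique-shares H H' Hs (adj OP.∷ c) with edge-shares H H' (adj H' (here (λ _ → refl)))
  ... | inj₁ (e , _ , _) = inj₁ go
    where
    go : ∀ K → K OP.∈ (H' ∷ Hs) → sndF K OB.≈ sndF H
    go K m with edge-shares H K (adj K m)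
    ... | inj₁ (e' , _) = OB.≈-sym {sndF H} {sndF K} e'
    ... | inj₂ (e₁ , n₂ , _) with K OP.≈? H'
    ...   | yes K≈ = λ b → trans (K≈ (inj₂ b)) (sym (e b))
    ...   | no K≉ with edge-shares K H' (OP.clique-E c {K} {H'} m (here (λ _ → refl)) K≉)
    ...     | inj₁ (e' , _) = λ b → trans (e' b) (sym (e b))
    ...     | inj₂ (e' , _) = ⊥-elim (proj₁ (adj H' (here (λ _ → refl))) (λ { (inj₁ a) → trans (e₁ a) (e' a) ; (inj₂ b) → e b }))
  ... | inj₂ (e , _ , _) = inj₂ go
    where
    go : ∀ K → K OP.∈ (H' ∷ Hs) → fstF K OA.≈ fstF H
    go K m with edge-shares H K (adj K m)
    ... | inj₂ (e' , _) = OA.≈-sym {fstF H} {fstF K} e'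
    ... | inj₁ (e₁ , n₂ , _) with K OP.≈? H'
    ...   | yes K≈ = λ b → trans (K≈ (inj₁ b)) (sym (e b))
    ...   | no K≉ with edge-shares K H' (OP.clique-E c {K} {H'} m (here (λ _ → refl)) K≉)
    ...     | inj₂ (e' , _) = λ b → trans (e' b) (sym (e b))
    ...     | inj₁ (e' , _) = ⊥-elim (proj₁ (adj H' (here (λ _ → refl))) (λ { (inj₂ a) → trans (e₁ a) (e' a) ; (inj₁ b) → e b }))

  pairF-congˡ : ∀ G {F F' : Filter A} → F OA.≈ F' → pairF F G OP.≈ pairF F' G
  pairF-congˡ G e (inj₁ a) = e a
  pairF-congˡ G e (inj₂ _) = refl

  pairF-congʳ : ∀ F {G G' : Filter B} → G OB.≈ G' → pairF F G OP.≈ pairF F G'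
  pairF-congʳ F e (inj₁ _) = refl
  pairF-congʳ F e (inj₂ b) = e b

  module TA (G : Filter B) = Transport (OG P) (OG A) (λ F → pairF F G) (λ {F} {F'} → pairF-congˡ G {F} {F'}) (λ e a → e (inj₁ a))
  module TB (F : Filter A) = Transport (OG P) (OG B) (λ G → pairF F G) (λ {G} {G'} → pairF-congʳ F {G} {G'}) (λ e b → e (inj₂ b))

  pairF-EA : ∀ G F F' → OP.E (pairF F G) (pairF F' G) → OA.E F F'
  pairF-EA G F F' e with edge-shares (pairF F G) (pairF F' G) e
  ... | inj₁ (_ , e') = e'
  ... | inj₂ (_ , n , _) = ⊥-elim (n (λ _ → refl))

  pairF-EB : ∀ F G G' → OP.E (pairF F G) (pairF F G') → OB.E G G'
  pairF-EB F G G' e with edge-shares (pairF F G) (pairF F G') e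
  ... | inj₂ (_ , e') = e'
  ... | inj₁ (_ , n , _) = ⊥-elim (n (λ _ → refl))

  module Decomposition where
    module PA = Product A B
    module PB = Product B A
    -- A single vertex is a fibre in both directions; it is filed under `A`, so the fibres of `B`
    -- start at two vertices.
    Tgt = Unit ⊎ᵍ ((OA.Cl≥ 1 ×ᵍ PA.Vertices) ⊎ᵍ (OB.Cl≥ 2 ×ᵍ PB.Vertices))

    data Out : El OP.Cl → El Tgt → Set where
      nil  : ∀ {c} → Out ([] , c) (inj₁ tt)
      fibA : ∀ {xs c} G (S : TA.Preimage G xs) {p} → Out (xs , c) (inj₂ (inj₁ ((TA.Preimage.elts S , p) , G)))
      fibB : ∀ {xs c} F (S : TB.Preimage F xs) {p} → Out (xs , c) (inj₂ (inj₂ ((TB.Preimage.elts S , p) , F)))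

    out : ∀ σ → Σ _ (Out σ)
    out ([] , c) = _ , nil
    out (H ∷ [] , c) = _ , fibA (sndF H) S {TA.Preimage.clique S c (λ F F' _ _ → pairF-EA (sndF H) F F') , s≤s z≤n}
      where S = TA.preimage (sndF H) (H ∷ []) (λ { K (here e) → fstF H , λ { (inj₁ a) → e (inj₁ a) ; (inj₂ b) → e (inj₂ b) } })
    out (H ∷ H' ∷ Hs , c) with clique-shares H H' Hs c
    ... | inj₁ sh = _ , fibA (sndF H) S {TA.Preimage.clique S c (λ F F' _ _ → pairF-EA (sndF H) F F') , s≤s z≤n}
      where S = TA.preimage (sndF H) (H ∷ H' ∷ Hs) (λ { K (here e) → fstF H , λ { (inj₁ a) → e (inj₁ a) ; (inj₂ b) → e (inj₂ b) }
                                                      ; K (there m) → fstF K , λ { (inj₁ a) → refl ; (inj₂ b) → sh K m b } })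
    ... | inj₂ sh = _ , fibB (fstF H) S {TB.Preimage.clique S c (λ F F' _ _ → pairF-EB (fstF H) F F') , s≤s (s≤s z≤n)}
      where S = TB.preimage (fstF H) (H ∷ H' ∷ Hs) (λ { K (here e) → sndF H , λ { (inj₁ a) → e (inj₁ a) ; (inj₂ b) → e (inj₂ b) }
                                                      ; K (there m) → sndF K , λ { (inj₂ a) → refl ; (inj₁ b) → sh K m b } })

    halfA : ∀ {xs ys} G G' (S : TA.Preimage G xs) (S' : TA.Preimage G' ys) → TA.Preimage.elts S OA.⊆ TA.Preimage.elts S' → G OB.≈ G' → xs OP.⊆ ys
    halfA G G' S S' s e H m with TA.Preimage.image S H m
    ... | F , x = OP.∈-resp {pairF F G'} {H} (λ { (inj₁ a) → sym (x (inj₁ a)) ; (inj₂ b) → sym (trans (x (inj₂ b)) (e b)) })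
                    (TA.Preimage.elt→ S' F (s F (TA.Preimage.elt← S F (OP.∈-resp {H} {pairF F G} x m))))
    halfB : ∀ {xs ys} F F' (S : TB.Preimage F xs) (S' : TB.Preimage F' ys) → TB.Preimage.elts S OB.⊆ TB.Preimage.elts S' → F OA.≈ F' → xs OP.⊆ ys
    halfB F F' S S' s e H m with TB.Preimage.image S H m
    ... | G , x = OP.∈-resp {pairF F' G} {H} (λ { (inj₂ a) → sym (x (inj₂ a)) ; (inj₁ b) → sym (trans (x (inj₁ b)) (e b)) })
                    (TB.Preimage.elt→ S' G (s G (TB.Preimage.elt← S G (OP.∈-resp {H} {pairF F G} x m))))

    reflect : ∀ {σ σ' u u'} → Out σ u → Out σ' u' → _≋_ Tgt u u' → _≋_ OP.Cl σ σ'
    reflect nil nil _ = (λ _ m → m) , (λ _ m → m)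
    reflect (fibA G S) (fibA G' S') (inr (inl ((s , s') , e))) = halfA G G' S S' s e , halfA G' G S' S s' (OB.≈-sym {G} {G'} e)
    reflect (fibB F S) (fibB F' S') (inr (inr ((s , s') , e))) = halfB F F' S S' s e , halfB F' F S' S s' (OA.≈-sym {F} {F'} e)
    reflect (fibA _ _) (fibB _ _) (inr ())
    reflect (fibB _ _) (fibA _ _) (inr ())

    degree : ∀ {σ u} → Out σ u → deg Tgt u ≡ deg OP.Cl σ
    degree nil = refl
    degree (fibA G S) = trans (+-identityʳ _) (TA.Preimage.len S)
    degree (fibB F S) = trans (+-identityʳ _) (TB.Preimage.len S)

    decompose : OP.Cl ↪ Tgt
    fun decompose σ = proj₁ (out σ)
    inj decompose σ σ' = reflect (proj₂ (out σ)) (proj₂ (out σ'))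
    deg≡ decompose σ = degree (proj₂ (out σ))

    module Links (b : Bool) where
      -- Likewise the empty clique of the link is filed under `A`.
      LTgt = OA.Link (base A b) ⊎ᵍ OB.Link≥1 (base B b)

      data LOut : El (OP.Link (base P b)) → El LTgt → Set where
        linkA : ∀ {xs c} (S : TA.Preimage (base B b) xs) {p} → LOut (xs , c) (inj₁ (TA.Preimage.elts S , p))
        linkB : ∀ {xs c} (S : TB.Preimage (base A b) xs) {p q} → LOut (xs , c) (inj₂ ((TB.Preimage.elts S , p) , q))

      base-pair : base P b OP.≈ pairF (base A b) (base B b)
      base-pair = λ { (inj₁ _) → refl ; (inj₂ _) → refl }

      adjA : ∀ {xs} → OP.Adj (base P b) xs → (S : TA.Preimage (base B b) xs) → OA.Adj (base A b) (TA.Preimage.elts S)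
      adjA adj S F m = pairF-EA (base B b) (base A b) F (OP.E-resp {base P b} {pairF (base A b) (base B b)} {pairF F (base B b)} base-pair (adj (pairF F (base B b)) (TA.Preimage.elt→ S F m)))
      adjB : ∀ {xs} → OP.Adj (base P b) xs → (S : TB.Preimage (base A b) xs) → OB.Adj (base B b) (TB.Preimage.elts S)
      adjB adj S G m = pairF-EB (base A b) (base B b) G (OP.E-resp {base P b} {pairF (base A b) (base B b)} {pairF (base A b) G} base-pair (adj (pairF (base A b) G) (TB.Preimage.elt→ S G m)))

      lout : ∀ τ → Σ _ (LOut τ)
      lout ([] , c , adj) = _ , linkA (TA.preimage (base B b) [] (λ _ ())) {OA.[] , λ _ ()}
      lout (H ∷ Hs , c , adj) with clique-shares (base P b) H Hs (adj OP.∷ c)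
      ... | inj₁ sh = _ , linkA S {TA.Preimage.clique S c (λ F F' _ _ → pairF-EA (base B b) F F') , adjA adj S}
        where S = TA.preimage (base B b) (H ∷ Hs) (λ K m → fstF K , λ { (inj₁ a) → refl ; (inj₂ x) → sh K m x })
      ... | inj₂ sh = _ , linkB S {TB.Preimage.clique S c (λ F F' _ _ → pairF-EB (base A b) F F') , adjB adj S} {s≤s z≤n}
        where S = TB.preimage (base A b) (H ∷ Hs) (λ K m → sndF K , λ { (inj₂ a) → refl ; (inj₁ x) → sh K m x })

      lreflect : ∀ {σ σ' u u'} → LOut σ u → LOut σ' u' → _≋_ LTgt u u' → _≋_ (OP.Link (base P b)) σ σ'
      lreflect (linkA S) (linkA S') (inl (s , s')) = halfA (base B b) (base B b) S S' s (λ _ → refl) , halfA (base B b) (base B b) S' S s' (λ _ → refl)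
      lreflect (linkB S) (linkB S') (inr (s , s')) = halfB (base A b) (base A b) S S' s (λ _ → refl) , halfB (base A b) (base A b) S' S s' (λ _ → refl)

      ldegree : ∀ {σ u} → LOut σ u → deg LTgt u ≡ deg (OP.Link (base P b)) σ
      ldegree (linkA S) = TA.Preimage.len S
      ldegree (linkB S) = TB.Preimage.len S

      decompose-link : OP.Link (base P b) ↪ LTgt
      fun decompose-link σ = proj₁ (lout σ)
      inj decompose-link σ σ' = lreflect (proj₂ (lout σ)) (proj₂ (lout σ'))
      deg≡ decompose-link σ = ldegree (proj₂ (lout σ))

  module _ (dec : DecOrder P) where
    decA : DecOrder A
    decA a a' = map′ (λ { (l le) → le }) l (dec (inj₁ a) (inj₁ a'))
    decB : DecOrder B
    decB b b' = map′ (λ { (r le) → le }) r (dec (inj₂ b) (inj₂ b'))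

    module _ (HA : Bounds A) (HB : Bounds B) where
      open Decomposition
      private module I = Isomorphism (⊔-comm A B)

      fibA↪ : (OA.Cl≥ 1 ×ᵍ PA.Vertices) ↪ Simps P
      fibA↪ = PA.fibres HA HB
      fibB↪ : (OB.Cl≥ 1 ×ᵍ PB.Vertices) ↪ Simps P
      fibB↪ = PB.fibres HB HA ⨾ I.pushSimps
      relax : (OB.Cl≥ 2 ×ᵍ PB.Vertices) ↪ (OB.Cl≥ 1 ×ᵍ PB.Vertices)
      fun relax ((xs , c , n) , F) = (xs , c , ≤-trans (s≤s z≤n) n) , F
      inj relax _ _ e = e
      deg≡ relax _ = refl

      fibB-constant : ∀ z Z Z' → Z GP.∈ pts (fun fibB↪ z) → Z' GP.∈ pts (fun fibB↪ z) → PA.fstA Z GA.≈ PA.fstA Z'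
      fibB-constant z Z Z' m m' = PB.fibres-constant HB HA z (I.pullA Z) (I.pullA Z') (I.pull-∈ Z m) (I.pull-∈ Z' m')

      -- A fibre of one kind is constant in the first component, one of the other kind in the
      -- second, so a fibre of `B` inside a fibre of `A` would have at most one point.
      not-both : ∀ x (y : El (OB.Cl≥ 2 ×ᵍ PB.Vertices)) → ¬ (pts (fun (relax ⨾ fibB↪) y) GP.⊆ pts (fun fibA↪ x))
      not-both x y s with GP.two-inhabitants (uniq (fun (relax ⨾ fibB↪) y))
        (subst (2 ≤_) (sym (trans (deg≡ (relax ⨾ fibB↪) y) (+-identityʳ _))) (proj₂ (proj₂ (proj₁ y))))
      ... | Z , Z' , m , m' , n = n (λ { (inj₁ a) → fibB-constant (fun relax y) Z Z' m m' a
                                       ; (inj₂ b) → PA.fibres-constant HA HB x Z Z' (s Z m) (s Z' m') b })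

      nonempty : ((OA.Cl≥ 1 ×ᵍ PA.Vertices) ⊎ᵍ (OB.Cl≥ 2 ×ᵍ PB.Vertices)) ↪ Simps P
      nonempty = copair fibA↪ (relax ⨾ fibB↪) (λ x y e → not-both x y (proj₂ e)) (λ x y e → not-both x y (proj₁ e))

      bounds : Bounds P
      Bounds.simplices bounds = decompose ⨾ copair empty nonempty clash clash'
        where
        empty : Unit ↪ Simps P
        fun empty _ = emptySimp P
        inj empty _ _ _ = tt
        deg≡ empty _ = refl
        no-member : ∀ Z → ¬ (Z GP.∈ [])
        no-member _ ()
        has : ∀ z → Σ (Anti P) λ Z → Z GP.∈ pts (fun nonempty z)
        has z = GP.inhabitant _ (subst (1 ≤_) (sym (deg≡ nonempty z)) (pos z))
          where
          pos : ∀ z → 1 ≤ deg ((OA.Cl≥ 1 ×ᵍ PA.Vertices) ⊎ᵍ (OB.Cl≥ 2 ×ᵍ PB.Vertices)) z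
          pos (inj₁ ((_ , _ , n) , _)) = subst (1 ≤_) (sym (+-identityʳ _)) n
          pos (inj₂ ((_ , _ , n) , _)) = subst (1 ≤_) (sym (+-identityʳ _)) (≤-trans (s≤s z≤n) n)
        clash : ∀ x y → ¬ _≋_ (Simps P) (fun empty x) (fun nonempty y)
        clash x y (_ , s) = no-member (proj₁ (has y)) (s (proj₁ (has y)) (proj₂ (has y)))
        clash' : ∀ x y → ¬ _≋_ (Simps P) (fun nonempty y) (fun empty x)
        clash' x y (s , _) = no-member (proj₁ (has y)) (s (proj₁ (has y)) (proj₂ (has y)))
      Bounds.links bounds b = Links.decompose-link b ⨾ copair extA (toLink ⨾ extB) (λ x y e → not-equal x y (proj₂ e)) (λ x y e → not-equal x y (proj₁ e))
        where
        toLink : OB.Link≥1 (base B b) ↪ OB.Link (base B b)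
        fun toLink = proj₁
        inj toLink _ _ e = e
        deg≡ toLink _ = refl
        extA : OA.Link (base A b) ↪ Simps∌∅ P
        extA = Bounds.links HA b ⨾ PA.extend decB
        extB₀ : OB.Link (base B b) ↪ Simps∌∅ (B ⊔ A)
        extB₀ = Bounds.links HB b ⨾ PB.extend decA
        extB : OB.Link (base B b) ↪ Simps∌∅ P
        extB = extB₀ ⨾ I.pushSimps∌∅
        -- A common point has both components empty, so it is the origin, which both faces avoid.
        not-equal : ∀ x y → ¬ (pts (proj₁ (fun (toLink ⨾ extB) y)) GP.⊆ pts (proj₁ (fun extA x)))
        not-equal x y s with GP.inhabitant (pts (proj₁ (fun (toLink ⨾ extB) y))) (subst (1 ≤_) (sym (deg≡ (toLink ⨾ extB) y)) (proj₂ y))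
        ... | Z , m = proj₂ (fun extA x) (GP.∈-resp {Z} {∅ P} Z≈∅ (s Z m))
          where
          Z≈∅ : Z GP.≈ ∅ P
          Z≈∅ (inj₁ a) = PB.extend-snd decA (fun (Bounds.links HB b) (proj₁ y)) (I.pullA Z) (I.pull-∈ Z m) a
          Z≈∅ (inj₂ c) = PA.extend-snd decB (fun (Bounds.links HA b) x) Z (s Z m) c

-- Cliques of filters are faces of the order polytope

module Extremum {V : Set} (R : V → V → Set) (R-trans : ∀ {x y z} → R x y → R y z → R x z) (Q : V → Set) (Q? : ∀ x → Dec (Q x)) where
  module _ (_≈_ : V → V → Set) (≈-refl : ∀ {x} → x ≈ x) (R-respˡ : ∀ {x y z} → x ≈ y → R y z → R x z) (R-refl : ∀ {x} → R x x)
           (Q-resp : ∀ {x y} → x ≈ y → Q x → Q y) where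

    Top : List V → Set
    Top xs = Σ V λ x → Any (x ≈_) xs × Q x × (∀ y → Any (y ≈_) xs → Q y → R y x)

    top : ∀ xs → (∀ x y → Any (x ≈_) xs → Any (y ≈_) xs → R x y ⊎ R y x) → Top xs ⊎ (∀ x → Any (x ≈_) xs → ¬ Q x)
    top [] total = inj₂ (λ _ ())
    top (x ∷ xs) total with top xs (λ a b m m' → total a b (there m) (there m')) | Q? x
    ... | inj₂ none | no n = inj₂ λ { y (here e) q → n (Q-resp e q) ; y (there m) → none y m }
    ... | inj₂ none | yes q = inj₁ (x , here ≈-refl , q , λ { y (here e) _ → R-respˡ e R-refl ; y (there m) q' → ⊥-elim (none y m q') })
    ... | inj₁ (t , t∈ , qt , mx) | no n = inj₁ (t , there t∈ , qt , λ { y (here e) q → ⊥-elim (n (Q-resp e q)) ; y (there m) q → mx y m q })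
    ... | inj₁ (t , t∈ , qt , mx) | yes q with total x t (here ≈-refl) (there t∈)
    ...   | inj₁ x≤t = inj₁ (t , there t∈ , qt , λ { y (here e) _ → R-respˡ e x≤t ; y (there m) q' → mx y m q' })
    ...   | inj₂ t≤x = inj₁ (x , here ≈-refl , q , λ { y (here e) _ → R-respˡ e R-refl ; y (there m) q' → R-trans (mx y m q') t≤x })

guard : {A C : Set} → Dec A → Aff C → Aff C
guard (yes _) e = e
guard (no _) _ = con 0ℚ

module Exposing (P : FinPoset) (_≤?_ : DecOrder P) where
  open Elements P
  private module O = Cliques (OG P)

  _⊑_ : Filter P → Filter P → Set
  F ⊑ G = _⊆ᵛ_ P (proj₁ F) (proj₁ G)

  ⊑-antisym : ∀ {F G : Filter P} → F ⊑ G → G ⊑ F → F O.≈ G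
  ⊑-antisym f g p = ≡-by-true (f p) (g p)

  ⊑? : ∀ F G → Dec (F ⊑ G)
  ⊑? (F , _) (G , _) = allC? (λ p → (F p ≟B true) →-dec (G p ≟B true))

  All-∈ : ∀ {Q : Filter P → Set} → (∀ {F G} → F O.≈ G → Q F → Q G) → ∀ {S} → All Q S → ∀ H → H O.∈ S → Q H
  All-∈ resp (q ∷ qs) H (here e) = resp (λ p → sym (e p)) q
  All-∈ resp (q ∷ qs) H (there m) = All-∈ resp qs H m

  ∈-All : ∀ {Q : Filter P → Set} S → (∀ H → H O.∈ S → Q H) → All Q S
  ∈-All [] h = []
  ∈-All (x ∷ S) h = h x (here (λ _ → refl)) ∷ ∈-All S (λ H m → h H (there m))

  module _ (S : List (Filter P)) (c : O.IsClique S) where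

    Coupled : Carrier P → Carrier P → Set
    Coupled p q = _≼_ P p q × All (λ H → proj₁ H q ≡ true → proj₁ H p ≡ true) S

    coupled? : ∀ p q → Dec (Coupled p q)
    coupled? p q = (p ≤? q) ×-dec all?ᴸ (λ H → (proj₁ H q ≟B true) →-dec (proj₁ H p ≟B true)) S

    constant? : ∀ b p → Dec (All (λ H → proj₁ H p ≡ b) S)
    constant? b p = all?ᴸ (λ H → proj₁ H p ≟B b) S

    linkTerm : Carrier P → Carrier P → Aff (Carrier P)
    linkTerm p q = guard (coupled? p q) (var p ⊞ -1ℚ ⊠ var q)

    zeroTerm oneTerm : Carrier P → Aff (Carrier P)
    zeroTerm p = guard (constant? false p) (-1ℚ ⊠ var p)
    oneTerm p = guard (constant? true p) (var p ⊞ con -1ℚ)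

    term : Carrier P → Aff (Carrier P)
    term p = sumA elems (linkTerm p) ⊞ (zeroTerm p ⊞ oneTerm p)

    -- The sum of all defining inequalities of `O(P)` that are equalities on `S`, so its zero set is
    -- the smallest face containing `S`. That no further vertex lies on this face is where the edges
    -- come in.
    exposing : Aff (Carrier P)
    exposing = sumA elems term

    χ-diff≤0 : ∀ a b → (a ≡ true → b ≡ true) → χ a +ℚ -1ℚ *ℚ χ b ≤ℚ 0ℚ
    χ-diff≤0 true true _ = ℚ.≤-refl
    χ-diff≤0 false true _ = toWitness {a? = (0ℚ +ℚ -1ℚ *ℚ 1ℚ) ℚ.≤? 0ℚ} _
    χ-diff≤0 false false _ = ℚ.≤-refl
    χ-diff≤0 true false h with () ← h refl

    χ-1≤0 : ∀ a → χ a +ℚ -1ℚ ≤ℚ 0ℚ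
    χ-1≤0 true = ℚ.≤-refl
    χ-1≤0 false = toWitness {a? = (0ℚ +ℚ -1ℚ) ℚ.≤? 0ℚ} _

    module _ (F : Filter P) where
      linkTerm≤0 : ∀ p q → ⟦ linkTerm p q ⟧ᵇ (proj₁ F) ≤ℚ 0ℚ
      linkTerm≤0 p q with coupled? p q
      ... | no _ = ℚ.≤-refl
      ... | yes (le , _) = χ-diff≤0 (proj₁ F p) (proj₁ F q) (proj₂ F p q le)
      zeroTerm≤0 : ∀ p → ⟦ zeroTerm p ⟧ᵇ (proj₁ F) ≤ℚ 0ℚ
      zeroTerm≤0 p with constant? false p
      ... | no _ = ℚ.≤-refl
      ... | yes _ = -χ≤0 (proj₁ F p)
      oneTerm≤0 : ∀ p → ⟦ oneTerm p ⟧ᵇ (proj₁ F) ≤ℚ 0ℚ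
      oneTerm≤0 p with constant? true p
      ... | no _ = ℚ.≤-refl
      ... | yes _ = χ-1≤0 (proj₁ F p)
      links≤0 : ∀ p → ⟦ sumA elems (linkTerm p) ⟧ᵇ (proj₁ F) ≤ℚ 0ℚ
      links≤0 p = sumA-≤0 _ (linkTerm p) elems (linkTerm≤0 p)
      term≤0 : ∀ p → ⟦ term p ⟧ᵇ (proj₁ F) ≤ℚ 0ℚ
      term≤0 p = nonpos-+ (links≤0 p) (nonpos-+ (zeroTerm≤0 p) (oneTerm≤0 p))
      exposing≤0 : ⟦ exposing ⟧ᵇ (proj₁ F) ≤ℚ 0ℚ
      exposing≤0 = sumA-≤0 _ term elems term≤0

      tight : F O.∈ S → ⟦ exposing ⟧ᵇ (proj₁ F) ≡ 0ℚ
      tight F∈ = sumA-≡0 _ term elems (λ p _ → trans (cong₂ _+ℚ_ (sumA-≡0 _ (linkTerm p) elems (λ q _ → link0 p q))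
                   (trans (cong₂ _+ℚ_ (zero0 p) (one0 p)) (ℚ.+-identityˡ 0ℚ))) (ℚ.+-identityˡ 0ℚ))
        where
        diff0 : ∀ {a b} → (a ≡ true → b ≡ true) → (b ≡ true → a ≡ true) → χ a +ℚ -1ℚ *ℚ χ b ≡ 0ℚ
        diff0 {true} f g rewrite f refl = refl
        diff0 {false} {false} f g = refl
        diff0 {false} {true} f g with () ← g refl
        link0 : ∀ p q → ⟦ linkTerm p q ⟧ᵇ (proj₁ F) ≡ 0ℚ
        link0 p q with coupled? p q
        ... | no _ = refl
        ... | yes (le , h) = diff0 (proj₂ F p q le) (All-∈ (λ e f x → trans (sym (e p)) (f (trans (e q) x))) h F F∈)
        zero0 : ∀ p → ⟦ zeroTerm p ⟧ᵇ (proj₁ F) ≡ 0ℚ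
        zero0 p with constant? false p
        ... | no _ = refl
        ... | yes h rewrite All-∈ {λ H → proj₁ H p ≡ false} (λ e f → trans (sym (e p)) f) h F F∈ = refl
        one0 : ∀ p → ⟦ oneTerm p ⟧ᵇ (proj₁ F) ≡ 0ℚ
        one0 p with constant? true p
        ... | no _ = refl
        ... | yes h rewrite All-∈ {λ H → proj₁ H p ≡ true} (λ e f → trans (sym (e p)) f) h F F∈ = refl

    module Tight (G : Filter P) (e : ⟦ exposing ⟧ᵇ (proj₁ G) ≡ 0ℚ) where
      private
        at : ∀ p → ⟦ term p ⟧ᵇ (proj₁ G) ≡ 0ℚ
        at p = sumA-≡0⁻ _ term elems (term≤0 G) e p (∈-elems p)
        at₁ : ∀ p → ⟦ sumA elems (linkTerm p) ⟧ᵇ (proj₁ G) ≡ 0ℚ × ⟦ zeroTerm p ⊞ oneTerm p ⟧ᵇ (proj₁ G) ≡ 0ℚ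
        at₁ p = nonpos-+≡0 (links≤0 G p) (nonpos-+ (zeroTerm≤0 G p) (oneTerm≤0 G p)) (at p)
        at₂ : ∀ p → ⟦ zeroTerm p ⟧ᵇ (proj₁ G) ≡ 0ℚ × ⟦ oneTerm p ⟧ᵇ (proj₁ G) ≡ 0ℚ
        at₂ p = nonpos-+≡0 (zeroTerm≤0 G p) (oneTerm≤0 G p) (proj₂ (at₁ p))
        at₃ : ∀ p q → ⟦ linkTerm p q ⟧ᵇ (proj₁ G) ≡ 0ℚ
        at₃ p q = sumA-≡0⁻ _ (linkTerm p) elems (linkTerm≤0 G p) (proj₁ (at₁ p)) q (∈-elems q)

      link : ∀ p q → _≼_ P p q → (∀ H → H O.∈ S → proj₁ H q ≡ true → proj₁ H p ≡ true) → proj₁ G q ≡ true → proj₁ G p ≡ true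
      link p q le h Gq with coupled? p q | at₃ p q
      ... | no n | _ = ⊥-elim (n (le , ∈-All S h))
      ... | yes _ | x rewrite Gq with proj₁ G p
      ...   | true = refl
      ...   | false with () ← x

      covered : ∀ p → proj₁ G p ≡ true → ¬ (∀ H → H O.∈ S → proj₁ H p ≡ false)
      covered p Gp h with constant? false p | proj₁ (at₂ p)
      ... | no n | _ = n (∈-All S h)
      ... | yes _ | x rewrite Gp with () ← x

      core : ∀ p → (∀ H → H O.∈ S → proj₁ H p ≡ true) → proj₁ G p ≡ true
      core p h with constant? true p | proj₂ (at₂ p)
      ... | no n | _ = ⊥-elim (n (∈-All S h))
      ... | yes _ | x with proj₁ G p
      ...   | true = refl
      ...   | false with () ← x

      comparable : ∀ F F' → F O.∈ S → F' O.∈ S → F ⊑ F' ⊎ F' ⊑ F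
      comparable F F' m m' with F O.≈? F'
      ... | yes e = inj₁ (λ p x → trans (sym (e p)) x)
      ... | no n = edge⇒comparable P {F} {F'} (O.clique-E c {F} {F'} m m' n)

      module Largest (Q : Filter P → Set) (Q? : ∀ F → Dec (Q F)) (Q-resp : ∀ {F F'} → F O.≈ F' → Q F → Q F') where
        largest : (Σ (Filter P) λ F → F O.∈ S × Q F × (∀ F' → F' O.∈ S → Q F' → F' ⊑ F)) ⊎ (∀ F → F O.∈ S → ¬ Q F)
        largest = Extremum.top _⊑_ (λ f g p x → g p (f p x)) Q Q? O._≈_ (λ _ → refl)
          (λ e f p x → f p (trans (sym (e p)) x)) (λ _ x → x) (λ {F} {F'} → Q-resp {F} {F'}) S comparable
        smallest : (Σ (Filter P) λ F → F O.∈ S × Q F × (∀ F' → F' O.∈ S → Q F' → F ⊑ F')) ⊎ (∀ F → F O.∈ S → ¬ Q F)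
        smallest = Extremum.top (λ F F' → F' ⊑ F) (λ f g p x → f p (g p x)) Q Q? O._≈_ (λ _ → refl)
          (λ e f p x → trans (e p) (f p x)) (λ _ x → x) (λ {F} {F'} → Q-resp {F} {F'}) S
          (λ F F' m m' → Data.Sum.swap (comparable F F' m m'))

      -- The largest member F̂ of S inside G equals G: otherwise let F be the least member of S containing a
      -- point of G outside F̂ and F₋ the next smaller member. The edge F₋ – F forces F = F₋ ∪ (G ∩ F), and
      -- then 1_F̂ + 1_F = 1_(G ∩ F) + 1_F₋ contradicts the edge F̂ – F.
      module Step (F̂ : Filter P) (F̂∈ : F̂ O.∈ S) (F̂⊑G : F̂ ⊑ G) (F̂-max : ∀ F' → F' O.∈ S → F' ⊑ G → F' ⊑ F̂) where
        Bad : Filter P → Set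
        Bad F = Σ (Carrier P) λ p → proj₁ F p ≡ true × proj₁ G p ≡ true × proj₁ F̂ p ≡ false

        bad? : ∀ F → Dec (Bad F)
        bad? F = anyC? (λ p → (proj₁ F p ≟B true) ×-dec ((proj₁ G p ≟B true) ×-dec (proj₁ F̂ p ≟B false)))

        module Worst (F : Filter P) (F∈ : F O.∈ S) (bad : Bad F) (F-min : ∀ F' → F' O.∈ S → Bad F' → F ⊑ F') where
          p = proj₁ bad
          Fp = proj₁ (proj₂ bad)
          Gp = proj₁ (proj₂ (proj₂ bad))
          F̂p = proj₂ (proj₂ (proj₂ bad))

          F̂⊑F : F̂ ⊑ F
          F̂⊑F with comparable F̂ F F̂∈ F∈
          ... | inj₁ s = s
          ... | inj₂ s = ⊥-elim (true≢false (s p Fp) F̂p)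

          F̂≉F : ¬ (F̂ O.≈ F)
          F̂≉F e = true≢false (trans (e p) Fp) F̂p

          Below : Filter P → Set
          Below F' = F' ⊑ F × ¬ (F' O.≈ F)

          below? : ∀ F' → Dec (Below F')
          below? F' = ⊑? F' F ×-dec ¬? (F' O.≈? F)

          module Prev (F₋ : Filter P) (F₋∈ : F₋ O.∈ S) (below : Below F₋) (F₋-max : ∀ F' → F' O.∈ S → Below F' → F' ⊑ F₋) where
            F̂⊑F₋ : F̂ ⊑ F₋
            F̂⊑F₋ = F₋-max F̂ F̂∈ (F̂⊑F , F̂≉F)

            G∩F₋⊑F̂ : ∀ q → proj₁ G q ≡ true → proj₁ F₋ q ≡ true → proj₁ F̂ q ≡ true
            G∩F₋⊑F̂ q Gq F₋q with proj₁ F̂ q in F̂q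
            ... | true = refl
            ... | false = ⊥-elim (proj₂ below (⊑-antisym {F₋} {F} (proj₁ below) (F-min F₋ F₋∈ (q , F₋q , Gq , F̂q))))

            H₁ H₂ : Filter P
            H₁ = join P F₋ (meet P G F)
            H₂ = (λ q → proj₁ F₋ q ∨ (proj₁ F q ∧ not (proj₁ G q))) , closed
              where
              closed : IsFilter P (λ q → proj₁ F₋ q ∨ (proj₁ F q ∧ not (proj₁ G q)))
              closed x y le h with proj₁ F₋ x in F₋x | proj₁ F₋ y in F₋y
              ... | _ | true = refl
              ... | true | false = ⊥-elim (true≢false (proj₂ F₋ x y le F₋x) F₋y)
              ... | false | false with proj₁ F x in Fx | proj₁ G x in Gx | proj₁ G y in Gy
              ...   | true | false | false rewrite proj₂ F x y le Fx = refl
              -- A member of `S` containing `y` is not inside `F₋`, so it contains `F` and with it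
              -- `x`. Hence the inequality between `x` and `y` is an equality on `S`, and `G` cannot
              -- separate them.
              ...   | true | false | true = ⊥-elim (true≢false (link x y le same Gy) Gx)
                where
                same : ∀ H → H O.∈ S → proj₁ H y ≡ true → proj₁ H x ≡ true
                same H H∈ Hy with comparable F H F∈ H∈
                ... | inj₁ s = s x Fx
                ... | inj₂ s with H O.≈? F
                ...   | yes e = trans (e x) Fx
                ...   | no n = ⊥-elim (true≢false (F₋-max H H∈ (s , n) y Hy) F₋y)

            swap₁ : ∀ q → Swap (proj₁ F₋ q) (proj₁ F q) (proj₁ H₁ q) (proj₁ H₂ q)
            swap₁ q with proj₁ F₋ q in F₋q | proj₁ F q in Fq | proj₁ G q
            ... | true | true | _ = inj₁ (refl , refl)
            ... | true | false | _ = ⊥-elim (true≢false (proj₁ below q F₋q) Fq)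
            ... | false | false | true = inj₁ (refl , refl)
            ... | false | false | false = inj₁ (refl , refl)
            ... | false | true | true = inj₂ (refl , refl)
            ... | false | true | false = inj₁ (refl , refl)

            F⊑F₋∪G : ∀ q → proj₁ F q ≡ true → proj₁ F₋ q ≡ false → proj₁ G q ≡ true
            F⊑F₋∪G q Fq F₋q with proj₂ (O.clique-E c {F₋} {F} F₋∈ F∈ (proj₂ below)) H₁ H₂ swap₁
            ... | inj₁ (x , _) = ⊥-elim (absurd (x p))
              where
              absurd : ¬ (proj₁ H₁ p ≡ proj₁ F₋ p)
              absurd x with proj₁ F₋ p in F₋p | proj₁ F p | Fp | proj₁ G p in G' 
              ... | true | _ | _ | _ = true≢false (G∩F₋⊑F̂ p Gp F₋p) F̂p
              ... | false | true | refl | false = true≢false Gp G'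
              ... | false | true | refl | true with () ← x
            ... | inj₂ (x , _) with proj₁ F₋ q | proj₁ F q | proj₁ G q | x q
            ...   | false | true | true | _ = refl
            ...   | false | true | false | y with () ← trans y Fq

            -- Otherwise `F` would lie in the union of `F̂` and `G`, hence inside `G`, against the
            -- choice of `F̂`.
            F₋≉F̂ : ¬ (F₋ O.≈ F̂)
            F₋≉F̂ x = true≢false (F̂-max F F∈ F⊑G p Fp) F̂p
              where
              F⊑G : F ⊑ G
              F⊑G q Fq with proj₁ F₋ q in F₋q
              ... | true = F̂⊑G q (trans (sym (x q)) F₋q)
              ... | false = F⊑F₋∪G q Fq F₋q

            swap₂ : ∀ q → Swap (proj₁ F̂ q) (proj₁ F q) (proj₁ (meet P G F) q) (proj₁ F₋ q)
            swap₂ q with proj₁ F̂ q in F̂q | proj₁ F q in Fq | proj₁ F₋ q in F₋q | proj₁ G q in Gq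
            ... | true | true | true | true = inj₁ (refl , refl)
            ... | true | false | _ | _ = ⊥-elim (true≢false (F̂⊑F q F̂q) Fq)
            ... | true | _ | false | _ = ⊥-elim (true≢false (F̂⊑F₋ q F̂q) F₋q)
            ... | true | _ | _ | false = ⊥-elim (true≢false (F̂⊑G q F̂q) Gq)
            ... | false | false | true | _ = ⊥-elim (true≢false (proj₁ below q F₋q) Fq)
            ... | false | false | false | true = inj₁ (refl , refl)
            ... | false | false | false | false = inj₁ (refl , refl)
            ... | false | true | true | true = ⊥-elim (true≢false (G∩F₋⊑F̂ q Gq F₋q) F̂q)
            ... | false | true | true | false = inj₁ (refl , refl)
            ... | false | true | false | true = inj₂ (refl , refl)
            ... | false | true | false | false = ⊥-elim (true≢false (F⊑F₋∪G q Fq F₋q) Gq)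

            contradictory : ⊥
            contradictory with proj₂ (O.clique-E c {F̂} {F} F̂∈ F∈ F̂≉F) (meet P G F) F₋ swap₂
            ... | inj₁ (_ , x) = proj₂ below x
            ... | inj₂ (_ , x) = F₋≉F̂ x

          no-worst : ⊥
          no-worst with Largest.largest Below below? (λ { x (s , n) → (λ q y → s q (trans (x q) y)) , λ y → n (λ q → trans (x q) (y q)) })
          ... | inj₂ none = none F̂ F̂∈ (F̂⊑F , F̂≉F)
          ... | inj₁ (F₋ , F₋∈ , below , mx) = Prev.contradictory F₋ F₋∈ below mx

        equal : G O.≈ F̂
        equal = ⊑-antisym {G} {F̂} inside F̂⊑G
          where
          inside : G ⊑ F̂
          inside p Gp with proj₁ F̂ p in F̂p
          ... | true = refl
          ... | false with Largest.smallest Bad bad? (λ { x (q , y , z) → q , trans (sym (x q)) y , z })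
          ...   | inj₁ (F , F∈ , bad , mn) = ⊥-elim (Worst.no-worst F F∈ bad mn)
          ...   | inj₂ none = ⊥-elim (covered p Gp (λ H H∈ → ¬true⇒false (λ Hp → none H H∈ (p , Hp , Gp , F̂p))))

      -- A nonempty `S` has a least member, whose points are common to all of `S` and so belong to
      -- `G` by `core`. Thus some member lies inside `G`, and the largest such equals `G` by `Step`.
      member : ∀ H → H O.∈ S → G O.∈ S
      member H H∈ with Largest.smallest (λ _ → ⊤) (λ _ → yes tt) (λ _ _ → tt)
      ... | inj₂ none = ⊥-elim (none H H∈ tt)
      ... | inj₁ (m , m∈ , _ , mn) with Largest.largest (_⊑ G) (λ F → ⊑? F G) (λ x s q y → s q (trans (x q) y))
      ...   | inj₂ none = ⊥-elim (none m m∈ (λ p mp → core p (λ K K∈ → mn K K∈ tt p mp)))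
      ...   | inj₁ (F̂ , F̂∈ , F̂⊑G , mx) = O.∈-resp {F̂} {G} (λ q → sym (Step.equal F̂ F̂∈ F̂⊑G mx q)) F̂∈

  record Exposed (S : List (Filter P)) : Set where
    field
      face  : Aff (Carrier P)
      face≤ : ∀ (F : Filter P) → ⟦ face ⟧ᵇ (proj₁ F) ≤ℚ 0ℚ
      face→ : ∀ (F : Filter P) → ⟦ face ⟧ᵇ (proj₁ F) ≡ 0ℚ → F O.∈ S
      face← : ∀ (F : Filter P) → F O.∈ S → ⟦ face ⟧ᵇ (proj₁ F) ≡ 0ℚ

  expose : ∀ S → O.IsClique S → Exposed S
  -- The empty face needs a function that is negative everywhere; the sum of inequalities would
  -- vanish on the empty poset.
  expose [] c = record { face = con -1ℚ ; face≤ = λ _ → toWitness {a? = -1ℚ ℚ.≤? 0ℚ} _ ; face→ = λ _ () ; face← = λ _ () }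
  expose S@(H ∷ _) c = record { face = exposing S c ; face≤ = exposing≤0 S c
                              ; face→ = λ F e → Tight.member S c F e H (here (λ _ → refl)) ; face← = tight S c }

-- X-free posets

module _ {C D : Set} (x : C → ℚ) (f : D → Aff C) where
  sumA-one : ∀ {ds} → Unique ds → ∀ d → Any (d ≡_) ds → ⟦ f d ⟧ x ≡ 1ℚ → (∀ c → c ≢ d → ⟦ f c ⟧ x ≡ 0ℚ) → ⟦ sumA ds f ⟧ x ≡ 1ℚ
  sumA-one {d ∷ ds} (n ∷ u) d (here refl) one others =
    trans (cong₂ _+ℚ_ one (sumA-≡0 x f ds (λ c m → others c (λ { refl → lookupAll n m refl })))) (ℚ.+-identityʳ 1ℚ)
  sumA-one {c ∷ ds} (n ∷ u) d (there m) one others =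
    trans (cong₂ _+ℚ_ (others c (λ { refl → lookupAll n m refl })) (sumA-one u d m one others)) (ℚ.+-identityˡ 1ℚ)

module Extremal (P : FinPoset) (_≤?_ : DecOrder P) where
  open Elements P

  module _ (R : Carrier P → Carrier P → Set) (R? : ∀ p q → Dec (R p q)) (R-refl : ∀ {p} → R p p)
           (R-trans : ∀ {p q t} → R p q → R q t → R p t) (R-antisym : ∀ {p q} → R p q → R q p → p ≡ q)
           {D : Carrier P → Set} (D? : ∀ p → Dec (D p)) where

    extremal : ∀ p → D p → Σ (Carrier P) λ q → R q p × D q × (∀ t → R t q → D t → t ≡ q)
    extremal p Dp = let (q , le , Dq , mn) = go elems p Dp in q , le , Dq , λ t → mn t (∈-elems t)
      where
      go : ∀ xs p → D p → Σ (Carrier P) λ q → R q p × D q × (∀ t → Any (t ≡_) xs → R t q → D t → t ≡ q)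
      go [] p Dp = p , R-refl , Dp , λ _ ()
      go (x ∷ xs) p Dp with R? x p ×-dec D? x
      ... | yes (le , Dx) with go xs x Dx
      ...   | q , le' , Dq , mn = q , R-trans le' le , Dq , λ { t (here refl) t≤q _ → R-antisym t≤q le' ; t (there m) → mn t m }
      go (x ∷ xs) p Dp | no n with go xs p Dp
      ...   | q , le' , Dq , mn = q , le' , Dq , λ { t (here refl) t≤q Dt → ⊥-elim (n (R-trans t≤q le' , Dt)) ; t (there m) → mn t m }

  minimal : {D : Carrier P → Set} → (∀ p → Dec (D p)) → ∀ p → D p → Σ (Carrier P) λ q → _≼_ P q p × D q × (∀ t → _≼_ P t q → D t → t ≡ q)
  minimal = extremal (_≼_ P) _≤?_ ≼-refl ≼-trans ≼-antisym

  maximal : {D : Carrier P → Set} → (∀ p → Dec (D p)) → ∀ p → D p → Σ (Carrier P) λ q → _≼_ P p q × D q × (∀ t → _≼_ P q t → D t → t ≡ q)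
  maximal = extremal (λ p q → _≼_ P q p) (λ p q → q ≤? p) ≼-refl (λ x y → ≼-trans y x) (λ x y → ≼-antisym y x)

module XFreeBounds (P : FinPoset) (_≤?_ : DecOrder P) (x-free : XFree P) where
  open Elements P
  open Extremal P _≤?_
  private
    module O = Cliques (OG P)
    module A = Cliques (AG P)

  -- Branching elements form an up-set. Below an element that does not branch lies a chain by
  -- definition; above one that does lies a chain because `X` is excluded. This chooses for each
  -- coordinate the direction in which sums are taken.
  Branching : Carrier P → Set
  Branching p = Σ (Carrier P) λ a → Σ (Carrier P) λ b → (_≼_ P a p × _≼_ P b p) × (¬ _≼_ P a b × ¬ _≼_ P b a)

  abstract
    branching? : ∀ p → Dec (Branching p)
    branching? p = anyC? (λ a → anyC? (λ b → ((a ≤? p) ×-dec (b ≤? p)) ×-dec ((¬? (a ≤? b)) ×-dec (¬? (b ≤? a)))))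

  branching-up : ∀ {p q} → _≼_ P p q → Branching p → Branching q
  branching-up le (a , b , (x , y) , n) = a , b , (≼-trans x le , ≼-trans y le) , n

  below-chain : ∀ {p} → ¬ Branching p → ∀ a b → _≼_ P a p → _≼_ P b p → _≼_ P a b ⊎ _≼_ P b a
  below-chain n a b x y with a ≤? b | b ≤? a
  ... | yes le | _ = inj₁ le
  ... | no _ | yes le = inj₂ le
  ... | no u | no v = ⊥-elim (n (a , b , (x , y) , (u , v)))

  abstract
    ≤X-antisym : ∀ i j → i ≤X j → j ≤X i → i ≡ j
    ≤X-antisym = toWitness {a? = all? λ i → all? λ j → T? (xle i j) →-dec (T? (xle j i) →-dec (i ≟F j))} _

  above-chain : ∀ {p} → Branching p → ∀ d e → _≼_ P p d → _≼_ P p e → _≼_ P d e ⊎ _≼_ P e d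
  above-chain {c} (a , b , (a≤c , b≤c) , (a≰b , b≰a)) d e c≤d c≤e with d ≤? e | e ≤? d
  ... | yes le | _ = inj₁ le
  ... | no _ | yes le = inj₂ le
  ... | no d≰e | no e≰d = ⊥-elim (x-free (f , (λ i j x → ≤X-antisym i j (proj₁ (iff i j) (≡⇒≼ x)) (proj₁ (iff j i) (≡⇒≼ (sym x)))) , iff))
    where
    ≡⇒≼ : ∀ {p q} → p ≡ q → _≼_ P p q
    ≡⇒≼ refl = ≼-refl
    f : Fin 5 → Carrier P
    f 0F = a
    f 1F = b
    f 2F = c
    f 3F = d
    f 4F = e
    c≰a : ¬ _≼_ P c a
    c≰a x = b≰a (≼-trans b≤c x)
    c≰b : ¬ _≼_ P c b
    c≰b x = a≰b (≼-trans a≤c x)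
    d≰c : ¬ _≼_ P d c
    d≰c x = d≰e (≼-trans x c≤e)
    e≰c : ¬ _≼_ P e c
    e≰c x = e≰d (≼-trans x c≤d)
    iff : ∀ i j → (_≼_ P (f i) (f j) → i ≤X j) × (i ≤X j → _≼_ P (f i) (f j))
    iff 0F 0F = (λ _ → tt) , λ _ → ≼-refl
    iff 0F 1F = a≰b , λ ()
    iff 0F 2F = (λ _ → tt) , λ _ → a≤c
    iff 0F 3F = (λ _ → tt) , λ _ → ≼-trans a≤c c≤d
    iff 0F 4F = (λ _ → tt) , λ _ → ≼-trans a≤c c≤e
    iff 1F 0F = b≰a , λ ()
    iff 1F 1F = (λ _ → tt) , λ _ → ≼-refl
    iff 1F 2F = (λ _ → tt) , λ _ → b≤c
    iff 1F 3F = (λ _ → tt) , λ _ → ≼-trans b≤c c≤d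
    iff 1F 4F = (λ _ → tt) , λ _ → ≼-trans b≤c c≤e
    iff 2F 0F = c≰a , λ ()
    iff 2F 1F = c≰b , λ ()
    iff 2F 2F = (λ _ → tt) , λ _ → ≼-refl
    iff 2F 3F = (λ _ → tt) , λ _ → c≤d
    iff 2F 4F = (λ _ → tt) , λ _ → c≤e
    iff 3F 0F = (λ x → c≰a (≼-trans c≤d x)) , λ ()
    iff 3F 1F = (λ x → c≰b (≼-trans c≤d x)) , λ ()
    iff 3F 2F = d≰c , λ ()
    iff 3F 3F = (λ _ → tt) , λ _ → ≼-refl
    iff 3F 4F = d≰e , λ ()
    iff 4F 0F = (λ x → c≰a (≼-trans c≤e x)) , λ ()
    iff 4F 1F = (λ x → c≰b (≼-trans c≤e x)) , λ ()
    iff 4F 2F = e≰c , λ ()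
    iff 4F 3F = e≰d , λ ()
    iff 4F 4F = (λ _ → tt) , λ _ → ≼-refl

  -- On non-branching elements this is the filter generated by `A`, on branching ones the complement
  -- of the ideal generated by `A`.
  InΦ : Vtx P → Carrier P → Set
  InΦ A p = (¬ Branching p × Σ (Carrier P) λ q → _≼_ P q p × A q ≡ true) ⊎ (Branching p × ¬ (Σ (Carrier P) λ q → _≼_ P p q × A q ≡ true))

  abstract
    inΦ? : ∀ A p → Dec (InΦ A p)
    inΦ? A p = (¬? (branching? p) ×-dec anyC? (λ q → (q ≤? p) ×-dec (A q ≟B true))) ⊎-dec
               (branching? p ×-dec ¬? (anyC? (λ q → (p ≤? q) ×-dec (A q ≟B true))))

  Φ : Anti P → Filter P
  Φ (A , anti) = (λ p → does (inΦ? A p)) , λ p q le e → dec-true (inΦ? A q) (upward p q le (true⇒ (inΦ? A p) e))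
    where
    upward : ∀ p q → _≼_ P p q → InΦ A p → InΦ A q
    upward p q le (inj₁ (n , t , t≤p , At)) with branching? q
    ... | no m = inj₁ (m , t , ≼-trans t≤p le , At)
    -- Elements `t ≤ p ≤ q ≤ s` with `t` and `s` in `A` force `t = s`, so `q ≤ p` and `p` would
    -- branch like `q`.
    ... | yes m = inj₂ (m , λ { (s , q≤s , As) → n (branching-up (≼-trans (subst (λ z → _≼_ P q z) (sym (anti t s At As (≼-trans t≤p (≼-trans le q≤s)))) q≤s) t≤p) m) })
    upward p q le (inj₂ (m , none)) = inj₂ (branching-up le m , λ { (s , q≤s , As) → none (s , ≼-trans le q≤s , As) })

  -- The inverse of `Φ`: minimal elements of the filter that do not branch, and maximal elements of
  -- its complement that do.
  InΨ : Vtx P → Carrier P → Set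
  InΨ F p = (¬ Branching p × F p ≡ true × (∀ q → _≼_ P q p → F q ≡ true → q ≡ p)) ⊎
            (Branching p × F p ≡ false × (∀ q → _≼_ P p q → F q ≡ false → q ≡ p))

  abstract
    inΨ? : ∀ F p → Dec (InΨ F p)
    inΨ? F p = (¬? (branching? p) ×-dec ((F p ≟B true) ×-dec allC? (λ q → (q ≤? p) →-dec ((F q ≟B true) →-dec (q ≟C p))))) ⊎-dec
               (branching? p ×-dec ((F p ≟B false) ×-dec allC? (λ q → (p ≤? q) →-dec ((F q ≟B false) →-dec (q ≟C p)))))

  Ψ : Filter P → Anti P
  Ψ (F , up) = (λ p → does (inΨ? F p)) , λ p q e e' le → anti p q (true⇒ (inΨ? F p) e) (true⇒ (inΨ? F q) e') le
    where
    anti : ∀ p q → InΨ F p → InΨ F q → _≼_ P p q → p ≡ q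
    anti p q (inj₁ (_ , Fp , _)) (inj₁ (_ , _ , mn)) le = mn p le Fp
    anti p q (inj₁ (_ , Fp , _)) (inj₂ (_ , Fq , _)) le = ⊥-elim (true≢false (up p q le Fp) Fq)
    anti p q (inj₂ (m , _)) (inj₁ (n , _)) le = ⊥-elim (n (branching-up le m))
    anti p q (inj₂ (_ , _ , mx)) (inj₂ (_ , Fq , _)) le = sym (mx q le Fq)

  Φ-cong : ∀ {A B} → A A.≈ B → Φ A O.≈ Φ B
  Φ-cong {A , _} {B , _} e p = ≡-by-true (λ x → dec-true (inΦ? B p) (conv e (true⇒ (inΦ? A p) x))) (λ x → dec-true (inΦ? A p) (conv (λ q → sym (e q)) (true⇒ (inΦ? B p) x)))
    where
    conv : ∀ {A B : Vtx P} → _≗ᵛ_ P A B → InΦ A p → InΦ B p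
    conv e (inj₁ (n , q , le , x)) = inj₁ (n , q , le , trans (sym (e q)) x)
    conv e (inj₂ (m , none)) = inj₂ (m , λ { (q , le , x) → none (q , le , trans (e q) x) })

  Ψ-cong : ∀ {F G} → F O.≈ G → Ψ F A.≈ Ψ G
  Ψ-cong {F , _} {G , _} e p = ≡-by-true (λ x → dec-true (inΨ? G p) (conv e (true⇒ (inΨ? F p) x))) (λ x → dec-true (inΨ? F p) (conv (λ q → sym (e q)) (true⇒ (inΨ? G p) x)))
    where
    conv : ∀ {F G : Vtx P} → _≗ᵛ_ P F G → InΨ F p → InΨ G p
    conv e (inj₁ (n , x , mn)) = inj₁ (n , trans (sym (e p)) x , λ q le y → mn q le (trans (e q) y))
    conv e (inj₂ (n , x , mn)) = inj₂ (n , trans (sym (e p)) x , λ q le y → mn q le (trans (e q) y))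

  ΦΨ : ∀ F → Φ (Ψ F) O.≈ F
  ΦΨ (F , up) p = ≡-by-true (λ x → forth (true⇒ (inΦ? A p) x)) (λ Fp → dec-true (inΦ? A p) (back Fp))
    where
    A = proj₁ (Ψ (F , up))
    forth : InΦ A p → F p ≡ true
    forth (inj₁ (n , q , le , Aq)) with true⇒ (inΨ? F q) Aq
    ... | inj₁ (_ , Fq , _) = up q p le Fq
    ... | inj₂ (m , _) = ⊥-elim (n (branching-up le m))
    forth (inj₂ (m , none)) with F p in Fp
    ... | true = refl
    ... | false with maximal (λ q → F q ≟B false) p Fp
    ...   | q , le , Fq , mx = ⊥-elim (none (q , le , dec-true (inΨ? F q) (inj₂ (branching-up le m , Fq , mx))))
    back : F p ≡ true → InΦ A p
    back Fp with branching? p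
    ... | no n with minimal (λ q → F q ≟B true) p Fp
    ...   | q , le , Fq , mn = inj₁ (n , q , le , dec-true (inΨ? F q) (inj₁ ((λ m → n (branching-up le m)) , Fq , mn)))
    back Fp | yes m = inj₂ (m , λ { (q , le , Aq) → [ (λ { (n , _) → n (branching-up le m) }) , (λ { (_ , Fq , _) → true≢false (up p q le Fp) Fq }) ]′ (true⇒ (inΨ? F q) Aq) })

  ΨΦ : ∀ A → Ψ (Φ A) A.≈ A
  ΨΦ (A , anti) p = ≡-by-true (λ x → forth (true⇒ (inΨ? F p) x)) (λ Ap → dec-true (inΨ? F p) (back Ap))
    where
    F = proj₁ (Φ (A , anti))
    forth : InΨ F p → A p ≡ true
    forth (inj₁ (n , Fp , mn)) with true⇒ (inΦ? A p) Fp
    ... | inj₂ (m , _) = ⊥-elim (n m)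
    ... | inj₁ (_ , q , le , Aq) = subst (λ z → A z ≡ true) (mn q le (dec-true (inΦ? A q) (inj₁ ((λ m → n (branching-up le m)) , q , ≼-refl , Aq)))) Aq
    forth (inj₂ (m , Fp , mx)) with anyC? (λ q → (p ≤? q) ×-dec (A q ≟B true))
    ... | no none = ⊥-elim (false⇒ (inΦ? A p) Fp (inj₂ (m , none)))
    ... | yes (q , le , Aq) = subst (λ z → A z ≡ true) (mx q le (dec-false (inΦ? A q) λ { (inj₁ (n , _)) → n (branching-up le m) ; (inj₂ (_ , none)) → none (q , ≼-refl , Aq) })) Aq
    back : A p ≡ true → InΨ F p
    back Ap with branching? p
    ... | no n = inj₁ (n , dec-true (inΦ? A p) (inj₁ (n , p , ≼-refl , Ap)) , least)
      where
      least : ∀ q → _≼_ P q p → F q ≡ true → q ≡ p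
      least q le Fq with true⇒ (inΦ? A q) Fq
      ... | inj₂ (m , _) = ⊥-elim (n (branching-up le m))
      ... | inj₁ (_ , t , t≤q , At) = ≼-antisym le (subst (λ z → _≼_ P z q) (anti t p At Ap (≼-trans t≤q le)) t≤q)
    ... | yes m = inj₂ (m , dec-false (inΦ? A p) (λ { (inj₁ (n , _)) → n m ; (inj₂ (_ , none)) → none (p , ≼-refl , Ap) }) , greatest)
      where
      greatest : ∀ q → _≼_ P p q → F q ≡ false → q ≡ p
      greatest q le Fq with anyC? (λ t → (q ≤? t) ×-dec (A t ≟B true))
      ... | no none = ⊥-elim (false⇒ (inΦ? A q) Fq (inj₂ (branching-up le m , none)))
      ... | yes (t , q≤t , At) = ≼-antisym (subst (λ z → _≼_ P q z) (sym (anti p t Ap At (≼-trans le q≤t))) q≤t) le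

  -- Sums along the chains, inverse to the passage to differences, with `1` minus the sum where the
  -- chain lies above. Substituting them pulls functions on `O(P)` back to `C(P)`.
  coordinate : Carrier P → Aff (Carrier P)
  coordinate p with branching? p
  ... | no _ = sumA elems (λ q → guard (q ≤? p) (var q))
  ... | yes _ = con 1ℚ ⊞ -1ℚ ⊠ sumA elems (λ q → guard (p ≤? q) (var q))

  -- An antichain meets the chain below (above) p at most once, so the indicator of Φ is affine.
  count : ∀ (A : Anti P) {R : Carrier P → Set} (R? : ∀ q → Dec (R q)) → (∀ a b → R a → R b → _≼_ P a b ⊎ _≼_ P b a) →
          (d : Dec (Σ (Carrier P) λ q → R q × proj₁ A q ≡ true)) → ⟦ sumA elems (λ q → guard (R? q) (var q)) ⟧ᵇ (proj₁ A) ≡ χ (does d)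
  count (A , anti) {R} R? total (yes (q , Rq , Aq)) = sumA-one _ _ elems-unique q (∈-elems q) one others
    where
    one : ⟦ guard (R? q) (var q) ⟧ᵇ A ≡ 1ℚ
    one with R? q
    ... | yes _ = cong χ Aq
    ... | no n = ⊥-elim (n Rq)
    others : ∀ c → c ≢ q → ⟦ guard (R? c) (var c) ⟧ᵇ A ≡ 0ℚ
    others c n with R? c
    ... | no _ = refl
    ... | yes Rc = cong χ (¬true⇒false (λ Ac → n ([ anti c q Ac Aq , (λ le → sym (anti q c Aq Ac le)) ]′ (total c q Rc Rq))))
  count (A , anti) {R} R? total (no none) = sumA-≡0 _ _ elems zeros
    where
    zeros : ∀ c → Any (c ≡_) elems → ⟦ guard (R? c) (var c) ⟧ᵇ A ≡ 0ℚ
    zeros c _ with R? c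
    ... | no _ = refl
    ... | yes Rc = cong χ (¬true⇒false (λ Ac → none (c , Rc , Ac)))

  coordinate-Φ : ∀ A p → ⟦ coordinate p ⟧ᵇ (proj₁ A) ≡ χ (proj₁ (Φ A) p)
  coordinate-Φ (A , anti) p with branching? p
  ... | no n = trans (count (A , anti) (λ q → q ≤? p) (λ a b → below-chain n a b) d) (cong χ bool)
    where
    d = anyC? (λ q → (q ≤? p) ×-dec (A q ≟B true))
    bool : does d ≡ does (inΦ? A p)
    bool = ≡-by-true (λ x → dec-true (inΦ? A p) (inj₁ (n , true⇒ d x)))
                     (λ x → dec-true d ([ proj₂ , (λ { (m , _) → ⊥-elim (n m) }) ]′ (true⇒ (inΦ? A p) x)))
  ... | yes m = trans (cong (λ z → 1ℚ +ℚ -1ℚ *ℚ z) (count (A , anti) (λ q → p ≤? q) (λ a b → above-chain m a b) d)) (flip (does d) (does (inΦ? A p)) f g)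
    where
    d = anyC? (λ q → (p ≤? q) ×-dec (A q ≟B true))
    f : does d ≡ true → does (inΦ? A p) ≡ false
    f x = dec-false (inΦ? A p) (λ { (inj₁ (n , _)) → n m ; (inj₂ (_ , none)) → none (true⇒ d x) })
    g : does d ≡ false → does (inΦ? A p) ≡ true
    g x = dec-true (inΦ? A p) (inj₂ (m , false⇒ d x))
    flip : ∀ a b → (a ≡ true → b ≡ false) → (a ≡ false → b ≡ true) → 1ℚ +ℚ -1ℚ *ℚ χ a ≡ χ b
    flip true b f g rewrite f refl = refl
    flip false b f g rewrite g refl = refl

  pullback : ∀ e A → ⟦ sub coordinate e ⟧ᵇ (proj₁ A) ≡ ⟦ e ⟧ᵇ (proj₁ (Φ A))
  pullback e A = trans (⟦sub⟧ coordinate e _) (⟦⟧-cong e (coordinate-Φ A))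

  open Exposing P _≤?_ using (expose; module Exposed)

  Ψ-inj : ∀ {F G} → Ψ F A.≈ Ψ G → F O.≈ G
  Ψ-inj {F} {G} e p = trans (sym (ΦΨ F p)) (trans (Φ-cong {Ψ F} {Ψ G} e p) (ΦΨ G p))

  module T = Transport (AG P) (OG P) Ψ (λ {F} {G} → Ψ-cong {F} {G}) (λ {F} {G} → Ψ-inj {F} {G})

  Φ-∈ : ∀ {S} A → A A.∈ map Ψ S → Φ A O.∈ S
  Φ-∈ {S} A m with T.map-∈⁻ {A} S m
  ... | F , F∈ , e = O.∈-resp {F} {Φ A} (λ p → sym (trans (Φ-cong {A} {Ψ F} e p) (ΦΨ F p))) F∈

  Φ-∈⁻ : ∀ {S} A → Φ A O.∈ S → A A.∈ map Ψ S
  Φ-∈⁻ A m = A.∈-resp {Ψ (Φ A)} {A} (ΨΦ A) (T.map-∈ {Φ A} m)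

  -- Every clique is exposed in `O(P)`, and a clique without one of its vertices is again a clique:
  -- the function exposing the rest is the dual function of the vertex removed.
  cliqueSimp : El O.Cl → Simp P
  cliqueSimp (S , c) = record
    { pts = map Ψ S
    ; uniq = T.map-clique (λ F G _ _ n e → proj₁ n (Ψ-inj {F} {G} e)) c
    ; face = sub coordinate X.face
    ; face≤ = λ A → subst (_≤ℚ 0ℚ) (sym (pullback X.face A)) (X.face≤ (Φ A))
    ; face→ = λ A e → Φ-∈⁻ A (X.face→ (Φ A) (trans (sym (pullback X.face A)) e))
    ; face← = λ A m → trans (pullback X.face A) (X.face← (Φ A) (Φ-∈ A m))
    ; dual = dual' }
    where
    module X = Exposed (expose S c)
    dual' : ∀ (A : Anti P) → A A.∈ map Ψ S → Σ (Aff (Carrier P)) λ u →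
            ⟦ u ⟧ᵇ (proj₁ A) ≢ 0ℚ × (∀ B → B A.∈ map Ψ S → ¬ (B A.≈ A) → ⟦ u ⟧ᵇ (proj₁ B) ≡ 0ℚ)
    dual' A m = sub coordinate Y.face , (λ e → O.link-∉ {Φ A} R.link (Y.face→ (Φ A) (trans (sym (pullback Y.face A)) e))) , others
      where
      R' = O.extract {Φ A} c (Φ-∈ A m)
      module R = O.Extract R'
      module Y = Exposed (expose R.rest R.clique)
      others : ∀ B → B A.∈ map Ψ S → ¬ (B A.≈ A) → ⟦ sub coordinate Y.face ⟧ᵇ (proj₁ B) ≡ 0ℚ
      others B m' n = [ (λ e → ⊥-elim (n (λ p → trans (sym (ΨΦ B p)) (trans (Ψ-cong {Φ B} {Φ A} e p) (ΨΦ A p)))))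
                      , (λ k → trans (pullback Y.face B) (Y.face← (Φ B) k)) ]′ (R.split {Φ B} (Φ-∈ B m'))

  simplices : O.Cl ↪ Simps P
  fun simplices = cliqueSimp
  inj simplices (S , _) (S' , _) e = T.map-~⁻ {S} {S'} e
  deg≡ simplices (S , _) = length-map Ψ S

  avoiding : O.Avoid (Φ (∅ P)) ↪ Simps∌∅ P
  fun avoiding (S , c , n) = cliqueSimp (S , c) , λ m → n (Φ-∈ (∅ P) m)
  inj avoiding (S , _) (S' , _) e = T.map-~⁻ {S} {S'} e
  deg≡ avoiding (S , _) = length-map Ψ S

  -- `Φ (∅ P)` is the vertex of `O(P)` matching the origin. `Link↪Avoid` compares the link of any
  -- vertex with the cliques avoiding any vertex, so neither base has to be the one matching the
  -- origin.
  xfree-bounds : Bounds P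
  xfree-bounds = record { simplices = simplices ; links = λ b → O.Link↪Avoid (base P b) (Φ (∅ P)) ⨾ avoiding }

-- Finite sums of rationals

a≡a+b-b : ∀ a b → a ≡ (a +ℚ b) +ℚ - b
a≡a+b-b = solve 2 (λ a b → a := ((a :+ b) :+ (:- b))) refl

b≡-a+[a+b] : ∀ a b → b ≡ - a +ℚ (a +ℚ b)
b≡-a+[a+b] = solve 2 (λ a b → b := ((:- a) :+ (a :+ b))) refl

a≡a-b+b : ∀ a b → a ≡ (a +ℚ - b) +ℚ b
a≡a-b+b = solve 2 (λ a b → a := ((a :+ (:- b)) :+ b)) refl

b≡a-[a-b] : ∀ a b → b ≡ a +ℚ - (a +ℚ - b)
b≡a-[a-b] = solve 2 (λ a b → b := (a :+ (:- (a :+ (:- b))))) refl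

*-exchange : ∀ a b c → a *ℚ (b *ℚ c) ≡ b *ℚ (a *ℚ c)
*-exchange = solve 3 (λ a b c → (a :* (b :* c)) := (b :* (a :* c))) refl

sumF-cong : ∀ {n} {f g : Fin n → ℚ} → (∀ i → f i ≡ g i) → sumF f ≡ sumF g
sumF-cong {zero} h = refl
sumF-cong {suc n} h = cong₂ _+ℚ_ (h zero) (sumF-cong (λ i → h (suc i)))

sumF-+ : ∀ {n} (f g : Fin n → ℚ) → sumF (λ i → f i +ℚ g i) ≡ sumF f +ℚ sumF g
sumF-+ {zero} f g = sym (ℚ.+-identityˡ 0ℚ)
sumF-+ {suc n} f g = trans (cong (f zero +ℚ g zero +ℚ_) (sumF-+ (f ∘ suc) (g ∘ suc))) (+-interchange (f zero) (g zero) (sumF (f ∘ suc)) (sumF (g ∘ suc)))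

sumF-* : ∀ {n} c (f : Fin n → ℚ) → sumF (λ i → c *ℚ f i) ≡ c *ℚ sumF f
sumF-* {zero} c f = sym (ℚ.*-zeroʳ c)
sumF-* {suc n} c f = trans (cong (c *ℚ f zero +ℚ_) (sumF-* c (f ∘ suc))) (sym (ℚ.*-distribˡ-+ c (f zero) (sumF (f ∘ suc))))

sumF-*ʳ : ∀ {n} c (f : Fin n → ℚ) → sumF (λ i → f i *ℚ c) ≡ sumF f *ℚ c
sumF-*ʳ c f = trans (sumF-cong (λ i → ℚ.*-comm (f i) c)) (trans (sumF-* c f) (ℚ.*-comm c (sumF f)))

sumF-0 : ∀ {n} (f : Fin n → ℚ) → (∀ i → f i ≡ 0ℚ) → sumF f ≡ 0ℚ
sumF-0 {zero} f h = refl
sumF-0 {suc n} f h = trans (cong₂ _+ℚ_ (h zero) (sumF-0 (f ∘ suc) (λ i → h (suc i)))) (ℚ.+-identityˡ 0ℚ)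

sumF-swap : ∀ {n m} (f : Fin n → Fin m → ℚ) → sumF (λ i → sumF (f i)) ≡ sumF (λ j → sumF (λ i → f i j))
sumF-swap {zero} {m} f = sym (sumF-0 {m} (λ _ → 0ℚ) (λ _ → refl))
sumF-swap {suc n} f = trans (cong (sumF (f zero) +ℚ_) (sumF-swap (f ∘ suc))) (sym (sumF-+ (f zero) (λ j → sumF (λ i → f (suc i) j))))

sumF-mono : ∀ {n} {f g : Fin n → ℚ} → (∀ i → f i ≤ℚ g i) → sumF f ≤ℚ sumF g
sumF-mono {zero} h = ℚ.≤-refl
sumF-mono {suc n} h = ℚ.+-mono-≤ (h zero) (sumF-mono (λ i → h (suc i)))

sumF-≡0⁻ : ∀ {n} (f : Fin n → ℚ) → (∀ i → 0ℚ ≤ℚ f i) → sumF f ≡ 0ℚ → ∀ i → f i ≡ 0ℚ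
sumF-≡0⁻ {suc n} f h e i = pick i
  where
  tail≥0 : ∀ {n} (f : Fin n → ℚ) → (∀ i → 0ℚ ≤ℚ f i) → 0ℚ ≤ℚ sumF f
  tail≥0 {zero} f h = ℚ.≤-refl
  tail≥0 {suc n} f h = ℚ.≤-trans (ℚ.≤-reflexive (sym (ℚ.+-identityˡ 0ℚ))) (ℚ.+-mono-≤ (h zero) (tail≥0 (f ∘ suc) (λ i → h (suc i))))
  zeros : ∀ {a b} → 0ℚ ≤ℚ a → 0ℚ ≤ℚ b → a +ℚ b ≡ 0ℚ → a ≡ 0ℚ × b ≡ 0ℚ
  zeros {a} {b} x y e with nonpos-+≡0 {(- a)} {(- b)} (ℚ.neg-antimono-≤ x) (ℚ.neg-antimono-≤ y) (trans (sym (ℚ.neg-distrib-+ a b)) (cong -_ e))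
  ... | p , q = ℚ.neg-injective {a} {0ℚ} p , ℚ.neg-injective {b} {0ℚ} q
  pick : ∀ i → f i ≡ 0ℚ
  pick zero = proj₁ (zeros (h zero) (tail≥0 (f ∘ suc) (λ i → h (suc i))) e)
  pick (suc i) = sumF-≡0⁻ (f ∘ suc) (λ i → h (suc i)) (proj₂ (zeros (h zero) (tail≥0 (f ∘ suc) (λ i → h (suc i))) e)) i

sumF-only : ∀ {n} (f : Fin n → ℚ) i → (∀ j → j ≢ i → f j ≡ 0ℚ) → sumF f ≡ f i
sumF-only {suc n} f zero h = trans (cong (f zero +ℚ_) (sumF-0 (f ∘ suc) (λ j → h (suc j) (λ ())))) (ℚ.+-identityʳ (f zero))
sumF-only {suc n} f (suc i) h = trans (cong₂ _+ℚ_ (h zero (λ ())) (sumF-only (f ∘ suc) i (λ j n → h (suc j) (λ { refl → n refl })))) (ℚ.+-identityˡ (f (suc i)))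

δ : ∀ {n} → Fin n → Fin n → ℚ
δ i j = χ (does (i ≟F j))

δ-self : ∀ {n} (i : Fin n) → δ i i ≡ 1ℚ
δ-self i = cong χ (dec-true (i ≟F i) refl)

δ-self≢0 : ∀ {n} (i : Fin n) → δ i i ≢ 0ℚ
δ-self≢0 i e with () ← trans (sym (δ-self i)) e

δ-other : ∀ {n} {i j : Fin n} → j ≢ i → δ i j ≡ 0ℚ
δ-other {i = i} {j} n = cong χ (dec-false (i ≟F j) (λ e → n (sym e)))

δ≥0 : ∀ {n} (i j : Fin n) → 0ℚ ≤ℚ δ i j
δ≥0 i j = χ≥0 (does (i ≟F j))

sumF-δ* : ∀ {n} (i : Fin n) (f : Fin n → ℚ) → sumF (λ j → δ i j *ℚ f j) ≡ f i
sumF-δ* i f = trans (sumF-only (λ j → δ i j *ℚ f j) i (λ j n → trans (cong (_*ℚ f j) (δ-other n)) (ℚ.*-zeroˡ (f j))))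
                    (trans (cong (_*ℚ f i) (δ-self i)) (ℚ.*-identityˡ (f i)))

sumF-δ : ∀ {n} (i : Fin n) → sumF (δ i) ≡ 1ℚ
sumF-δ i = trans (sumF-only (δ i) i (λ j n → δ-other n)) (δ-self i)

-- From simplex faces of the order polytope to cliques

module Points (P : FinPoset) where
  open Geometry P
  open Inverse (enum P) using (to; from)

  dot-cong : ∀ w {x y : Pt} → (∀ p → x p ≡ y p) → w · x ≡ w · y
  dot-cong w h = sumF-cong (λ i → cong (w (from i) *ℚ_) (h (from i)))

  dot-+ : ∀ w (x y : Pt) → w · (λ p → x p +ℚ y p) ≡ w · x +ℚ w · y
  dot-+ w x y = trans (sumF-cong (λ i → ℚ.*-distribˡ-+ (w (from i)) (x (from i)) (y (from i)))) (sumF-+ (λ i → w (from i) *ℚ x (from i)) (λ i → w (from i) *ℚ y (from i)))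

  dot-Σ : ∀ {m} w (μ : Fin m → ℚ) (v : Fin m → Pt) → w · (λ p → sumF (λ i → μ i *ℚ v i p)) ≡ sumF (λ i → μ i *ℚ (w · v i))
  dot-Σ w μ v = trans (sumF-cong (λ j → trans (sym (sumF-* (w (from j)) (λ i → μ i *ℚ v i (from j)))) (sumF-cong (λ i → *-exchange (w (from j)) (μ i) (v i (from j))))))
    (trans (sumF-swap (λ j i → μ i *ℚ (w (from j) *ℚ v i (from j)))) (sumF-cong (λ i → sumF-* (μ i) (λ j → w (from j) *ℚ v i (from j)))))

  dot-conv : ∀ {m} w c (μ : Fin m → ℚ) (v : Fin m → Pt) x → sumF μ ≡ 1ℚ → (∀ p → x p ≡ sumF (λ i → μ i *ℚ v i p)) → (∀ i → w · v i ≡ c) → w · x ≡ c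
  dot-conv w c μ v x s e h = trans (dot-cong w e) (trans (dot-Σ w μ v) (trans (sumF-cong (λ i → cong (μ i *ℚ_) (h i)))
    (trans (sumF-*ʳ c μ) (trans (cong (_*ℚ c) s) (ℚ.*-identityˡ c)))))

  ind : Vtx P → Pt
  ind F p = χ (F p)

module OrderFaces (P : FinPoset) where
  open Geometry P
  open Elements P
  open Points P
  private module O = Cliques (OG P)

  χ≤1 : ∀ b → χ b ≤ℚ 1ℚ
  χ≤1 true = ℚ.≤-refl
  χ≤1 false = toWitness {a? = 0ℚ ℚ.≤? 1ℚ} _

  χ-mono : ∀ {a b} → (a ≡ true → b ≡ true) → χ a ≤ℚ χ b
  χ-mono {true} h rewrite h refl = ℚ.≤-refl
  χ-mono {false} {b} h = χ≥0 b

  ind-Order : ∀ (F : Filter P) → OrderPoly (ind (proj₁ F))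
  ind-Order (F , f) = (λ p → χ≥0 (F p) , χ≤1 (F p)) , λ p q le → χ-mono (f p q le)

  tight-sum : ∀ {a b c} → a ≤ℚ c → b ≤ℚ c → a +ℚ b ≡ c +ℚ c → a ≡ c
  tight-sum {a} {b} {c} x y e = ℚ.≤-antisym x (≤-cancel (ℚ.≤-trans (ℚ.≤-reflexive (sym e)) (ℚ.+-monoʳ-≤ a y)))
    where
    ≤-cancel : c +ℚ c ≤ℚ a +ℚ c → c ≤ℚ a
    ≤-cancel h = ℚ.≤-trans (ℚ.≤-reflexive (a≡a+b-b c c)) (ℚ.≤-trans (ℚ.+-monoˡ-≤ (- c) h) (ℚ.≤-reflexive (sym (a≡a+b-b a c))))

  clamp excess : ℚ → ℚ
  clamp t = t ⊓ 1ℚ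
  excess t = (t +ℚ -1ℚ) ⊔ℚ 0ℚ

  clamp+excess : ∀ t → clamp t +ℚ excess t ≡ t
  clamp+excess t with ℚ.≤-total t 1ℚ
  ... | inj₁ le = trans (cong₂ _+ℚ_ (ℚ.p≤q⇒p⊓q≡p le) (ℚ.p≤q⇒p⊔q≡q (ℚ.+-monoˡ-≤ -1ℚ le))) (ℚ.+-identityʳ t)
  ... | inj₂ le = trans (cong₂ _+ℚ_ (ℚ.p≥q⇒p⊓q≡q le) (ℚ.p≥q⇒p⊔q≡p (ℚ.+-monoˡ-≤ -1ℚ le)))
                        (trans (ℚ.+-comm 1ℚ (t +ℚ -1ℚ)) (trans (ℚ.+-assoc t -1ℚ 1ℚ) (ℚ.+-identityʳ t)))

  -- A vertex x of O(P) is the midpoint of min(2x,1) and max(2x-1,0), which both lie in O(P).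
  doubled : Pt → Pt
  doubled x p = x p +ℚ x p

  doubled-bounds : ∀ {x} → OrderPoly x → ∀ p → (0ℚ ≤ℚ doubled x p) × (doubled x p +ℚ -1ℚ ≤ℚ 1ℚ)
  doubled-bounds (h , _) p = ℚ.≤-trans (ℚ.≤-reflexive (sym (ℚ.+-identityˡ 0ℚ))) (ℚ.+-mono-≤ (proj₁ (h p)) (proj₁ (h p))) ,
    ℚ.+-monoˡ-≤ -1ℚ (ℚ.+-mono-≤ (proj₂ (h p)) (proj₂ (h p)))

  clamp-Order : ∀ {x} → OrderPoly x → OrderPoly (λ p → clamp (doubled x p))
  clamp-Order {x} o@(h , m) = (λ p → ℚ.⊓-glb (proj₁ (doubled-bounds {x} o p)) (toWitness {a? = 0ℚ ℚ.≤? 1ℚ} _) , ℚ.p⊓q≤q (doubled x p) 1ℚ) ,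
    λ p q le → ℚ.⊓-monoˡ-≤ 1ℚ (ℚ.+-mono-≤ (m p q le) (m p q le))

  excess-Order : ∀ {x} → OrderPoly x → OrderPoly (λ p → excess (doubled x p))
  excess-Order {x} o@(h , m) = (λ p → ℚ.p≤q⊔p (doubled x p +ℚ -1ℚ) 0ℚ , ℚ.⊔-lub (proj₂ (doubled-bounds {x} o p)) (toWitness {a? = 0ℚ ℚ.≤? 1ℚ} _)) ,
    λ p q le → ℚ.⊔-monoˡ-≤ 0ℚ (ℚ.+-monoˡ-≤ -1ℚ (ℚ.+-mono-≤ (m p q le) (m p q le)))

  clamp-fixed : ∀ t → clamp (t +ℚ t) ≡ t → t ≢ 0ℚ → t ≡ 1ℚ
  clamp-fixed t e n with ℚ.⊓-sel (t +ℚ t) 1ℚ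
  ... | inj₂ x = trans (sym e) x
  ... | inj₁ x = ⊥-elim (n (trans (a≡a+b-b t t) (trans (cong (_+ℚ - t) (trans (sym x) e)) (ℚ.+-inverseʳ t))))

  module Simplex {k} (Fc : Face OrderPoly) (v : Fin (suc k) → Pt) (aff : AffInd v) (same : SameSet (faceSet Fc) (Conv v)) where
    open Face Fc

    unique-coordinates : ∀ (α β : Fin (suc k) → ℚ) → sumF α ≡ sumF β →
      (∀ p → sumF (λ i → α i *ℚ v i p) ≡ sumF (λ i → β i *ℚ v i p)) → ∀ i → α i ≡ β i
    unique-coordinates α β s e i = recover (α i) (β i) (aff (λ i → α i +ℚ - (β i)) sum0 comb0 i)
      where
      recover : ∀ a b → a +ℚ - b ≡ 0ℚ → a ≡ b
      recover a b h = trans (a≡a-b+b a b) (trans (cong (_+ℚ b) h) (ℚ.+-identityˡ b))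
      cancel' : ∀ {a b} → a ≡ b → a +ℚ -1ℚ *ℚ b ≡ 0ℚ
      cancel' {a} refl = trans (cong (a +ℚ_) (sym (ℚ.neg-distribˡ-* 1ℚ a))) (trans (cong (λ z → a +ℚ - z) (ℚ.*-identityˡ a)) (ℚ.+-inverseʳ a))
      neg1 : ∀ b → - b ≡ -1ℚ *ℚ b
      neg1 b = trans (cong -_ (sym (ℚ.*-identityˡ b))) (ℚ.neg-distribˡ-* 1ℚ b)
      sum0 : sumF (λ i → α i +ℚ - (β i)) ≡ 0ℚ
      sum0 = trans (sumF-cong (λ i → cong (α i +ℚ_) (neg1 (β i)))) (trans (sumF-+ α (λ i → -1ℚ *ℚ β i)) (trans (cong (sumF α +ℚ_) (sumF-* -1ℚ β)) (cancel' s)))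
      comb0 : ∀ p → sumF (λ i → (α i +ℚ - (β i)) *ℚ v i p) ≡ 0ℚ
      comb0 p = trans (sumF-cong (λ i → trans (cong (λ z → (α i +ℚ z) *ℚ v i p) (neg1 (β i)))
          (trans (ℚ.*-distribʳ-+ (v i p) (α i) (-1ℚ *ℚ β i)) (cong (α i *ℚ v i p +ℚ_) (ℚ.*-assoc -1ℚ (β i) (v i p))))))
        (trans (sumF-+ (λ i → α i *ℚ v i p) (λ i → -1ℚ *ℚ (β i *ℚ v i p))) (trans (cong (sumF (λ i → α i *ℚ v i p) +ℚ_) (sumF-* -1ℚ (λ i → β i *ℚ v i p))) (cancel' (e p))))

    v-on : ∀ i → faceSet Fc (v i)
    v-on i = proj₂ (same (v i)) (δ i , δ≥0 i , sumF-δ i , λ p → sym (sumF-δ* i (λ j → v j p)))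

    coords : ∀ x → faceSet Fc x → Conv v x
    coords x h = proj₁ (same x) h

    -- The supporting functional is at most `c` at both points and totals `2 c`, so it equals `c` at
    -- each.
    both-on : ∀ x y i j → OrderPoly x → OrderPoly y → (∀ p → x p +ℚ y p ≡ v i p +ℚ v j p) → faceSet Fc x × faceSet Fc y
    both-on x y i j ox oy e = (ox , tight-sum (valid x ox) (valid y oy) sum) , (oy , tight-sum (valid y oy) (valid x ox) (trans (ℚ.+-comm (w · y) (w · x)) sum))
      where
      sum : w · x +ℚ w · y ≡ c +ℚ c
      sum = trans (sym (dot-+ w x y)) (trans (dot-cong w e) (trans (dot-+ w (v i) (v j)) (cong₂ _+ℚ_ (proj₂ (v-on i)) (proj₂ (v-on j)))))

    pair-sum : ∀ (α β : Fin (suc k) → ℚ) p → sumF (λ i → (α i +ℚ β i) *ℚ v i p) ≡ sumF (λ i → α i *ℚ v i p) +ℚ sumF (λ i → β i *ℚ v i p)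
    pair-sum α β p = trans (sumF-cong (λ i → ℚ.*-distribʳ-+ (v i p) (α i) (β i))) (sumF-+ (λ i → α i *ℚ v i p) (λ i → β i *ℚ v i p))

    -- Both halves of the midpoint decomposition lie on the face. Their coefficients are nonnegative
    -- and add up to twice those of `v i`, so they are concentrated at `i`. Hence `min(2x,1)` is
    -- `v i` itself, which leaves only `1` for a nonzero coordinate.
    zero-or-one : ∀ i p → v i p ≢ 0ℚ → v i p ≡ 1ℚ
    zero-or-one i p = clamp-fixed (v i p) (fixed p)
      where
      x' = λ p → clamp (doubled (v i) p)
      x″ = λ p → excess (doubled (v i) p)
      on = both-on x' x″ i i (clamp-Order {v i} (proj₁ (v-on i))) (excess-Order {v i} (proj₁ (v-on i))) (λ p → clamp+excess (doubled (v i) p))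
      C' = coords x' (proj₁ on)
      C″ = coords x″ (proj₂ on)
      α = proj₁ C'
      β = proj₁ C″
      agree : ∀ j → α j +ℚ β j ≡ δ i j +ℚ δ i j
      agree = unique-coordinates (λ j → α j +ℚ β j) (λ j → δ i j +ℚ δ i j)
        (trans (sumF-+ α β) (trans (cong₂ _+ℚ_ (proj₁ (proj₂ (proj₂ C'))) (proj₁ (proj₂ (proj₂ C″)))) (sym (trans (sumF-+ (δ i) (δ i)) (cong₂ _+ℚ_ (sumF-δ i) (sumF-δ i))))))
        (λ p → trans (pair-sum α β p) (trans (sym (cong₂ _+ℚ_ (proj₂ (proj₂ (proj₂ C')) p) (proj₂ (proj₂ (proj₂ C″)) p)))
          (trans (clamp+excess (doubled (v i) p)) (sym (trans (pair-sum (δ i) (δ i) p) (cong₂ _+ℚ_ (sumF-δ* i (λ j → v j p)) (sumF-δ* i (λ j → v j p))))))))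
      off : ∀ j → j ≢ i → α j ≡ 0ℚ
      off j n = sumF-≡0⁻ {2} (λ { zero → α j ; (suc _) → β j }) (λ { zero → proj₁ (proj₂ C') j ; (suc _) → proj₁ (proj₂ C″) j })
        (trans (cong (α j +ℚ_) (ℚ.+-identityʳ (β j))) (trans (agree j) (cong₂ _+ℚ_ (δ-other n) (δ-other n)))) zero
      αi : α i ≡ 1ℚ
      αi = trans (sym (sumF-only α i off)) (proj₁ (proj₂ (proj₂ C')))
      fixed : ∀ p → x' p ≡ v i p
      fixed p = trans (proj₂ (proj₂ (proj₂ C')) p) (trans (sumF-only (λ j → α j *ℚ v j p) i (λ j n → trans (cong (_*ℚ v j p) (off j n)) (ℚ.*-zeroˡ (v j p))))
        (trans (cong (_*ℚ v i p) αi) (ℚ.*-identityˡ (v i p))))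

    vertex : Fin (suc k) → Filter P
    vertex i = (λ p → does (v i p ℚ.≟ 1ℚ)) , λ p q le e → dec-true (v i q ℚ.≟ 1ℚ)
      (ℚ.≤-antisym (proj₂ (proj₁ (proj₁ (v-on i)) q)) (subst (_≤ℚ v i q) (true⇒ (v i p ℚ.≟ 1ℚ) e) (proj₂ (proj₁ (v-on i)) p q le)))

    vertex-ind : ∀ i p → v i p ≡ ind (proj₁ (vertex i)) p
    vertex-ind i p with v i p ℚ.≟ 1ℚ
    ... | yes e = e
    ... | no n with v i p ℚ.≟ 0ℚ
    ...   | yes e = e
    ...   | no m = ⊥-elim (n (zero-or-one i p m))

    χ-injective : ∀ {a b} → χ a ≡ χ b → a ≡ b
    χ-injective {true} {true} _ = refl
    χ-injective {false} {false} _ = refl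

    -- A 0/1 point of the face is one of the v j: any j with a positive coefficient works.
    is-vertex : ∀ (F : Filter P) → faceSet Fc (ind (proj₁ F)) → Σ (Fin (suc k)) λ j → ∀ p → v j p ≡ ind (proj₁ F) p
    is-vertex (F , f) h with coords (ind F) h
    ... | α , α≥0 , s , e with any? (λ j → ¬? (α j ℚ.≟ 0ℚ))
    ...   | no none = ⊥-elim (1≢0 (trans (sym s) (sumF-0 α (λ j → stable j))))
      where
      1≢0 : 1ℚ ≢ 0ℚ
      1≢0 ()
      stable : ∀ j → α j ≡ 0ℚ
      stable j with α j ℚ.≟ 0ℚ
      ... | yes z = z
      ... | no n = ⊥-elim (none (j , n))
    ...   | yes (j , αj≢0) = j , at
      where
      nonneg-* : ∀ {a b} → 0ℚ ≤ℚ a → 0ℚ ≤ℚ b → 0ℚ ≤ℚ a *ℚ b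
      nonneg-* {a} {b} x y = ℚ.≤-trans (ℚ.≤-reflexive (sym (ℚ.*-zeroʳ a))) (ℚ.*-monoˡ-≤-nonNeg a {{nonNegative x}} y)
      1-v : Carrier P → Fin (suc k) → ℚ
      1-v p i = 1ℚ +ℚ - (v i p)
      1-v≥0 : ∀ p i → 0ℚ ≤ℚ 1-v p i
      1-v≥0 p i = ℚ.≤-trans (ℚ.≤-reflexive (sym (ℚ.+-inverseʳ (v i p)))) (ℚ.+-monoˡ-≤ (- (v i p)) (proj₂ (proj₁ (proj₁ (v-on i)) p)))
      split : ∀ a b → a *ℚ (1ℚ +ℚ - b) +ℚ a *ℚ b ≡ a
      split a b = trans (sym (ℚ.*-distribˡ-+ a (1ℚ +ℚ - b) b)) (trans (cong (a *ℚ_) (trans (ℚ.+-assoc 1ℚ (- b) b) (trans (cong (1ℚ +ℚ_) (ℚ.+-inverseˡ b)) (ℚ.+-identityʳ 1ℚ)))) (ℚ.*-identityʳ a))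
      drop1 : ∀ a → a +ℚ 1ℚ ≡ 1ℚ → a ≡ 0ℚ
      drop1 a x = trans (a≡a+b-b a 1ℚ) (trans (cong (_+ℚ - 1ℚ) x) (ℚ.+-inverseʳ 1ℚ))
      at : ∀ p → v j p ≡ χ (F p)
      at p with F p | e p
      ... | false | z = *-zero-cancelˡ αj≢0 (sumF-≡0⁻ (λ i → α i *ℚ v i p) (λ i → nonneg-* (α≥0 i) (proj₁ (proj₁ (proj₁ (v-on i)) p))) (sym z) j)
      ... | true | z = trans (b≡a-[a-b] 1ℚ (v j p))
                             (trans (cong (λ y → 1ℚ +ℚ - y) (*-zero-cancelˡ αj≢0 (sumF-≡0⁻ (λ i → α i *ℚ 1-v p i) (λ i → nonneg-* (α≥0 i) (1-v≥0 p i)) total j))) (ℚ.+-identityʳ 1ℚ))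
        where
        total : sumF (λ i → α i *ℚ 1-v p i) ≡ 0ℚ
        total = drop1 (sumF (λ i → α i *ℚ 1-v p i)) (trans (cong (sumF (λ i → α i *ℚ 1-v p i) +ℚ_) z) (trans (sym (sumF-+ (λ i → α i *ℚ 1-v p i) (λ i → α i *ℚ v i p)))
                  (trans (sumF-cong (λ i → split (α i) (v i p))) s)))

    vertex≈ : ∀ (F : Filter P) j → (∀ p → v j p ≡ ind (proj₁ F) p) → F O.≈ vertex j
    vertex≈ F j e p = χ-injective (trans (sym (e p)) (vertex-ind j p))

    δ-support : ∀ {a i j b : Fin (suc k)} → δ a a +ℚ δ b a ≡ δ i a +ℚ δ j a → (a ≡ i) ⊎ (a ≡ j)
    δ-support {a} {i} {j} {b} e with a ≟F i | a ≟F j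
    ... | yes x | _ = inj₁ x
    ... | no _ | yes y = inj₂ y
    ... | no n | no m = ⊥-elim (δ-self≢0 a (sumF-≡0⁻ {2} (λ { zero → δ a a ; (suc _) → δ b a }) (λ { zero → δ≥0 a a ; (suc _) → δ≥0 b a }) total zero))
      where
      total : δ a a +ℚ (δ b a +ℚ 0ℚ) ≡ 0ℚ
      total = trans (cong (δ a a +ℚ_) (ℚ.+-identityʳ (δ b a))) (trans e (cong₂ _+ℚ_ (δ-other n) (δ-other m)))

    vertex-injective : ∀ i j → vertex i O.≈ vertex j → i ≡ j
    vertex-injective i j e with i ≟F j
    ... | yes x = x
    ... | no n = ⊥-elim (δ-self≢0 i (trans (unique-coordinates (δ i) (δ j) (trans (sumF-δ i) (sym (sumF-δ j))) same-point i) (δ-other n)))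
      where
      same-point : ∀ p → sumF (λ t → δ i t *ℚ v t p) ≡ sumF (λ t → δ j t *ℚ v t p)
      same-point p = trans (sumF-δ* i (λ t → v t p)) (trans (trans (vertex-ind i p) (trans (cong χ (e p)) (sym (vertex-ind j p)))) (sym (sumF-δ* j (λ t → v t p))))

    -- Filters with the same sum of indicators as two vertices of the face lie on the face by
    -- `both-on`, so they are vertices `v a` and `v b`; unique affine coordinates then identify the
    -- pair `a`, `b` with `i`, `j`.
    vertex-edge : ∀ i j → i ≢ j → O.E (vertex i) (vertex j)
    vertex-edge i j i≢j = (λ e → i≢j (vertex-injective i j e)) , edge
      where
      edge : ∀ (H K : Filter P) → (∀ p → Swap (proj₁ (vertex i) p) (proj₁ (vertex j) p) (proj₁ H p) (proj₁ K p)) →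
             (H O.≈ vertex i × K O.≈ vertex j) ⊎ (H O.≈ vertex j × K O.≈ vertex i)
      edge H K s = resolve (δ-support {a} {i} {j} {b} (agree a))
        where
        balance : ∀ p → ind (proj₁ H) p +ℚ ind (proj₁ K) p ≡ v i p +ℚ v j p
        balance p = trans (χ-swap (s p)) (sym (cong₂ _+ℚ_ (vertex-ind i p) (vertex-ind j p)))
        on = both-on (ind (proj₁ H)) (ind (proj₁ K)) i j (ind-Order H) (ind-Order K) balance
        VH = is-vertex H (proj₁ on)
        VK = is-vertex K (proj₂ on)
        a = proj₁ VH
        b = proj₁ VK
        two : ∀ x y p → sumF (λ t → (δ x t +ℚ δ y t) *ℚ v t p) ≡ v x p +ℚ v y p
        two x y p = trans (pair-sum (δ x) (δ y) p) (cong₂ _+ℚ_ (sumF-δ* x (λ t → v t p)) (sumF-δ* y (λ t → v t p)))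
        sum2 : ∀ x y → sumF (λ t → δ {suc k} x t +ℚ δ y t) ≡ 1ℚ +ℚ 1ℚ
        sum2 x y = trans (sumF-+ (δ x) (δ y)) (cong₂ _+ℚ_ (sumF-δ x) (sumF-δ y))
        agree : ∀ t → δ a t +ℚ δ b t ≡ δ i t +ℚ δ j t
        agree = unique-coordinates (λ t → δ a t +ℚ δ b t) (λ t → δ i t +ℚ δ j t) (trans (sum2 a b) (sym (sum2 i j)))
          (λ p → trans (two a b p) (trans (cong₂ _+ℚ_ (proj₂ VH p) (proj₂ VK p)) (trans (balance p) (sym (two i j p)))))
        other : ∀ {x y z u : Fin (suc k)} → x ≡ z → (∀ t → δ x t +ℚ δ y t ≡ δ z t +ℚ δ u t) → y ≡ u
        other {x} {y} {z} {u} refl h with y ≟F u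
        ... | yes e = e
        ... | no n = ⊥-elim (δ-self≢0 y (trans (drop (δ x y) (δ y y) (δ u y) (h y)) (δ-other n)))
          where
          drop : ∀ a b c → a +ℚ b ≡ a +ℚ c → b ≡ c
          drop a b c e = trans (b≡-a+[a+b] a b) (trans (cong (- a +ℚ_) e) (sym (b≡-a+[a+b] a c)))
        at : ∀ (F : Filter P) {x y} → (∀ p → v x p ≡ ind (proj₁ F) p) → x ≡ y → F O.≈ vertex y
        at F {x} e refl = vertex≈ F x e
        resolve : (a ≡ i) ⊎ (a ≡ j) → (H O.≈ vertex i × K O.≈ vertex j) ⊎ (H O.≈ vertex j × K O.≈ vertex i)
        resolve (inj₁ x) = inj₁ (at H (proj₂ VH) x , at K (proj₂ VK) (other x agree))
        resolve (inj₂ x) = inj₂ (at H (proj₂ VH) x , at K (proj₂ VK) (other x (λ t → trans (agree t) (ℚ.+-comm (δ i t) (δ j t)))))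

    vertices : El O.Cl
    vertices = tabulate vertex , O.tabulate-clique vertex vertex-edge

  toClique : ∀ {k} → SimplexFace OrderPoly k → El O.Cl
  toClique (Fc , v , aff , same) = Simplex.vertices Fc v aff same

  toClique-length : ∀ {k} (S : SimplexFace OrderPoly k) → length (proj₁ (toClique S)) ≡ suc k
  toClique-length (Fc , v , aff , same) = length-tabulate (Simplex.vertex Fc v aff same)

  -- A point of one face is a convex combination of its vertices, and these lie on the supporting
  -- hyperplane of the other.
  toClique-reflects : ∀ {k} (S T : SimplexFace OrderPoly k) → proj₁ (toClique S) O.~ proj₁ (toClique T) → SameSet (faceSet (proj₁ S)) (faceSet (proj₁ T))
  toClique-reflects S T (s , s') x = half S T s x , half T S s' x
    where
    half : ∀ {k} (S T : SimplexFace OrderPoly k) → proj₁ (toClique S) O.⊆ proj₁ (toClique T) → ∀ x → faceSet (proj₁ S) x → faceSet (proj₁ T) x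
    half S@(F₁ , v₁ , a₁ , e₁) T@(F₂ , v₂ , a₂ , e₂) s x on =
      proj₁ on , dot-conv (Face.w F₂) (Face.c F₂) (proj₁ C) v₁ x (proj₁ (proj₂ (proj₂ C))) (proj₂ (proj₂ (proj₂ C))) tight
      where
      module S₁ = Simplex F₁ v₁ a₁ e₁
      module S₂ = Simplex F₂ v₂ a₂ e₂
      C = S₁.coords x on
      tight : ∀ i → Face.w F₂ · v₁ i ≡ Face.c F₂
      tight i with O.tabulate-∈⁻ S₂.vertex (S₁.vertex i) (s (S₁.vertex i) (O.tabulate-∈ S₁.vertex i))
      ... | j , e = trans (dot-cong (Face.w F₂) (λ p → trans (S₁.vertex-ind i p) (trans (cong χ (e p)) (sym (S₂.vertex-ind j p))))) (proj₂ (S₂.v-on j))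

-- From certificates to simplex faces of the chain polytope

module ChainFaces (P : FinPoset) (_≤?_ : DecOrder P) where
  open Geometry P
  open Elements P
  open Points P
  open Extremal P _≤?_
  open Inverse (enum P) using (to; from)
  private module A = Cliques (AG P)
  open Simp

  linear : Aff (Carrier P) → Pt
  linear (con a) p = 0ℚ
  linear (var q) p = χ (does (q ≟C p))
  linear (e ⊞ f) p = linear e p +ℚ linear f p
  linear (a ⊠ e) p = a *ℚ linear e p

  constant : Aff (Carrier P) → ℚ
  constant (con a) = a
  constant (var q) = 0ℚ
  constant (e ⊞ f) = constant e +ℚ constant f
  constant (a ⊠ e) = a *ℚ constant e

  linear-correct : ∀ e x → ⟦ e ⟧ x ≡ linear e · x +ℚ constant e
  linear-correct (con a) x = sym (trans (cong (_+ℚ a) (sumF-0 (λ i → 0ℚ *ℚ x (from i)) (λ i → ℚ.*-zeroˡ (x (from i))))) (ℚ.+-identityˡ a))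
  linear-correct (var q) x = sym (trans (ℚ.+-identityʳ (linear (var q) · x)) (trans (sumF-only (λ i → χ (does (q ≟C from i)) *ℚ x (from i)) (to q) others) at))
    where
    others : ∀ j → j ≢ to q → χ (does (q ≟C from j)) *ℚ x (from j) ≡ 0ℚ
    others j n = trans (cong (λ b → χ b *ℚ x (from j)) (dec-false (q ≟C from j) (λ e → n (trans (sym (Inverse.strictlyInverseˡ (enum P) j)) (cong to (sym e)))))) (ℚ.*-zeroˡ (x (from j)))
    at : χ (does (q ≟C from (to q))) *ℚ x (from (to q)) ≡ x q
    at = trans (cong₂ _*ℚ_ (cong χ (dec-true (q ≟C from (to q)) (sym (from-to q)))) (cong x (from-to q))) (ℚ.*-identityˡ (x q))
  linear-correct (e ⊞ f) x = trans (cong₂ _+ℚ_ (linear-correct e x) (linear-correct f x))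
    (trans (+-interchange (linear e · x) (constant e) (linear f · x) (constant f)) (cong (_+ℚ (constant e +ℚ constant f))
      (sym (trans (sumF-cong (λ i → ℚ.*-distribʳ-+ (x (from i)) (linear e (from i)) (linear f (from i)))) (sumF-+ (λ i → linear e (from i) *ℚ x (from i)) (λ i → linear f (from i) *ℚ x (from i)))))))
  linear-correct (a ⊠ e) x = trans (cong (a *ℚ_) (linear-correct e x)) (trans (ℚ.*-distribˡ-+ a (linear e · x) (constant e))
    (cong (_+ℚ a *ℚ constant e) (sym (trans (sumF-cong (λ i → ℚ.*-assoc a (linear e (from i)) (x (from i)))) (sumF-* a (λ i → linear e (from i) *ℚ x (from i)))))))

  on-plane : ∀ e x → ⟦ e ⟧ x ≡ 0ℚ → linear e · x ≡ - constant e
  on-plane e x h = trans (a≡a+b-b (linear e · x) (constant e)) (trans (cong (_+ℚ - constant e) (trans (sym (linear-correct e x)) h)) (ℚ.+-identityˡ (- constant e)))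

  on-plane⁻ : ∀ e x → linear e · x ≡ - constant e → ⟦ e ⟧ x ≡ 0ℚ
  on-plane⁻ e x h = trans (linear-correct e x) (trans (cong (_+ℚ constant e) h) (ℚ.+-inverseˡ (constant e)))

  below-plane : ∀ e x → ⟦ e ⟧ x ≤ℚ 0ℚ → linear e · x ≤ℚ - constant e
  below-plane e x h = ℚ.≤-trans (ℚ.≤-reflexive (a≡a+b-b (linear e · x) (constant e)))
    (ℚ.≤-trans (ℚ.+-monoˡ-≤ (- constant e) (ℚ.≤-trans (ℚ.≤-reflexive (sym (linear-correct e x))) h)) (ℚ.≤-reflexive (ℚ.+-identityˡ (- constant e))))

  lsum : List (ℚ × Anti P) → (Anti P → ℚ) → ℚ
  lsum [] f = 0ℚ
  lsum ((a , A) ∷ L) f = a *ℚ f A +ℚ lsum L f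

  lsum-+ : ∀ L f g → lsum L (λ A → f A +ℚ g A) ≡ lsum L f +ℚ lsum L g
  lsum-+ [] f g = sym (ℚ.+-identityˡ 0ℚ)
  lsum-+ ((a , A) ∷ L) f g = trans (cong₂ _+ℚ_ (ℚ.*-distribˡ-+ a (f A) (g A)) (lsum-+ L f g)) (+-interchange (a *ℚ f A) (a *ℚ g A) (lsum L f) (lsum L g))

  lsum-* : ∀ L c f → lsum L (λ A → c *ℚ f A) ≡ c *ℚ lsum L f
  lsum-* [] c f = sym (ℚ.*-zeroʳ c)
  lsum-* ((a , A) ∷ L) c f = trans (cong₂ _+ℚ_ (*-exchange a c (f A)) (lsum-* L c f)) (sym (ℚ.*-distribˡ-+ c (a *ℚ f A) (lsum L f)))

  Positive : ℚ × Anti P → Set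
  Positive (a , _) = 0ℚ ≤ℚ a × a ≢ 0ℚ

  -- A convex combination of antichains when `μ` is `1`. Zero weights are excluded, so that a
  -- supporting function tight at `x` is tight at every antichain listed.
  record Decomposition (x : Pt) (μ : ℚ) : Set where
    field
      terms  : List (ℚ × Anti P)
      pos    : All Positive terms
      total  : lsum terms (λ _ → 1ℚ) ≡ μ
      points : ∀ p → x p ≡ lsum terms (λ A → χ (proj₁ A p))

  sumL-mono : ∀ {x y : Pt} cs → (∀ p → x p ≤ℚ y p) → sumL x cs ≤ℚ sumL y cs
  sumL-mono [] h = ℚ.≤-refl
  sumL-mono (c ∷ cs) h = ℚ.+-mono-≤ (h c) (sumL-mono cs h)

  remove : ∀ {p : Carrier P} {xs} → Any (p ≡_) xs → Σ (List (Carrier P)) λ ys → length xs ≡ suc (length ys) × (∀ q → Any (q ≡_) xs → q ≢ p → Any (q ≡_) ys)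
  remove {xs = x ∷ xs} (here refl) = xs , refl , λ { q (here e) n → ⊥-elim (n e) ; q (there m) n → m }
  remove {xs = x ∷ xs} (there m) with remove m
  ... | ys , e , h = x ∷ ys , cong suc e , λ { q (here e') n → here e' ; q (there m') n → there (h q m' n) }

  sub-mono : ∀ {a b c} → a +ℚ b ≤ℚ c → b ≤ℚ c +ℚ - a
  sub-mono {a} {b} {c} h = ℚ.≤-trans (ℚ.≤-reflexive (trans (a≡a+b-b b a) (cong (_+ℚ - a) (ℚ.+-comm b a)))) (ℚ.+-monoˡ-≤ (- a) h)

  -- Subtract ε times the antichain of minimal elements of the support, ε being the least value on it;
  -- every chain whose support is nonempty can be assumed to meet this antichain.
  module Peel (x : Pt) (μ : ℚ) (x≥0 : ∀ p → 0ℚ ≤ℚ x p) (bound : ∀ cs → IsChain cs → sumL x cs ≤ℚ μ) where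
    Support : Carrier P → Set
    Support p = x p ≢ 0ℚ

    support? : ∀ p → Dec (Support p)
    support? p = ¬? (x p ℚ.≟ 0ℚ)

    Bottom : Carrier P → Set
    Bottom p = Support p × (∀ q → _≼_ P q p → Support q → q ≡ p)

    abstract
      bottom? : ∀ p → Dec (Bottom p)
      bottom? p = support? p ×-dec allC? (λ q → (q ≤? p) →-dec (support? q →-dec (q ≟C p)))

    B : Anti P
    B = (λ p → does (bottom? p)) , λ p q e e' le → proj₂ (true⇒ (bottom? q) e') p le (proj₁ (true⇒ (bottom? p) e))

    bottom-below : ∀ q → Support q → Σ (Carrier P) λ a → _≼_ P a q × Bottom a
    bottom-below q s with minimal support? q s
    ... | a , le , sa , mn = a , le , sa , mn

    vanish : (∀ a → Any (a ≡_) elems → ¬ Bottom a) → ∀ p → x p ≡ 0ℚ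
    vanish none p with x p ℚ.≟ 0ℚ
    ... | yes z = z
    ... | no s with bottom-below p s
    ...   | a , _ , h = ⊥-elim (none a (∈-elems a) h)

    module _ (p₀ : Carrier P) (b₀ : Bottom p₀) (least : ∀ q → Bottom q → x p₀ ≤ℚ x q) where
      ε = x p₀

      x' : Pt
      x' p = x p +ℚ - (ε *ℚ χ (proj₁ B p))

      x'≤x : ∀ p → x' p ≤ℚ x p
      x'≤x p = ℚ.≤-trans (ℚ.+-monoʳ-≤ (x p) (ℚ.neg-antimono-≤ (prod (proj₁ B p)))) (ℚ.≤-reflexive (ℚ.+-identityʳ (x p)))
        where
        prod : ∀ b → 0ℚ ≤ℚ ε *ℚ χ b
        prod true = ℚ.≤-trans (x≥0 p₀) (ℚ.≤-reflexive (sym (ℚ.*-identityʳ ε)))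
        prod false = ℚ.≤-reflexive (sym (ℚ.*-zeroʳ ε))

      x'-off : ∀ p → ¬ Bottom p → x' p ≡ x p
      x'-off p n = trans (cong (λ b → x p +ℚ - (ε *ℚ χ b)) (dec-false (bottom? p) n)) (trans (cong (λ z → x p +ℚ - z) (ℚ.*-zeroʳ ε)) (ℚ.+-identityʳ (x p)))

      x'-on : ∀ p → Bottom p → x' p ≡ x p +ℚ - ε
      x'-on p h = trans (cong (λ b → x p +ℚ - (ε *ℚ χ b)) (dec-true (bottom? p) h)) (cong (λ z → x p +ℚ - z) (ℚ.*-identityʳ ε))

      x'≥0 : ∀ p → 0ℚ ≤ℚ x' p
      x'≥0 p = go (bottom? p)
        where
        go : Dec (Bottom p) → 0ℚ ≤ℚ x' p
        go (no n) = ℚ.≤-trans (x≥0 p) (ℚ.≤-reflexive (sym (x'-off p n)))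
        go (yes h) = ℚ.≤-trans (ℚ.≤-reflexive (sym (ℚ.+-inverseʳ ε))) (ℚ.≤-trans (ℚ.+-monoˡ-≤ (- ε) (least p h)) (ℚ.≤-reflexive (sym (x'-on p h))))

      x'-zero : ∀ p → x p ≡ 0ℚ → x' p ≡ 0ℚ
      x'-zero p z = trans (x'-off p (λ h → proj₁ h z)) z

      bound' : ∀ cs → IsChain cs → sumL x' cs ≤ℚ μ +ℚ - ε
      -- The empty chain asks for `ε ≤ μ`, which the one-element chain `p₀` provides.
      bound' [] ch = sub-mono (bound (p₀ ∷ []) [-])
      bound' (p ∷ cs) ch = go (x p ℚ.≟ 0ℚ) (bottom? p)
        where
        reorder : ∀ a b c → (a +ℚ - b) +ℚ c ≡ (a +ℚ c) +ℚ - b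
        reorder = solve 3 (λ a b c → ((a :+ (:- b)) :+ c) := ((a :+ c) :+ (:- b))) refl
        go : Dec (x p ≡ 0ℚ) → Dec (Bottom p) → sumL x' (p ∷ cs) ≤ℚ μ +ℚ - ε
        go (yes z) _ = ℚ.≤-trans (ℚ.≤-reflexive (trans (cong (_+ℚ sumL x' cs) (x'-zero p z)) (ℚ.+-identityˡ (sumL x' cs)))) (bound' cs (tailᴸ ch))
        go (no s) (yes h) = ℚ.≤-trans (ℚ.+-mono-≤ (ℚ.≤-reflexive (x'-on p h)) (sumL-mono cs x'≤x))
          (ℚ.≤-trans (ℚ.≤-reflexive (reorder (x p) ε (sumL x cs))) (ℚ.+-monoˡ-≤ (- ε) (bound (p ∷ cs) ch)))
        go (no s) (no n) with bottom-below p s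
        -- Prolonging the chain downwards by `a` adds at least `ε` to its sum, and the longer chain
        -- still obeys the bound `μ`.
        ... | a , le , h = ℚ.≤-trans (sumL-mono (p ∷ cs) x'≤x)
          (ℚ.≤-trans (sub-mono (bound (a ∷ p ∷ cs) ((le , λ { refl → n h }) ∷ ch))) (ℚ.+-monoʳ-≤ μ (ℚ.neg-antimono-≤ (least a h))))

  decompose : ∀ n todo → length todo ≡ n → ∀ x μ → (∀ p → 0ℚ ≤ℚ x p) → (∀ cs → IsChain cs → sumL x cs ≤ℚ μ) →
              (∀ p → x p ≢ 0ℚ → Any (p ≡_) todo) → Decomposition x μ
  decompose n todo len x μ x≥0 bound supp with Extremum.top (λ p q → x q ≤ℚ x p) (λ f g → ℚ.≤-trans g f) (Peel.Bottom x μ x≥0 bound) (Peel.bottom? x μ x≥0 bound)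
      _≡_ refl (λ { refl f → f }) ℚ.≤-refl (λ { refl q → q }) elems (λ p q _ _ → ℚ.≤-total (x q) (x p))
  decompose n todo len x μ x≥0 bound supp | inj₂ none with μ ℚ.≟ 0ℚ
  ... | yes z = record { terms = [] ; pos = [] ; total = sym z ; points = Peel.vanish x μ x≥0 bound none }
  -- Weight left over once the support is exhausted goes to the origin; a zero weight would not be
  -- admissible, hence the separate case.
  ... | no μ≢0 = record
    { terms = (μ , ∅ P) ∷ [] ; pos = (bound [] [] , μ≢0) ∷ [] ; total = trans (ℚ.+-identityʳ (μ *ℚ 1ℚ)) (ℚ.*-identityʳ μ)
    ; points = λ p → trans (Peel.vanish x μ x≥0 bound none p) (sym (trans (ℚ.+-identityʳ (μ *ℚ 0ℚ)) (ℚ.*-zeroʳ μ))) }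
  decompose n todo len x μ x≥0 bound supp | inj₁ (p₀ , _ , b₀ , least) with remove (supp p₀ (proj₁ b₀))
  decompose zero todo len x μ x≥0 bound supp | inj₁ (p₀ , _ , b₀ , least) | todo' , len' , h with () ← trans (sym len) len'
  decompose (suc n) todo len x μ x≥0 bound supp | inj₁ (p₀ , _ , b₀ , least) | todo' , len' , h = record
    { terms = (x p₀ , Pl.B) ∷ D.terms ; pos = (x≥0 p₀ , proj₁ b₀) ∷ D.pos
    ; total = trans (cong (x p₀ *ℚ 1ℚ +ℚ_) D.total) (trans (cong (_+ℚ (μ +ℚ - x p₀)) (ℚ.*-identityʳ (x p₀))) (back (x p₀) μ))
    ; points = λ p → trans (split (x p) (x p₀ *ℚ χ (proj₁ Pl.B p))) (cong (x p₀ *ℚ χ (proj₁ Pl.B p) +ℚ_) (D.points p)) }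
    where
    module Pl = Peel x μ x≥0 bound
    least' : ∀ q → Pl.Bottom q → x p₀ ≤ℚ x q
    least' q b = least q (∈-elems q) b
    back : ∀ a b → a +ℚ (b +ℚ - a) ≡ b
    back = solve 2 (λ a b → (a :+ (b :+ (:- a))) := b) refl
    split : ∀ a b → a ≡ b +ℚ (a +ℚ - b)
    split = solve 2 (λ a b → a := (b :+ (a :+ (:- b)))) refl
    x' = Pl.x' p₀ b₀ least'
    supp' : ∀ p → x' p ≢ 0ℚ → Any (p ≡_) todo'
    supp' p s = h p (supp p (λ z → s (Pl.x'-zero p₀ b₀ least' p z)))
      (λ { refl → s (trans (Pl.x'-on p₀ b₀ least' p₀ b₀) (ℚ.+-inverseʳ (x p₀))) })
    module D = Decomposition (decompose n todo' (suc-injective (trans (sym len') len)) x' (μ +ℚ - x p₀) (Pl.x'≥0 p₀ b₀ least') (Pl.bound' p₀ b₀ least') supp')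

  decomposition : ∀ x → ChainPoly x → Decomposition x 1ℚ
  decomposition x (x≥0 , bound) = decompose (length elems) elems refl x 1ℚ x≥0 bound (λ p _ → ∈-elems p)

  module _ {x : Pt} (D : Decomposition x 1ℚ) where
    open Decomposition D

    eval-terms : ∀ e → ⟦ e ⟧ x ≡ lsum terms (λ A → ⟦ e ⟧ᵇ (proj₁ A))
    eval-terms (con a) = sym (trans (lsum-cong' terms) (trans (lsum-* terms a (λ _ → 1ℚ)) (trans (cong (a *ℚ_) total) (ℚ.*-identityʳ a))))
      where
      lsum-cong' : ∀ L → lsum L (λ _ → a) ≡ lsum L (λ _ → a *ℚ 1ℚ)
      lsum-cong' [] = refl
      lsum-cong' ((b , A) ∷ L) = cong₂ _+ℚ_ (cong (b *ℚ_) (sym (ℚ.*-identityʳ a))) (lsum-cong' L)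
    eval-terms (var q) = points q
    eval-terms (e ⊞ f) = trans (cong₂ _+ℚ_ (eval-terms e) (eval-terms f)) (sym (lsum-+ terms (λ A → ⟦ e ⟧ᵇ (proj₁ A)) (λ A → ⟦ f ⟧ᵇ (proj₁ A))))
    eval-terms (a ⊠ e) = trans (cong (a *ℚ_) (eval-terms e)) (sym (lsum-* terms a (λ A → ⟦ e ⟧ᵇ (proj₁ A))))

  scale≤0 : ∀ {a y} → 0ℚ ≤ℚ a → y ≤ℚ 0ℚ → a *ℚ y ≤ℚ 0ℚ
  scale≤0 {a} x y = ℚ.≤-trans (ℚ.*-monoˡ-≤-nonNeg a {{nonNegative x}} y) (ℚ.≤-reflexive (ℚ.*-zeroʳ a))

  lsum≤0 : ∀ {f} → (∀ A → f A ≤ℚ 0ℚ) → ∀ L → All Positive L → lsum L f ≤ℚ 0ℚ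
  lsum≤0 h [] [] = ℚ.≤-refl
  lsum≤0 h ((a , A) ∷ L) ((a≥0 , _) ∷ ps) = nonpos-+ (scale≤0 a≥0 (h A)) (lsum≤0 h L ps)

  lsum≡0⁻ : ∀ {f} → (∀ A → f A ≤ℚ 0ℚ) → ∀ L → All Positive L → lsum L f ≡ 0ℚ → All (λ t → f (proj₂ t) ≡ 0ℚ) L
  lsum≡0⁻ h [] [] e = []
  lsum≡0⁻ h ((a , A) ∷ L) ((a≥0 , a≢0) ∷ ps) e with nonpos-+≡0 (scale≤0 a≥0 (h A)) (lsum≤0 h L ps) e
  ... | x , y = *-zero-cancelˡ a≢0 x ∷ lsum≡0⁻ h L ps y

  antichain-sum : ∀ (Z : Anti P) p cs → IsChain (p ∷ cs) → proj₁ Z p ≡ true → sumL (ind (proj₁ Z)) cs ≡ 0ℚ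
  antichain-sum Z p [] ch Zp = refl
  antichain-sum Z p (q ∷ cs) ((le , n) ∷ ch) Zp =
    trans (cong₂ _+ℚ_ (cong χ (¬true⇒false (λ Zq → n (proj₂ Z p q Zp Zq le)))) (antichain-sum Z p cs (skip ch) Zp)) (ℚ.+-identityˡ 0ℚ)
    where
    skip : ∀ {cs} → IsChain (q ∷ cs) → IsChain (p ∷ cs)
    skip [-] = [-]
    skip ((le' , n') ∷ ch) = (≼-trans le le' , λ { refl → n (≼-antisym le le') }) ∷ ch

  ind-Chain : ∀ (Z : Anti P) → ChainPoly (ind (proj₁ Z))
  ind-Chain Z = (λ p → χ≥0 (proj₁ Z p)) , bound
    where
    bound : ∀ cs → IsChain cs → sumL (ind (proj₁ Z)) cs ≤ℚ 1ℚ
    bound [] _ = toWitness {a? = 0ℚ ℚ.≤? 1ℚ} _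
    bound (p ∷ cs) ch with proj₁ Z p in Zp
    ... | true = ℚ.≤-reflexive (trans (cong (1ℚ +ℚ_) (antichain-sum Z p cs ch Zp)) (ℚ.+-identityʳ 1ℚ))
    ... | false = ℚ.≤-trans (ℚ.≤-reflexive (ℚ.+-identityˡ (sumL (ind (proj₁ Z)) cs))) (bound cs (tailᴸ ch))

  -- `SimplexFace` with the number of vertices `n` in place of `suc k`, so that it can be
  -- transported along an equation of lengths.
  Data : ℕ → Set
  Data n = Σ (Face ChainPoly) λ F → Σ (Fin n → Pt) λ v → AffInd v × SameSet (faceSet F) (Conv v)

  module SimplexOf (σ : Simp P) where
    n = length (pts σ)

    F : Face ChainPoly
    F = record { w = linear (face σ) ; c = - constant (face σ) ; valid = λ x h → below-plane (face σ) x (valid' x h) }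
      where
      valid' : ∀ x → ChainPoly x → ⟦ face σ ⟧ x ≤ℚ 0ℚ
      valid' x h = ℚ.≤-trans (ℚ.≤-reflexive (eval-terms D (face σ))) (lsum≤0 (face≤ σ) _ (Decomposition.pos D))
        where D = decomposition x h

    vtx : Fin n → Anti P
    vtx = lookup (pts σ)

    v : Fin n → Pt
    v i = ind (proj₁ (vtx i))

    -- Uniform in the total `s`: the value `0` serves affine independence and the value `1` convex
    -- combinations.
    combination : ∀ (μ : Fin n → ℚ) x s → sumF μ ≡ s → (∀ p → sumF (λ i → μ i *ℚ v i p) ≡ s *ℚ x p) → ∀ e → sumF (λ i → μ i *ℚ ⟦ e ⟧ (v i)) ≡ s *ℚ ⟦ e ⟧ x
    combination μ x s h g (con a) = trans (sumF-*ʳ a μ) (cong (_*ℚ a) h)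
    combination μ x s h g (var p) = g p
    combination μ x s h g (e ⊞ f) = trans (sumF-cong (λ i → ℚ.*-distribˡ-+ (μ i) (⟦ e ⟧ (v i)) (⟦ f ⟧ (v i)))) (trans (sumF-+ (λ i → μ i *ℚ ⟦ e ⟧ (v i)) (λ i → μ i *ℚ ⟦ f ⟧ (v i)))
      (trans (cong₂ _+ℚ_ (combination μ x s h g e) (combination μ x s h g f)) (sym (ℚ.*-distribˡ-+ s (⟦ e ⟧ x) (⟦ f ⟧ x)))))
    combination μ x s h g (a ⊠ e) = trans (sumF-cong (λ i → *-exchange (μ i) a (⟦ e ⟧ (v i)))) (trans (sumF-* a (λ i → μ i *ℚ ⟦ e ⟧ (v i)))
      (trans (cong (a *ℚ_) (combination μ x s h g e)) (*-exchange a s (⟦ e ⟧ x))))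

    -- The dual function of vertex `i`, applied to an affine dependence, leaves only the term of
    -- `μ i`.
    independent : AffInd v
    independent μ s h i with dual σ (vtx i) (A.lookup-∈ (pts σ) i)
    ... | u , u≢0 , u0 = *-zero-cancelˡ u≢0 (trans (ℚ.*-comm (⟦ u ⟧ (v i)) (μ i)) (trans (sym (sumF-only (λ j → μ j *ℚ ⟦ u ⟧ (v j)) i others))
        (trans (combination μ (λ _ → 0ℚ) 0ℚ s (λ p → trans (h p) (sym (ℚ.*-zeroˡ 0ℚ))) u) (ℚ.*-zeroˡ (⟦ u ⟧ (λ _ → 0ℚ))))))
      where
      others : ∀ j → j ≢ i → μ j *ℚ ⟦ u ⟧ (v j) ≡ 0ℚ
      others j j≢i = trans (cong (μ j *ℚ_) (u0 (vtx j) (A.lookup-∈ (pts σ) j) (λ e → j≢i (A.lookup-injective (uniq σ) j i e)))) (ℚ.*-zeroʳ (μ j))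

    -- Coefficients on the vertices of the simplex, gathered from a list that may repeat antichains.
    record Weights (L : List (ℚ × Anti P)) : Set where
      field
        μ   : Fin n → ℚ
        μ≥0 : ∀ i → 0ℚ ≤ℚ μ i
        sum : sumF μ ≡ lsum L (λ _ → 1ℚ)
        pt  : ∀ p → sumF (λ i → μ i *ℚ v i p) ≡ lsum L (λ Z → χ (proj₁ Z p))

    weights : ∀ L → All Positive L → All (λ t → ⟦ face σ ⟧ᵇ (proj₁ (proj₂ t)) ≡ 0ℚ) L → Weights L
    weights [] [] [] = record { μ = λ _ → 0ℚ ; μ≥0 = λ _ → ℚ.≤-refl ; sum = sumF-0 {n} (λ _ → 0ℚ) (λ _ → refl) ; pt = λ p → sumF-0 (λ i → 0ℚ *ℚ v i p) (λ i → ℚ.*-zeroˡ (v i p)) }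
    weights ((a , Z) ∷ L) ((a≥0 , _) ∷ ps) (t ∷ ts) with A.lookup-index (pts σ) Z (face→ σ Z t)
    ... | j , e = record
      { μ = λ i → a *ℚ δ j i +ℚ W.μ i
      ; μ≥0 = λ i → ℚ.≤-trans (ℚ.≤-reflexive (sym (ℚ.+-identityˡ 0ℚ))) (ℚ.+-mono-≤
                (ℚ.≤-trans (ℚ.≤-reflexive (sym (ℚ.*-zeroʳ a))) (ℚ.*-monoˡ-≤-nonNeg a {{nonNegative a≥0}} (δ≥0 j i))) (W.μ≥0 i))
      ; sum = trans (sumF-+ (λ i → a *ℚ δ j i) W.μ) (cong₂ _+ℚ_ (trans (sumF-* a (δ j)) (cong (a *ℚ_) (sumF-δ j))) W.sum)
      ; pt = λ p → trans (sumF-cong (λ i → trans (ℚ.*-distribʳ-+ (v i p) (a *ℚ δ j i) (W.μ i)) (cong (_+ℚ W.μ i *ℚ v i p) (ℚ.*-assoc a (δ j i) (v i p)))))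
               (trans (sumF-+ (λ i → a *ℚ (δ j i *ℚ v i p)) (λ i → W.μ i *ℚ v i p)) (cong₂ _+ℚ_
                 (trans (sumF-* a (λ i → δ j i *ℚ v i p)) (cong (a *ℚ_) (trans (sumF-δ* j (λ i → v i p)) (cong χ (sym (e p)))))) (W.pt p))) }
      where module W = Weights (weights L ps ts)

    sumL-Σ : ∀ (μ : Fin n → ℚ) x → (∀ p → x p ≡ sumF (λ i → μ i *ℚ v i p)) → ∀ cs → sumL x cs ≡ sumF (λ i → μ i *ℚ sumL (v i) cs)
    sumL-Σ μ x e [] = sym (sumF-0 (λ i → μ i *ℚ 0ℚ) (λ i → ℚ.*-zeroʳ (μ i)))
    sumL-Σ μ x e (c ∷ cs) = trans (cong₂ _+ℚ_ (e c) (sumL-Σ μ x e cs)) (sym (trans (sumF-cong (λ i → ℚ.*-distribˡ-+ (μ i) (v i c) (sumL (v i) cs))) (sumF-+ (λ i → μ i *ℚ v i c) (λ i → μ i *ℚ sumL (v i) cs))))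

    -- A point of the face decomposes into antichains, each of which is tight because nonpositive
    -- terms cannot cancel; so all of them are vertices of `σ`. The converse needs that antichain
    -- indicators lie in `C(P)`.
    face-is-conv : SameSet (faceSet F) (Conv v)
    face-is-conv x = forth , back
      where
      forth : faceSet F x → Conv v x
      forth (h , e) = W.μ , W.μ≥0 , trans W.sum (Decomposition.total D) , λ p → trans (Decomposition.points D p) (sym (W.pt p))
        where
        D = decomposition x h
        module W = Weights (weights (Decomposition.terms D) (Decomposition.pos D)
          (lsum≡0⁻ (face≤ σ) _ (Decomposition.pos D) (trans (sym (eval-terms D (face σ))) (on-plane⁻ (face σ) x e))))
      back : Conv v x → faceSet F x
      back (μ , μ≥0 , s , e) = (nonneg , bound) , on-plane (face σ) x tight
        where
        scaled : ∀ i {a b} → a ≤ℚ b → μ i *ℚ a ≤ℚ μ i *ℚ b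
        scaled i h = ℚ.*-monoˡ-≤-nonNeg (μ i) {{nonNegative (μ≥0 i)}} h
        nonneg : ∀ p → 0ℚ ≤ℚ x p
        nonneg p = ℚ.≤-trans (ℚ.≤-reflexive (sym (sumF-0 (λ i → μ i *ℚ 0ℚ) (λ i → ℚ.*-zeroʳ (μ i)))))
          (ℚ.≤-trans (sumF-mono (λ i → scaled i (proj₁ (ind-Chain (vtx i)) p))) (ℚ.≤-reflexive (sym (e p))))
        bound : ∀ cs → IsChain cs → sumL x cs ≤ℚ 1ℚ
        bound cs ch = ℚ.≤-trans (ℚ.≤-reflexive (sumL-Σ μ x e cs)) (ℚ.≤-trans (sumF-mono (λ i → scaled i (proj₂ (ind-Chain (vtx i)) cs ch)))
          (ℚ.≤-reflexive (trans (sumF-*ʳ 1ℚ μ) (trans (ℚ.*-identityʳ (sumF μ)) s))))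
        tight : ⟦ face σ ⟧ x ≡ 0ℚ
        tight = trans (sym (ℚ.*-identityˡ (⟦ face σ ⟧ x))) (trans (sym (combination μ x 1ℚ s (λ p → trans (sym (e p)) (sym (ℚ.*-identityˡ (x p)))) (face σ)))
          (sumF-0 (λ i → μ i *ℚ ⟦ face σ ⟧ (v i)) (λ i → trans (cong (μ i *ℚ_) (face← σ (vtx i) (A.lookup-∈ (pts σ) i))) (ℚ.*-zeroʳ (μ i)))))

    simplex : Data n
    simplex = F , v , independent , face-is-conv

  toFace : ∀ {k} (σ : Simp P) → length (pts σ) ≡ suc k → SimplexFace ChainPoly k
  toFace σ e = subst Data e (SimplexOf.simplex σ)

  toFace-face : ∀ {k} σ (e : length (pts σ) ≡ suc k) → proj₁ (toFace σ e) ≡ SimplexOf.F σ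
  toFace-face σ e = go e
    where
    go : ∀ {n} (e : length (pts σ) ≡ n) → proj₁ (subst Data e (SimplexOf.simplex σ)) ≡ SimplexOf.F σ
    go refl = refl

  face-reflects : ∀ σ τ → SameSet (faceSet (SimplexOf.F σ)) (faceSet (SimplexOf.F τ)) → pts σ A.~ pts τ
  face-reflects σ τ h = half σ τ (λ x → proj₁ (h x)) , half τ σ (λ x → proj₂ (h x))
    where
    half : ∀ σ τ → (∀ x → faceSet (SimplexOf.F σ) x → faceSet (SimplexOf.F τ) x) → pts σ A.⊆ pts τ
    half σ τ h Z m = face→ τ Z (on-plane⁻ (face τ) (ind (proj₁ Z)) (proj₂ (h (ind (proj₁ Z)) (ind-Chain Z , on-plane (face σ) (ind (proj₁ Z)) (face← σ Z m)))))

-- Induction over the family and comparison of counts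

¬¬-∀Fin : ∀ {n} {Q : Fin n → Set} → (∀ i → ¬ ¬ Q i) → ¬ ¬ (∀ i → Q i)
¬¬-∀Fin {zero} h k = k (λ ())
¬¬-∀Fin {suc n} h = ¬¬-bind (h zero) λ q → ¬¬-bind (¬¬-∀Fin (λ i → h (suc i))) λ qs k → k (λ { zero → q ; (suc i) → qs i })

¬¬-decOrder : ∀ P → ¬ ¬ DecOrder P
¬¬-decOrder P = ¬¬-bind (¬¬-∀Fin {Q = λ i → ∀ j → Dec (_≼_ P (from i) (from j))} (λ i → ¬¬-∀Fin (λ j → ¬¬-em _)))
  λ d k → k (λ p q → subst₂ (λ p q → Dec (_≼_ P p q)) (from-to p) (from-to q) (d (to p) (to q)))
  where
  open Inverse (enum P) using (to; from)
  open Elements P using (from-to)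

-- Decidability of the order passes from a composite poset to its parts and along isomorphisms, so
-- one decision at the top serves the whole induction.
bounds : ∀ {P} → InF P → DecOrder P → ¬ ¬ Bounds P
bounds (xfree x) d k = k (XFreeBounds.xfree-bounds _ d x)
bounds (union {A} {B} a b) d = ¬¬-bind (bounds a (Union.decA A B d)) λ HA → ¬¬-bind (bounds b (Union.decB A B d)) λ HB k →
  k (Union.bounds A B d HA HB)
bounds (ordsum {A} {B} a b) d = ¬¬-bind (bounds a (OrdinalSum.decA A B d)) λ HA → ¬¬-bind (bounds b (OrdinalSum.decB A B d)) λ HB →
  OrdinalSum.ordinalSum-bounds A B d HA HB
bounds (iso a φ) d = ¬¬-bind (bounds a (Isomorphism.iso-dec φ d)) λ H k → k (Isomorphism.iso-bounds φ H)

theorem4p1 : (P : FinPoset) → InF P → (k m m' : ℕ) →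
    s k [O P ]≡ m → s k [C P ]≡ m' → m ≤ m'
theorem4p1 P P∈F k m m' (o , o-inj , _) (c , _ , c-all) =
  decidable-stable (m ≤?ℕ m') (¬¬-bind (¬¬-decOrder P) λ d → ¬¬-bind (bounds P∈F d) λ H k → k (compare d H))
  where
  open Geometry P
  module OF = OrderFaces P
  compare : DecOrder P → Bounds P → m ≤ m'
  compare d H = injective⇒≤ {f = index} (λ {i} {j} → index-injective i j)
    where
    module CF = ChainFaces P d
    simp : Fin m → Simp P
    simp i = fun (Bounds.simplices H) (OF.toClique (o i))
    size≡ : ∀ i → length (Simp.pts (simp i)) ≡ suc k
    size≡ i = trans (deg≡ (Bounds.simplices H) (OF.toClique (o i))) (OF.toClique-length (o i))
    index : Fin m → Fin m'
    index i = proj₁ (c-all (CF.toFace (simp i) (size≡ i)))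
    index-same : ∀ i → SameSet (faceSet (CF.SimplexOf.F (simp i))) (faceSet (proj₁ (c (index i))))
    index-same i = subst (λ F → SameSet (faceSet F) (faceSet (proj₁ (c (index i))))) (CF.toFace-face (simp i) (size≡ i))
                         (proj₂ (c-all (CF.toFace (simp i) (size≡ i))))
    index-injective : ∀ i j → index i ≡ index j → i ≡ j
    index-injective i j e = o-inj i j (OF.toClique-reflects (o i) (o j) (inj (Bounds.simplices H) _ _ (CF.face-reflects (simp i) (simp j) same)))
      where
      same : SameSet (faceSet (CF.SimplexOf.F (simp i))) (faceSet (CF.SimplexOf.F (simp j)))
      same x = (λ h → proj₂ (index-same j x) (subst (λ t → faceSet (proj₁ (c t)) x) e (proj₁ (index-same i x) h))) ,
               (λ h → proj₂ (index-same i x) (subst (λ t → faceSet (proj₁ (c t)) x) (sym e) (proj₁ (index-same j x) h)))
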